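{- There exists $\delta>0$ such that for all $n$, if $A$ is an independent set of size at least $(1-\delta)(2n-3)!!$ in $\mathcal{M}_n$, then $A$ is contained in a star of $\mathcal{M}_n$.
   Context: The perfect matching graph $\mathcal{M}_n$ has as vertices all perfect matchings of the complete graph $\mathcal{K}_{2n}$ on $2n$ vertices, two matchings being adjacent iff they have no common edge. For an edge $\{a,b\}$ of $\mathcal{K}_{2n}$, the star $\mathcal{S}_{\{a,b\}}$ is the set of all perfect matchings containing $\{a,b\}$. $(2m-1)!!=(2m-1)(2m-3)\cdots1$, with $(-1)!!=1$. -}

module Defs where

open import Level using (0ℓ) renaming (suc to lsuc)
open import Data.Nat using (ℕ; zero; suc; _+_; _*_)
open import Data.Fin using (Fin; _<_)
open import Data.List using (List)
open import Data.List.Membership.Propositional using () renaming (_∈_ to _∈ₗ_)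
import Data.List.Relation.Unary.Unique.Setoid as USetoid
open import Data.Product using (∃!; _×_)
open import Data.Sum using (_⊎_)
open import Relation.Binary using (Rel; Setoid)
import Relation.Binary.Construct.On as On
open import Relation.Binary.PropositionalEquality using (_≡_)
open import Relation.Nullary using (¬_)
open import Relation.Unary using (Pred; _∈_; _∩_; Empty)
open import Relation.Unary.Relation.Binary.Equality using (≐-setoid)

-- An edge {a , b} of the complete graph on N vertices is stored with its
-- endpoints in increasing order; the order proof is irrelevant, so that _≡_
-- on edges is equality of unordered pairs.
record Edge (N : ℕ) : Set where
  constructor edge
  field
    lower upper  : Fin N
    .lower<upper : lower < upper

open Edge public

_IsEndOf_ : ∀ {N} → Fin N → Edge N → Set
v IsEndOf e = (v ≡ lower e) ⊎ (v ≡ upper e)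

-- Membership in `edges` is automatically decidable: compare an edge with the
-- unique edge of the matching at one of its endpoints.
record PerfectMatching (N : ℕ) : Set₁ where
  field
    edges   : Pred (Edge N) 0ℓ
    perfect : ∀ v → ∃! _≡_ (λ e → e ∈ edges × v IsEndOf e)

open PerfectMatching public

-- The vertices of the perfect matching graph 𝓜 n.  Two matchings are the same
-- vertex when they have the same edges.
Vertex : ℕ → Set₁
Vertex n = PerfectMatching (2 * n)

vertexSetoid : ℕ → Setoid (lsuc 0ℓ) 0ℓ
vertexSetoid n = On.setoid (≐-setoid (Edge (2 * n)) 0ℓ) edges

Adjacent : ∀ n → Rel (Vertex n) 0ℓ
Adjacent n M M′ = Empty (edges M ∩ edges M′)

-- A finite set of vertices is a list without repetitions up to the equality of
-- vertexSetoid; its size is then the length of the list.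
Distinct : ∀ n → List (Vertex n) → Set₁
Distinct n = USetoid.Unique (vertexSetoid n)

Independent : ∀ n → List (Vertex n) → Set₁
Independent n A = ∀ {M M′} → M ∈ₗ A → M′ ∈ₗ A → ¬ Adjacent n M M′

Star : ∀ n → Edge (2 * n) → Pred (Vertex n) 0ℓ
Star n e M = e ∈ edges M

-- [2 m -1]!! is (2m − 1)!! = (2m − 1)(2m − 3)⋯1, with (−1)!! = 1.
[2_-1]!! : ℕ → ℕ
[2 zero   -1]!! = 1
[2 suc m  -1]!! = (2 * m + 1) * [2 m -1]!!

{-# OPTIONS --safe #-}
module Submission where

-- For large n, suppose that A has no star containing more than 1/k of its members. Then for any fewer than k edges some
-- member of A avoids them all, and branching over the edges of such members k times bounds |A| by nᵏ (2n − 2k − 1)!!,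
-- which for k ≈ 2 log n is much smaller than (2n − 3)!!. So A has a heavy star, at ab say; branching over the members
-- containing ab bounds the rest of A in the same way. If some member M avoids ab, the members containing ab all meet M
-- and number at most (n − 2)(2n − 5)!!, about half of (2n − 3)!!: a contradiction.
--
-- For the remaining n, δ is so small that |A| ≥ (2n − 3)!!. By clique–coclique A then meets every 1-factorisation of
-- K₂ₙ. As A is not closed under switches, some M ∈ A contains ab and cd such that trading them for ac and bd leaves A.
-- In a 1-factorisation through M and a factor containing ac and bd, the two pairs of edges can be exchanged; comparing
-- the results shows that the other edges of M may be switched freely, so that A contains every matching through ab and
-- cd. Hence each member of A contains ab or cd, and the bound (n − 2)(2n − 5)!! for both stars leaves only one of them.

-- Each round of the branching trades an odd factor of the double factorial, at least 3n/2, for a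
-- factor n. The gain (2/3)ᵏ has to beat 1/(8n), which happens only for large n, and the remaining
-- cases, up to n = 1023, are far beyond enumeration. The equality case is therefore proved
-- uniformly in n, and for small n the constant δ only has to leave no room below (2n - 3)!!. For
-- large n three quarters of (2n - 3)!! suffice: a heavy star that some member avoids has at most
-- about one half, and the members outside it fall short of about a quarter. The exchange argument
-- needs a 1-factorisation in which the union of two factors contains a 4-cycle and the second of
-- them also a further prescribed edge. The rotational factorisation of K₂ₙ has no such 4-cycle if
-- 2n - 1 > 3 is prime, as any two of its factors form a Hamiltonian cycle. Here the rotation fixes
-- four vertices instead of one: the three matchings of the K₄ on them lie in three factors of their
-- own, and two of these make the 4-cycle.

module Matchings where

  open import Data.Bool using (Bool; true; false; not; _xor_; if_then_else_)
  open import Data.Fin using (Fin; zero; suc; fromℕ<; toℕ; join; splitAt)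
  open import Data.Fin.Patterns using (0F; 1F; 2F; 3F; 4F; 5F)
  open import Data.Fin.Permutation as Perm using (Permutation′; permutation; _⟨$⟩ʳ_; _⟨$⟩ˡ_; _∘ₚ_)
  import Data.Fin.Permutation.Components as PC
  import Data.Fin.Properties as Finₚ
  open import Data.List as List
    using (List; []; _∷_; _++_; length; filter; map; allFin; cartesianProduct; cartesianProductWith)
  import Data.List.Membership.DecPropositional as DecMembership
  open import Data.List.Membership.Propositional using (_∈_; _∉_; find; lose)
  open import Data.List.Membership.Propositional.Properties
    using (∈-filter⁺; ∈-filter⁻; ∈-∃++; ∈-++⁻; ∈-++⁺ˡ; ∈-++⁺ʳ; ∈-allFin; ∈-map⁻; ∈-lookup;
      ∈-cartesianProductWith⁺; ∈-cartesianProduct⁺; ∈-cartesianProduct⁻)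
  open import Data.List.Properties
    using (length-++; length-tabulate; length-map; length-filter; filter-accept; filter-all; filter-none)
  open import Data.List.Relation.Unary.All as All using (All; []; _∷_)
  import Data.List.Relation.Unary.All.Properties as Allₚ
  open import Data.List.Relation.Unary.AllPairs as AllPairs using (AllPairs; []; _∷_)
  import Data.List.Relation.Unary.AllPairs.Properties as AllPairsₚ
  open import Data.List.Relation.Unary.Any as Any using (Any; here; there)
  open import Data.List.Relation.Unary.Unique.Propositional using (Unique)
  open import Data.List.Relation.Unary.Unique.Propositional.Properties
    using (allFin⁺; cartesianProductWith⁺; cartesianProduct⁺)
    renaming (filter⁺ to Unique-filter⁺; map⁺ to Unique-map⁺)
  import Data.List.Relation.Unary.Unique.Setoid.Properties as UniqueSetoid
  open import Data.Nat
    using (ℕ; zero; suc; _+_; _*_; _∸_; _^_; _/_; _≤_; _<_; _≤′_; z≤n; s≤s; ≤′-refl; ≤′-step; NonZero; >-nonZero)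
  open import Data.Nat.DivMod using (_mod_; m≡m%n+[m/n]*n; m%n<n)
  open import Data.Nat.Properties
  open import Data.Nat.Solver using (module +-*-Solver)
  open import Data.Product using (_×_; _,_; ∃-syntax; proj₁; proj₂)
  open import Data.Sum using (_⊎_; inj₁; inj₂; [_,_]′)
  open import Data.Sum.Properties using (inj₁-injective; inj₂-injective)
  open import Data.Vec using (Vec; lookup; tabulate) renaming ([] to []ᵥ; _∷_ to _∷ᵥ_)
  open import Data.Vec.Properties using (∷-injective; lookup∘tabulate; tabulate∘lookup; tabulate-cong)
  open import Function using (_∘_; id)
  open import Level using (Level)
  open import Relation.Binary using (Setoid; tri<; tri≈; tri>)
  open import Relation.Binary.PropositionalEquality
  open import Relation.Nullary using (¬_; Dec; yes; no; contradiction; recompute; ¬?; _×-dec_; _⊎-dec_)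
  open import Relation.Nullary.Decidable using (dec-true; dec-false; toWitness)
  open import Relation.Unary using (Pred; Decidable)
  open import Relation.Unary.Properties using (∁?)
  open +-*-Solver using (solve; _:+_; _:*_; con; _:=_)
  open import Defs using ([2_-1]!!)

  -- Counting in filtered lists: covers and packings

  module _ {a p : Level} {X : Set a} {P : Pred X p} (P? : Decidable P) where

    length-filter-∁ : ∀ xs → length (filter P? xs) + length (filter (∁? P?) xs) ≡ length xs
    length-filter-∁ [] = refl
    length-filter-∁ (x ∷ xs) with P? x
    ... | yes _ = cong suc (length-filter-∁ xs)
    ... | no _  = trans (+-suc _ _) (cong suc (length-filter-∁ xs))

    length-filter-filter : ∀ {q} {Q : Pred X q} (Q? : Decidable Q) xs →
      length (filter P? (filter Q? xs)) ≤ length (filter P? xs)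
    length-filter-filter Q? [] = z≤n
    length-filter-filter Q? (x ∷ xs) with Q? x
    ... | yes _ with P? x
    ...   | yes _ = s≤s (length-filter-filter Q? xs)
    ...   | no _  = length-filter-filter Q? xs
    length-filter-filter Q? (x ∷ xs) | no _ with P? x
    ...   | yes _ = m≤n⇒m≤1+n (length-filter-filter Q? xs)
    ...   | no _  = length-filter-filter Q? xs

    filter-filter-⊆ : ∀ {q} {Q : Pred X q} (Q? : Decidable Q) xs → (∀ {x} → x ∈ xs → P x → Q x) →
      filter P? (filter Q? xs) ≡ filter P? xs
    filter-filter-⊆ Q? [] P⊆Q = refl
    filter-filter-⊆ Q? (x ∷ xs) P⊆Q with Q? x
    ... | yes _ with P? x
    ...   | yes _ = cong (x ∷_) (filter-filter-⊆ Q? xs (P⊆Q ∘ there))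
    ...   | no _  = filter-filter-⊆ Q? xs (P⊆Q ∘ there)
    filter-filter-⊆ Q? (x ∷ xs) P⊆Q | no ¬q with P? x
    ...   | yes p = contradiction (P⊆Q (here refl) p) ¬q
    ...   | no _  = filter-filter-⊆ Q? xs (P⊆Q ∘ there)

    AllPairs-filter⁺ : ∀ {r} {R : X → X → Set r} {xs} → AllPairs R xs → AllPairs R (filter P? xs)
    AllPairs-filter⁺ [] = []
    AllPairs-filter⁺ {xs = x ∷ xs} (r ∷ rs) with P? x
    ... | no _  = AllPairs-filter⁺ rs
    ... | yes _ = All.tabulate (All.lookup r ∘ proj₁ ∘ ∈-filter⁻ P?) ∷ AllPairs-filter⁺ rs

    length-filter≤1 : ∀ {r} {R : X → X → Set r} {xs} → AllPairs R xs → (∀ {x y} → P x → P y → ¬ R x y) →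
      length (filter P? xs) ≤ 1
    length-filter≤1 [] clash = z≤n
    length-filter≤1 {xs = x ∷ xs} (r ∷ rs) clash with P? x
    ... | no _   = length-filter≤1 rs clash
    ... | yes px = s≤s (≤-reflexive (cong length (filter-none P? (All.map (λ rxy py → clash px py rxy) r))))

  unique-⊆⇒length≤ : ∀ {a} {X : Set a} {xs ys : List X} → Unique xs → (∀ {x} → x ∈ xs → x ∈ ys) →
    length xs ≤ length ys
  unique-⊆⇒length≤ [] xs⊆ys = z≤n
  unique-⊆⇒length≤ {xs = x ∷ xs} (x∉ ∷ u) xs⊆ys with ∈-∃++ (xs⊆ys (here refl))
  ... | ys₁ , ys₂ , refl = begin
    suc (length xs)              ≤⟨ s≤s (unique-⊆⇒length≤ u xs⊆rest) ⟩
    suc (length (ys₁ ++ ys₂))    ≡⟨ cong suc (length-++ ys₁) ⟩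
    suc (length ys₁ + length ys₂) ≡⟨ sym (+-suc _ _) ⟩
    length ys₁ + suc (length ys₂) ≡⟨ sym (length-++ ys₁) ⟩
    length (ys₁ ++ x ∷ ys₂)      ∎
    where
    open ≤-Reasoning
    xs⊆rest : ∀ {y} → y ∈ xs → y ∈ ys₁ ++ ys₂
    xs⊆rest y∈xs with ∈-++⁻ ys₁ (xs⊆ys (there y∈xs))
    ... | inj₁ y∈ys₁          = ∈-++⁺ˡ y∈ys₁
    ... | inj₂ (here refl)    = contradiction refl (All.lookup x∉ y∈xs)
    ... | inj₂ (there y∈ys₂)  = ∈-++⁺ʳ ys₁ y∈ys₂

  module _ {a b p : Level} {X : Set a} {Y : Set b} {P : X → Y → Set p} (P? : ∀ x → Decidable (P x)) where

    length≤cover : ∀ c (xs : List X) (ys : List Y) →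
      (∀ {y} → y ∈ ys → ∃[ x ] (x ∈ xs × P x y)) →
      (∀ {x} → x ∈ xs → length (filter (P? x) ys) ≤ c) →
      length ys ≤ length xs * c
    length≤cover c [] [] covers small = z≤n
    length≤cover c [] (y ∷ ys) covers small with covers (here refl)
    ... | _ , () , _
    length≤cover c (x ∷ xs) ys covers small = begin
      length ys                        ≡⟨ sym (length-filter-∁ (P? x) ys) ⟩
      length (filter (P? x) ys) + length rest  ≤⟨ +-mono-≤ (small (here refl)) (length≤cover c xs rest covers′ small′) ⟩
      c + length xs * c                ∎
      where
      open ≤-Reasoning
      rest = filter (∁? (P? x)) ys
      covers′ : ∀ {y} → y ∈ rest → ∃[ x ] (x ∈ xs × P x y)
      covers′ y∈ with ∈-filter⁻ (∁? (P? x)) y∈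
      ... | y∈ys , ¬p with covers y∈ys
      ...   | _ , here refl , p = contradiction p ¬p
      ...   | z , there z∈ , p  = z , z∈ , p
      small′ : ∀ {z} → z ∈ xs → length (filter (P? z) rest) ≤ c
      small′ {z} z∈ = ≤-trans (length-filter-filter (P? z) (∁? (P? x)) ys) (small (there z∈))

    -- The inequality is strict because `y₀` lies in none of the disjoint classes. The
    -- clique-coclique bound depends on this: its two sides may be equal, and one uncounted element
    -- is then a contradiction.
    packing<length : ∀ {r} {R : X → X → Set r} c {y₀} {xs : List X} {ys : List Y} → AllPairs R xs →
      (∀ {x x′ y} → x ∈ xs → x′ ∈ xs → R x x′ → y ∈ ys → P x y → ¬ P x′ y) →
      (∀ {x} → x ∈ xs → c ≤ length (filter (P? x) ys)) →
      y₀ ∈ ys → (∀ {x} → x ∈ xs → ¬ P x y₀) →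
      length xs * c < length ys
    packing<length c {ys = _ ∷ _} [] disjoint large y₀∈ys missed = s≤s z≤n
    packing<length {R = R} c {y₀} {x ∷ xs} {ys} (r ∷ rs) disjoint large y₀∈ys missed = begin-strict
      c + length xs * c                        <⟨ +-mono-≤-< (large (here refl)) rest-large ⟩
      length (filter (P? x) ys) + length rest  ≡⟨ length-filter-∁ (P? x) ys ⟩
      length ys                                ∎
      where
      open ≤-Reasoning
      rest = filter (∁? (P? x)) ys
      rest⊆ : ∀ {y} → y ∈ rest → y ∈ ys
      rest⊆ = proj₁ ∘ ∈-filter⁻ (∁? (P? x))
      rest-large : length xs * c < length rest
      rest-large = packing<length c rs
        (λ x∈ x′∈ q y∈ → disjoint (there x∈) (there x′∈) q (rest⊆ y∈))
        (λ {z} z∈ → subst (c ≤_) (sym (cong length (filter-filter-⊆ (P? z) (∁? (P? x)) ys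
          (λ y∈ pz px → disjoint (here refl) (there z∈) (All.lookup r z∈) y∈ px pz)))) (large (there z∈)))
        (∈-filter⁺ (∁? (P? x)) y₀∈ys (missed (here refl)))
        (missed ∘ there)

  module _ {N : ℕ} where

    infixl 6 _∖_
    _∖_ : List (Fin N) → Fin N → List (Fin N)
    W ∖ v = filter (λ x → ¬? (x Finₚ.≟ v)) W

    ∈-∖⁺ : ∀ {W x v} → x ∈ W → x ≢ v → x ∈ W ∖ v
    ∈-∖⁺ {v = v} = ∈-filter⁺ (λ x → ¬? (x Finₚ.≟ v))

    ∈-∖⁻ : ∀ {W x v} → x ∈ W ∖ v → x ∈ W × x ≢ v
    ∈-∖⁻ {v = v} = ∈-filter⁻ (λ x → ¬? (x Finₚ.≟ v))

    ∖-unique : ∀ {W v} → Unique W → Unique (W ∖ v)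
    ∖-unique {v = v} = Unique-filter⁺ (λ x → ¬? (x Finₚ.≟ v))

    ∖-∉ : ∀ {W v} → v ∉ W → W ∖ v ≡ W
    ∖-∉ {[]} v∉ = refl
    ∖-∉ {x ∷ W} {v} v∉ with x Finₚ.≟ v
    ... | yes refl = contradiction (here refl) v∉
    ... | no _     = cong (x ∷_) (∖-∉ (v∉ ∘ there))

    length-∖ : ∀ {W v} → Unique W → v ∈ W → suc (length (W ∖ v)) ≡ length W
    length-∖ {x ∷ W} {v} (x∉ ∷ u) v∈ with x Finₚ.≟ v
    ... | yes refl = cong (suc ∘ length) (∖-∉ (λ v∈W → All.lookup x∉ v∈W refl))
    length-∖ {x ∷ W} (x∉ ∷ u) (here refl) | no x≢v = contradiction refl x≢v
    length-∖ {x ∷ W} (x∉ ∷ u) (there v∈)  | no x≢v = cong suc (length-∖ u v∈)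

    _∈?_ : ∀ (x : Fin N) W → Dec (x ∈ W)
    _∈?_ = DecMembership._∈?_ Finₚ._≟_

    length-allFin : length (allFin N) ≡ N
    length-allFin = length-tabulate id

    fresh : ∀ xs → length xs < N → ∃[ z ] z ∉ xs
    fresh xs short with Finₚ.any? (λ z → ¬? (z ∈? xs))
    ... | yes found = found
    ... | no none   = contradiction short (≤⇒≯ (subst (_≤ length xs) length-allFin
      (unique-⊆⇒length≤ (allFin⁺ N) (λ {z} _ → all-∈ z))))
      where
      all-∈ : ∀ z → z ∈ xs
      all-∈ z with z ∈? xs
      ... | yes z∈ = z∈
      ... | no z∉  = contradiction (z , z∉) none

  -- Counting matchings with prescribed edges

  -- Elements of `X` are seen only through `μ`, and several of them may induce the same map. This
  -- lets one count serve twice: for matchings themselves, and for permutations acting on a fixed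
  -- matching, where the multiplicity is that of a stabiliser.
  module Assignments {N : ℕ} {X : Set} (μ : X → Fin N → Fin N) where

    _⟨_↦_⟩ : List X → Fin N → Fin N → List X
    B ⟨ v ↦ w ⟩ = filter (λ x → μ x v Finₚ.≟ w) B

    _≗?_ : ∀ x y → Dec (∀ v → μ x v ≡ μ y v)
    x ≗? y = Finₚ.all? (λ v → μ x v Finₚ.≟ μ y v)

    -- The invariant of every branching below: outside `W` the members of `B` are one and the same
    -- partial matching, inside `W` each is a perfect matching of `W`.
    record Free (W : List (Fin N)) (B : List X) : Set where
      field
        involutive  : ∀ {x} → x ∈ B → ∀ v → μ x (μ x v) ≡ v
        irreflexive : ∀ {x} → x ∈ B → ∀ v → μ x v ≢ v
        unique      : Unique W
        closed      : ∀ {x v} → x ∈ B → v ∈ W → μ x v ∈ W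
        determined  : ∀ {x y v} → x ∈ B → y ∈ B → v ∉ W → μ x v ≡ μ y v

    ∈-⟨⟩⁻ : ∀ {B v w x} → x ∈ B ⟨ v ↦ w ⟩ → x ∈ B × μ x v ≡ w
    ∈-⟨⟩⁻ {v = v} {w} = ∈-filter⁻ (λ x → μ x v Finₚ.≟ w)

    ∈-⟨⟩⁺ : ∀ {B v w x} → x ∈ B → μ x v ≡ w → x ∈ B ⟨ v ↦ w ⟩
    ∈-⟨⟩⁺ {v = v} {w} = ∈-filter⁺ (λ x → μ x v Finₚ.≟ w)

    module _ {W : List (Fin N)} {B : List X} {v w : Fin N} (F : Free W B) where
      open Free F

      fix-edge : Free (W ∖ v ∖ w) (B ⟨ v ↦ w ⟩)
      fix-edge = record
        { involutive  = involutive ∘ proj₁ ∘ ∈-⟨⟩⁻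
        ; irreflexive = irreflexive ∘ proj₁ ∘ ∈-⟨⟩⁻
        ; unique      = ∖-unique (∖-unique unique)
        ; closed      = closed′
        ; determined  = determined′
        }
        where
        closed′ : ∀ {x u} → x ∈ B ⟨ v ↦ w ⟩ → u ∈ W ∖ v ∖ w → μ x u ∈ W ∖ v ∖ w
        closed′ {x} {u} x∈ u∈ =
          let x∈B , μv≡w = ∈-⟨⟩⁻ x∈
              u∈′ , u≢w  = ∈-∖⁻ u∈
              u∈W , u≢v  = ∈-∖⁻ u∈′
              inv        = involutive x∈B
          in ∈-∖⁺ (∈-∖⁺ (closed x∈B u∈W)
               (λ e → u≢w (trans (sym (inv u)) (trans (cong (μ x) e) μv≡w))))
               (λ e → u≢v (trans (sym (inv u)) (trans (cong (μ x) (trans e (sym μv≡w))) (inv v))))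

        determined′ : ∀ {x y u} → x ∈ B ⟨ v ↦ w ⟩ → y ∈ B ⟨ v ↦ w ⟩ → u ∉ W ∖ v ∖ w → μ x u ≡ μ y u
        determined′ {x} {y} {u} x∈ y∈ u∉ with ∈-⟨⟩⁻ x∈ | ∈-⟨⟩⁻ y∈ | u ∈? W | u Finₚ.≟ v | u Finₚ.≟ w
        ... | x∈B , xv | y∈B , yv | no u∉W | _ | _ = determined x∈B y∈B u∉W
        ... | x∈B , xv | y∈B , yv | yes _ | yes refl | _ = trans xv (sym yv)
        ... | x∈B , xv | y∈B , yv | yes _ | no _ | yes refl = trans (back x∈B xv) (sym (back y∈B yv))
          where
          back : ∀ {z} → z ∈ B → μ z v ≡ w → μ z w ≡ v
          back {z} z∈ e = trans (cong (μ z) (sym e)) (involutive z∈ v)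
        ... | _ | _ | yes u∈W | no u≢v | no u≢w = contradiction (∈-∖⁺ (∈-∖⁺ u∈W u≢v) u≢w) u∉

      length-fix-edge : ∀ {r} → length W ≡ 2 * suc r → v ∈ W → w ∈ W → v ≢ w → length (W ∖ v ∖ w) ≡ 2 * r
      length-fix-edge {r} |W| v∈ w∈ v≢w = suc-injective (suc-injective (begin
        suc (suc (length (W ∖ v ∖ w))) ≡⟨ cong suc (length-∖ (∖-unique unique) (∈-∖⁺ w∈ (v≢w ∘ sym))) ⟩
        suc (length (W ∖ v))           ≡⟨ length-∖ unique v∈ ⟩
        length W                       ≡⟨ |W| ⟩
        2 * suc r                      ≡⟨ *-suc 2 r ⟩
        suc (suc (2 * r))              ∎))
        where open ≡-Reasoning

    length-class : ∀ {c} B → (∀ {x} → x ∈ B → length (filter (_≗? x) B) ≤ c) →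
      (∀ {x y} → x ∈ B → y ∈ B → ∀ v → μ x v ≡ μ y v) → length B ≤ c
    length-class [] small agree = z≤n
    length-class (x ∷ B) small agree =
      subst (λ L → length L ≤ _) (filter-all (_≗? x) (All.tabulate (λ y∈ → agree y∈ (here refl)))) (small (here refl))

    -- The first vertex of `W` has an odd number `2 * r + 1` of possible partners (with `r` one less
    -- than at the start), and each choice removes two vertices from `W`; these numbers multiply to
    -- the double factorial, and `c` bounds the multiplicity left at the end.
    length-free : ∀ c r {W} B → Free W B → length W ≡ 2 * r →
      (∀ {x} → x ∈ B → length (filter (_≗? x) B) ≤ c) → length B ≤ [2 r -1]!! * c
    length-free c zero {[]} B F |W| small =
      subst (length B ≤_) (sym (*-identityˡ c)) (length-class B small (λ x∈ y∈ v → Free.determined F x∈ y∈ λ ()))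
    length-free c (suc r) {v ∷ W} B F |W| small = begin
      length B                          ≤⟨ length≤cover {P = λ w x → μ x v ≡ w} (λ w x → μ x v Finₚ.≟ w) _ W B covers small′ ⟩
      length W * ([2 r -1]!! * c)       ≡⟨ cong (_* ([2 r -1]!! * c)) |W|′ ⟩
      (2 * r + 1) * ([2 r -1]!! * c)    ≡⟨ sym (*-assoc (2 * r + 1) [2 r -1]!! c) ⟩
      (2 * r + 1) * [2 r -1]!! * c      ∎
      where
      open ≤-Reasoning
      open Free F
      |W|′ : length W ≡ 2 * r + 1
      |W|′ = trans (suc-injective (trans |W| (*-suc 2 r))) (+-comm 1 (2 * r))
      ≢v : ∀ {x} → x ∈ B → μ x v ≢ v
      ≢v x∈ = irreflexive x∈ v
      v∉W : v ∉ W
      v∉W v∈W with unique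
      ... | v∉ ∷ _ = All.lookup v∉ v∈W refl
      covers : ∀ {x} → x ∈ B → ∃[ w ] (w ∈ W × μ x v ≡ w)
      covers x∈ with closed x∈ (here refl)
      ... | here e   = contradiction e (≢v x∈)
      ... | there w∈ = _ , w∈ , refl
      small′ : ∀ {w} → w ∈ W → length (B ⟨ v ↦ w ⟩) ≤ [2 r -1]!! * c
      small′ {w} w∈ = length-free c r (B ⟨ v ↦ w ⟩) (fix-edge F)
        (length-fix-edge F |W| (here refl) (there w∈) (λ v≡w → v∉W (subst (_∈ W) (sym v≡w) w∈)))
        (λ {x} x∈ → ≤-trans (length-filter-filter (_≗? x) (λ y → μ y v Finₚ.≟ w) B) (small (proj₁ (∈-⟨⟩⁻ x∈))))

  record Mat (N : ℕ) : Set where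
    field
      mate        : Fin N → Fin N
      involutive  : ∀ v → mate (mate v) ≡ v
      irreflexive : ∀ v → mate v ≢ v

  open Mat public

  infix 4 _≈_
  _≈_ : ∀ {N} → Mat N → Mat N → Set
  X ≈ Y = ∀ v → mate X v ≡ mate Y v

  Meets : ∀ {N} → Mat N → Mat N → Set
  Meets X Y = ∃[ v ] mate X v ≡ mate Y v

  mate-flip : ∀ {N} (X : Mat N) {v w} → mate X v ≡ w → mate X w ≡ v
  mate-flip X {v} e = trans (cong (mate X) (sym e)) (involutive X v)

  mate-injective : ∀ {N} (X : Mat N) {v w} → mate X v ≡ mate X w → v ≡ w
  mate-injective X e = trans (sym (mate-flip X e)) (involutive X _)

  Distinctₘ : ∀ {N} → List (Mat N) → Set
  Distinctₘ = AllPairs (λ X Y → ¬ X ≈ Y)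

  Intersecting : ∀ {N} → List (Mat N) → Set
  Intersecting A = ∀ {X Y} → X ∈ A → Y ∈ A → Meets X Y

  module _ {N : ℕ} where
    open Assignments {N} mate public

    lowers : Mat N → List (Fin N)
    lowers X = filter (λ v → v Finₚ.<? mate X v) (allFin N)

    lowers-unique : ∀ X → Unique (lowers X)
    lowers-unique X = Unique-filter⁺ (λ v → v Finₚ.<? mate X v) (allFin⁺ N)

    -- `mate X` maps `lowers X` injectively into its complement.
    length-lowers : ∀ {n} → N ≡ 2 * n → ∀ X → length (lowers X) ≤ n
    length-lowers {n} N≡2n X = *-cancelˡ-≤ 2 (begin
      2 * length (lowers X)                       ≡⟨ cong (length (lowers X) +_) (+-identityʳ _) ⟩
      length (lowers X) + length (lowers X)       ≡⟨ cong (length (lowers X) +_) (sym (length-map (mate X) (lowers X))) ⟩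
      length (lowers X) + length (map (mate X) (lowers X))
        ≤⟨ +-monoʳ-≤ (length (lowers X)) (unique-⊆⇒length≤ (Unique-map⁺ (mate-injective X) (lowers-unique X)) upper) ⟩
      length (lowers X) + length (filter (∁? L?) (allFin N)) ≡⟨ length-filter-∁ L? (allFin N) ⟩
      length (allFin N)                           ≡⟨ length-allFin ⟩
      N                                           ≡⟨ N≡2n ⟩
      2 * n                                       ∎)
      where
      open ≤-Reasoning
      L? = λ v → v Finₚ.<? mate X v
      upper : ∀ {w} → w ∈ map (mate X) (lowers X) → w ∈ filter (∁? L?) (allFin N)
      upper w∈ with ∈-map⁻ (mate X) w∈
      ... | v , v∈ , refl = ∈-filter⁺ (∁? L?) (∈-allFin _)
        (λ lt → Finₚ.<-asym (proj₂ (∈-filter⁻ L? {xs = allFin N} v∈)) (subst (mate X v Data.Fin.<_) (involutive X v) lt))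

    lesser : Mat N → Fin N → Fin N
    lesser X v with v Finₚ.<? mate X v
    ... | yes _ = v
    ... | no  _ = mate X v

    lesser-cases : ∀ X v → lesser X v ≡ v ⊎ lesser X v ≡ mate X v
    lesser-cases X v with v Finₚ.<? mate X v
    ... | yes _ = inj₁ refl
    ... | no  _ = inj₂ refl

    lesser-∈ : ∀ X v → lesser X v ∈ lowers X
    lesser-∈ X v with v Finₚ.<? mate X v
    ... | yes lt = ∈-filter⁺ (λ v → v Finₚ.<? mate X v) (∈-allFin v) lt
    ... | no ¬lt = ∈-filter⁺ (λ v → v Finₚ.<? mate X v) (∈-allFin _)
      (subst (mate X v Data.Fin.<_) (sym (involutive X v)) (Finₚ.≤∧≢⇒< (≮⇒≥ ¬lt) (irreflexive X v)))

    -- One vertex for each edge of `X` inside `W`. Branching over all vertices instead would cost a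
    -- factor 2 per round and exceed the double factorial.
    slots : Mat N → List (Fin N) → List (Fin N)
    slots X W = filter (λ v → v ∈? W ×-dec mate X v ∈? W) (lowers X)

    length-distinct-free : ∀ r {W B} → Distinctₘ B → Free W B → length W ≡ 2 * r → length B ≤ [2 r -1]!!
    length-distinct-free r {W} {B} distinct F |W| =
      subst (length B ≤_) (*-identityʳ _) (length-free 1 r B F |W|
        (λ {X} _ → length-filter≤1 (_≗? X) distinct (λ Y≈X Z≈X Y≉Z → Y≉Z (λ v → trans (Y≈X v) (sym (Z≈X v))))))

    length-meeting : ∀ {W B} c r (X : Mat N) → Free W B → length W ≡ 2 * suc r →
      (∀ {Y} → Y ∈ B → ∃[ v ] (v ∈ W × mate Y v ≡ mate X v)) →
      (∀ {v} → v ∈ W → mate X v ∈ W → length (W ∖ v ∖ mate X v) ≡ 2 * r → length (B ⟨ v ↦ mate X v ⟩) ≤ c) →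
      length B ≤ length (slots X W) * c
    length-meeting {W} {B} c r X F |W| meets small =
      length≤cover {P = λ v Y → mate Y v ≡ mate X v} (λ v Y → mate Y v Finₚ.≟ mate X v) c (slots X W) B covers small′
      where
      open Free F using (closed)
      S? = λ v → v ∈? W ×-dec mate X v ∈? W
      covers : ∀ {Y} → Y ∈ B → ∃[ v ] (v ∈ slots X W × mate Y v ≡ mate X v)
      covers {Y} Y∈ with meets Y∈
      ... | v , v∈ , e with lesser-cases X v | lesser-∈ X v
      ...   | inj₁ e′ | l∈ = lesser X v , ∈-filter⁺ S? l∈ (subst (λ u → u ∈ W × mate X u ∈ W) (sym e′)
                               (v∈ , subst (_∈ W) e (closed Y∈ v∈))) , subst (λ u → mate Y u ≡ mate X u) (sym e′) e
      ...   | inj₂ e′ | l∈ = lesser X v , ∈-filter⁺ S? l∈ (subst (λ u → u ∈ W × mate X u ∈ W) (sym e′)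
                               (subst (_∈ W) e (closed Y∈ v∈) , subst (_∈ W) (sym (involutive X v)) v∈)) ,
                             subst (λ u → mate Y u ≡ mate X u) (sym e′)
                               (trans (mate-flip Y e) (sym (involutive X v)))
      small′ : ∀ {v} → v ∈ slots X W → length (B ⟨ v ↦ mate X v ⟩) ≤ c
      small′ {v} v∈ = let _ , v∈W , w∈W = ∈-filter⁻ S? {xs = lowers X} v∈ in
        small v∈W w∈W (length-fix-edge F |W| v∈W w∈W (irreflexive X v ∘ sym))

    free-all : ∀ B → Free (allFin N) B
    free-all B = record
      { involutive = λ {X} _ → involutive X ; irreflexive = λ {X} _ → irreflexive X
      ; unique = allFin⁺ N ; closed = λ _ _ → ∈-allFin _
      ; determined = λ _ _ v∉ → contradiction (∈-allFin _) v∉ }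

    module _ {n : ℕ} (N≡2n : N ≡ 2 * suc (suc n)) where

      |allFin| : length (allFin N) ≡ 2 * suc (suc n)
      |allFin| = trans length-allFin N≡2n

      -- A member containing ab meets `X` in an edge off a and b. As `X` avoids ab, two different
      -- edges of `X` touch a or b, which leaves at most `n` of its `2 + n` edges to branch over;
      -- fixing one of them next to ab leaves 2n free vertices.
      star-split-≤ : ∀ {A a b} → Distinctₘ A → Intersecting A → a ≢ b → ∀ {X} → X ∈ A → mate X a ≢ b →
        length (A ⟨ a ↦ b ⟩) ≤ n * [2 n -1]!!
      star-split-≤ {A} {a} {b} distinct intersecting a≢b {X} X∈ Xa≢b = begin
        length (A ⟨ a ↦ b ⟩)                 ≤⟨ length-meeting [2 n -1]!! n X F |W| meets small ⟩
        length (slots X W) * [2 n -1]!!      ≤⟨ *-monoˡ-≤ [2 n -1]!! |slots| ⟩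
        n * [2 n -1]!!                       ∎
        where
        open ≤-Reasoning
        W = allFin N ∖ a ∖ b
        F = fix-edge {v = a} {b} (free-all A)
        |W| : length W ≡ 2 * suc n
        |W| = length-fix-edge (free-all A) {suc n} |allFin| (∈-allFin a) (∈-allFin b) a≢b
        ∈W : ∀ {v} → v ≢ a → v ≢ b → v ∈ W
        ∈W v≢a v≢b = ∈-∖⁺ (∈-∖⁺ (∈-allFin _) v≢a) v≢b
        meets : ∀ {Y} → Y ∈ A ⟨ a ↦ b ⟩ → ∃[ v ] (v ∈ W × mate Y v ≡ mate X v)
        meets {Y} Y∈ with ∈-⟨⟩⁻ Y∈
        ... | Y∈A , Ya≡b with intersecting Y∈A X∈
        ...   | v , e = v , ∈W (λ { refl → Xa≢b (trans (sym e) Ya≡b) })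
                               (λ { refl → Xa≢b (mate-flip X (trans (sym e) (mate-flip Y Ya≡b))) }) , e
        small : ∀ {v} → v ∈ W → mate X v ∈ W → length (W ∖ v ∖ mate X v) ≡ 2 * n →
          length (A ⟨ a ↦ b ⟩ ⟨ v ↦ mate X v ⟩) ≤ [2 n -1]!!
        small _ _ |W′| = length-distinct-free n
          (AllPairs-filter⁺ _ (AllPairs-filter⁺ _ distinct)) (fix-edge F) |W′|
        ∉W : ∀ {v} → v ≡ a ⊎ v ≡ b → v ∉ W
        ∉W v≡ v∈ with ∈-∖⁻ v∈
        ... | v∈′ , v≢b = [ proj₂ (∈-∖⁻ {W = allFin N} v∈′) , v≢b ]′ v≡
        off : ∀ {v u} → v ≡ a ⊎ v ≡ b → u ∈ slots X W → u ≢ lesser X v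
        off {v} v≡ u∈ u≡ with lesser-cases X v | ∈-filter⁻ (λ v → v ∈? W ×-dec mate X v ∈? W) {xs = lowers X} u∈
        ... | inj₁ e | _ , u∈W , _ = ∉W v≡ (subst (_∈ W) (trans u≡ e) u∈W)
        ... | inj₂ e | _ , _ , Xu∈W = ∉W v≡ (subst (_∈ W) (trans (cong (mate X) (trans u≡ e)) (involutive X v)) Xu∈W)
        la = lesser X a
        lb = lesser X b
        la≢lb : la ≢ lb
        la≢lb e with lesser-cases X a | lesser-cases X b
        ... | inj₁ p | inj₁ q = a≢b (trans (sym p) (trans e q))
        ... | inj₁ p | inj₂ q = Xa≢b (mate-flip X (trans (sym q) (trans (sym e) p)))
        ... | inj₂ p | inj₁ q = Xa≢b (trans (sym p) (trans e q))
        ... | inj₂ p | inj₂ q = a≢b (mate-injective X (trans (sym p) (trans e q)))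
        |slots| : length (slots X W) ≤ n
        |slots| = ≤-pred (≤-pred (begin
          2 + length (slots X W)          ≤⟨ s≤s (s≤s (unique-⊆⇒length≤ (Unique-filter⁺ _ (lowers-unique X))
            (λ u∈ → ∈-∖⁺ (∈-∖⁺ (proj₁ (∈-filter⁻ (λ v → v ∈? W ×-dec mate X v ∈? W) {xs = lowers X} u∈)) (off (inj₁ refl) u∈)) (off (inj₂ refl) u∈)))) ⟩
          2 + length (lowers X ∖ la ∖ lb) ≡⟨ cong suc (length-∖ (∖-unique (lowers-unique X)) (∈-∖⁺ (lesser-∈ X b) (la≢lb ∘ sym))) ⟩
          1 + length (lowers X ∖ la)      ≡⟨ length-∖ (lowers-unique X) (lesser-∈ X a) ⟩
          length (lowers X)               ≤⟨ length-lowers N≡2n X ⟩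
          2 + n                           ∎))

  -- Branching, and stability for large n

  length-empty : ∀ {a} {X : Set a} {xs : List X} {c} → (∀ {x} → x ∉ xs) → length xs ≤ c
  length-empty {xs = []} empty = z≤n
  length-empty {xs = x ∷ xs} empty = contradiction (here refl) empty

  module _ {N : ℕ} where

    Edges : Set
    Edges = List (Fin N × Fin N)

    Contains : Mat N → Edges → Set
    Contains X = All (λ { (v , w) → mate X v ≡ w })

    Avoids : Mat N → Edges → Set
    Avoids X = All (λ { (v , w) → mate X v ≢ w })

    avoids? : ∀ es X → Dec (Avoids X es)
    avoids? es X = All.all? (λ { (v , w) → ¬? (mate X v Finₚ.≟ w) }) es

    avoiding-member : ∀ c {B : List (Mat N)} es →
      (∀ {v w} → (v , w) ∈ es → length (B ⟨ v ↦ w ⟩) ≤ c) →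
      length es * c < length B → ∃[ X ] (X ∈ B × Avoids X es)
    avoiding-member c {B} es small large with Any.any? (avoids? es) B
    ... | yes found = find found
    ... | no none   = contradiction
      (length≤cover {P = λ { (v , w) X → mate X v ≡ w }} (λ { (v , w) X → mate X v Finₚ.≟ w }) c es B covers small)
      (<⇒≱ large)
      where
      covers : ∀ {X} → X ∈ B → ∃[ e ] (e ∈ es × mate X (proj₁ e) ≡ proj₂ e)
      covers {X} X∈ with Any.any? (λ { (v , w) → mate X v Finₚ.≟ w }) es
      ... | yes e = find e
      ... | no ¬e = contradiction (lose X∈ (All.tabulate (λ e∈ eq → ¬e (lose e∈ eq)))) none

    -- A blocker need not belong to `C`, and it is demanded only for edge lists contained in some
    -- member of `C`. Both liberties serve the second round of `dominant-star`, where the blockers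
    -- come from a heavy star and the members of `C` avoid it.
    module _ {n : ℕ} (N≡2n : N ≡ 2 * n) (K : ℕ) {C : List (Mat N)} (distinct : Distinctₘ C)
      (blocker : ∀ es → length es < K → ∀ {Y} → Y ∈ C → Contains Y es →
        ∃[ X ] (Avoids X es × (∀ {Z} → Z ∈ C → Meets Z X))) where

      -- The blocker avoids the fixed edges, and all vertices outside `W` are ends of fixed edges.
      -- So the edge it shares with a member of `B` lies inside `W`, and one of its at most `n`
      -- edges can be fixed next.
      length-branching : ∀ k r es {W B} → k + length es ≡ K → length W ≡ 2 * (k + r) → Free W B →
        Distinctₘ B → (∀ {Y} → Y ∈ B → Y ∈ C × Contains Y es) →
        (∀ {u} → u ∉ W → ∃[ e ] (e ∈ es × (u ≡ proj₁ e ⊎ u ≡ proj₂ e))) →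
        length B ≤ n ^ k * [2 r -1]!!
      length-branching zero r es k+ |W| F dB B⊆ ends =
        subst (_ ≤_) (sym (*-identityˡ _)) (length-distinct-free r dB F |W|)
      length-branching (suc k) r es {B = []} k+ |W| F dB B⊆ ends = z≤n
      length-branching (suc k) r es {W} {B@(Y₀ ∷ _)} k+ |W| F dB B⊆ ends
        with blocker es (subst (suc (length es) ≤_) k+ (s≤s (m≤n+m (length es) k)))
               (proj₁ (B⊆ (here refl))) (proj₂ (B⊆ (here refl)))
      ... | X , avoids , meetsX = begin
        length B                                           ≤⟨ length-meeting _ (k + r) X F |W| meets small ⟩
        length (slots X W) * (n ^ k * [2 r -1]!!)          ≤⟨ *-monoˡ-≤ (n ^ k * [2 r -1]!!) (≤-trans (length-filter (λ v → v ∈? W ×-dec mate X v ∈? W) (lowers X)) (length-lowers {n = n} N≡2n X)) ⟩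
        n * (n ^ k * [2 r -1]!!)                           ≡⟨ sym (*-assoc n (n ^ k) _) ⟩
        n * n ^ k * [2 r -1]!!                             ∎
        where
        open ≤-Reasoning
        meets : ∀ {Y} → Y ∈ B → ∃[ v ] (v ∈ W × mate Y v ≡ mate X v)
        meets {Y} Y∈ with B⊆ Y∈
        ... | Y∈C , contains with meetsX Y∈C
        ...   | v , Yv≡Xv with v ∈? W
        ...     | yes v∈ = v , v∈ , Yv≡Xv
        ...     | no v∉ with ends v∉
        ...       | e , e∈ , inj₁ refl = contradiction (trans (sym Yv≡Xv) (All.lookup contains e∈)) (All.lookup avoids e∈)
        ...       | e , e∈ , inj₂ refl = contradiction
          (mate-flip X (trans (sym Yv≡Xv) (mate-flip Y (All.lookup contains e∈)))) (All.lookup avoids e∈)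
        small : ∀ {v} → v ∈ W → mate X v ∈ W → length (W ∖ v ∖ mate X v) ≡ 2 * (k + r) →
          length (B ⟨ v ↦ mate X v ⟩) ≤ n ^ k * [2 r -1]!!
        small {v} v∈ w∈ |W′| = length-branching k r ((v , mate X v) ∷ es) (trans (+-suc k _) k+) |W′| (fix-edge F)
          (AllPairs-filter⁺ (λ Y → mate Y v Finₚ.≟ mate X v) dB) B⊆′ ends′
          where
          B⊆′ : ∀ {Y} → Y ∈ B ⟨ v ↦ mate X v ⟩ → Y ∈ C × Contains Y ((v , mate X v) ∷ es)
          B⊆′ Y∈ = let Y∈B , e = ∈-⟨⟩⁻ Y∈ ; Y∈C , contains = B⊆ Y∈B in Y∈C , e ∷ contains
          ends′ : ∀ {u} → u ∉ W ∖ v ∖ mate X v → ∃[ e ] (e ∈ (v , mate X v) ∷ es × (u ≡ proj₁ e ⊎ u ≡ proj₂ e))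
          ends′ {u} u∉ with u ∈? W | u Finₚ.≟ v | u Finₚ.≟ mate X v
          ... | _ | yes u≡v | _ = _ , here refl , inj₁ u≡v
          ... | _ | no _ | yes u≡w = _ , here refl , inj₂ u≡w
          ... | yes u∈ | no u≢v | no u≢w = contradiction (∈-∖⁺ (∈-∖⁺ u∈ u≢v) u≢w) u∉
          ... | no u∉W | no _ | no _ = let e , e∈ , is = ends u∉W in e , there e∈ , is

      length-blocked : ∀ r → n ≡ K + r → length C ≤ n ^ K * [2 r -1]!!
      length-blocked r n≡ = length-branching K r [] (+-identityʳ K)
        (trans length-allFin (trans N≡2n (cong (2 *_) n≡))) (free-all C) distinct
        (λ Y∈ → Y∈ , []) (λ u∉ → contradiction (∈-allFin _) u∉)

    -- `Y` certifies that vw is an edge other than ab. If the two edges share a vertex, no matching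
    -- contains both; otherwise 2n vertices remain free.
    double-star-≤ : ∀ {n} → N ≡ 2 * suc (suc n) → ∀ {A : List (Mat N)} {a b v w} → Distinctₘ A → a ≢ b →
      ∀ {Y} → mate Y a ≢ b → mate Y v ≡ w → length (A ⟨ a ↦ b ⟩ ⟨ v ↦ w ⟩) ≤ [2 n -1]!!
    double-star-≤ {n} N≡2n {A} {a} {b} {v} {w} distinct a≢b {Y} Ya≢b Yv≡w with v ∈? W | w ∈? W
      where W = allFin N ∖ a ∖ b
    ... | yes v∈ | yes w∈ = length-distinct-free n (AllPairs-filter⁺ _ (AllPairs-filter⁺ _ distinct)) (fix-edge F)
            (length-fix-edge F |W| v∈ w∈ (λ v≡w → irreflexive Y v (trans Yv≡w (sym v≡w))))
      where
      F = fix-edge {v = a} {b} (free-all A)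
      |W| = length-fix-edge (free-all A) {suc n} (|allFin| N≡2n) (∈-allFin a) (∈-allFin b) a≢b
    ... | no v∉ | _ = length-empty empty
      where
      empty : ∀ {X} → X ∉ A ⟨ a ↦ b ⟩ ⟨ v ↦ w ⟩
      empty {X} X∈ with ∈-⟨⟩⁻ {B = A ⟨ a ↦ b ⟩} X∈
      ... | X∈′ , Xv≡w with ∈-⟨⟩⁻ {B = A} X∈′
      ...   | _ , Xa≡b with v Finₚ.≟ a | v Finₚ.≟ b
      ...     | yes refl | _ = Ya≢b (trans Yv≡w (trans (sym Xv≡w) Xa≡b))
      ...     | no _ | yes refl = Ya≢b (mate-flip Y (trans Yv≡w (trans (sym Xv≡w) (mate-flip X Xa≡b))))
      ...     | no v≢a | no v≢b = v∉ (∈-∖⁺ (∈-∖⁺ (∈-allFin v) v≢a) v≢b)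
    ... | yes _ | no w∉ = length-empty empty
      where
      empty : ∀ {X} → X ∉ A ⟨ a ↦ b ⟩ ⟨ v ↦ w ⟩
      empty {X} X∈ with ∈-⟨⟩⁻ {B = A ⟨ a ↦ b ⟩} X∈
      ... | X∈′ , Xv≡w with ∈-⟨⟩⁻ {B = A} X∈′
      ...   | _ , Xa≡b with w Finₚ.≟ a | w Finₚ.≟ b
      ...     | yes refl | _ = Ya≢b (trans (mate-flip Y Yv≡w) (trans (sym (mate-flip X Xv≡w)) Xa≡b))
      ...     | no _ | yes refl = Ya≢b (trans (cong (mate Y) (sym (mate-injective X (trans Xv≡w (sym Xa≡b))))) Yv≡w)
      ...     | no w≢a | no w≢b = w∉ (∈-∖⁺ (∈-∖⁺ (∈-allFin w) w≢a) w≢b)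

    module _ {n : ℕ} (N≡2n : N ≡ 2 * suc (suc n)) {A : List (Mat N)} (distinct : Distinctₘ A)
      (intersecting : Intersecting A) (K r : ℕ) (n≡K+r : suc (suc n) ≡ K + r)
      (few : suc (suc n) ^ K * [2 r -1]!! < length A)
      (many : K * (K * [2 n -1]!!) < length A) where

      -- The threshold `K * [2 n -1]!!` for heaviness serves both cases. If no star exceeds it,
      -- fewer than `K` stars cannot cover `A`, by `many`, so blockers exist for all of `A`, against
      -- `few`. If the star at ab exceeds it, fewer than `K` double stars cannot cover that star, so
      -- it supplies blockers for the members avoiding ab.
      dominant-star : ∃[ a ] ∃[ b ] (a ≢ b ×
        length (filter (λ X → ¬? (mate X a Finₚ.≟ b)) A) ≤ suc (suc n) ^ K * [2 r -1]!!)
      dominant-star with Finₚ.any? (λ a → Finₚ.any? (λ b → K * [2 n -1]!! <? length (A ⟨ a ↦ b ⟩)))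
      ... | no none = contradiction (length-blocked N≡2n K distinct blocker r n≡K+r) (<⇒≱ few)
        where
        blocker : ∀ es → length es < K → ∀ {Y} → Y ∈ A → Contains Y es →
          ∃[ X ] (Avoids X es × (∀ {Z} → Z ∈ A → Meets Z X))
        blocker es short _ _ =
          let X , X∈ , avoids = avoiding-member (K * [2 n -1]!!) es
                (λ {v} {w} _ → ≮⇒≥ (λ lt → none (v , w , lt)))
                (≤-<-trans (*-monoˡ-≤ (K * [2 n -1]!!) (<⇒≤ short)) many)
          in X , avoids , λ Z∈ → intersecting Z∈ X∈
      ... | yes (a , b , heavy) = a , b , a≢b ,
          length-blocked N≡2n K (AllPairs-filter⁺ _ distinct) blocker r n≡K+r
        where
        C? = λ X → ¬? (mate X a Finₚ.≟ b)
        a≢b : a ≢ b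
        a≢b refl = contradiction (length-empty (λ {X} X∈ → irreflexive X a (proj₂ (∈-⟨⟩⁻ {B = A} X∈)))) (<⇒≱ heavy)
        blocker : ∀ es → length es < K → ∀ {Y} → Y ∈ filter C? A → Contains Y es →
          ∃[ X ] (Avoids X es × (∀ {Z} → Z ∈ filter C? A → Meets Z X))
        blocker es short {Y} Y∈ contains =
          let _ , Ya≢b = ∈-filter⁻ C? {xs = A} Y∈
              X , X∈ , avoids = avoiding-member [2 n -1]!! es
                (λ e∈ → double-star-≤ N≡2n distinct a≢b {Y} Ya≢b (All.lookup contains e∈))
                (≤-<-trans (*-monoˡ-≤ [2 n -1]!! (<⇒≤ short)) heavy)
          in X , avoids , λ Z∈ → intersecting (proj₁ (∈-filter⁻ C? {xs = A} Z∈)) (proj₁ (∈-⟨⟩⁻ {B = A} X∈))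

  -- Numerical estimates for large n

  [2-1]!!>0 : ∀ m → 0 < [2 m -1]!!
  [2-1]!!>0 zero    = s≤s z≤n
  [2-1]!!>0 (suc m) = *-mono-< {0} {2 * m + 1} {0} (subst (0 <_) (+-comm 1 (2 * m)) (s≤s z≤n)) ([2-1]!!>0 m)

  -- In each of the `k` steps a factor `n` stands against an odd factor of the double factorial that
  -- is at least 3n/2.
  double-factorial-decay : ∀ n r → 3 * n ≤ 2 * (2 * r + 1) → ∀ k →
    n ^ k * [2 r -1]!! * 3 ^ k ≤ 2 ^ k * [2 (k + r) -1]!!
  double-factorial-decay n r 3n≤ zero = ≤-reflexive (*-identityʳ _)
  double-factorial-decay n r 3n≤ (suc k) = begin
    n * n ^ k * d * (3 * 3 ^ k)            ≡⟨ solve 4 (λ n x d y → n :* x :* d :* (con 3 :* y) := (con 3 :* n) :* (x :* d :* y)) refl n (n ^ k) d (3 ^ k) ⟩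
    3 * n * (n ^ k * d * 3 ^ k)            ≤⟨ *-mono-≤ (≤-trans 3n≤ (*-monoʳ-≤ 2 (+-monoˡ-≤ 1 (*-monoʳ-≤ 2 (m≤n+m r k))))) (double-factorial-decay n r 3n≤ k) ⟩
    2 * (2 * (k + r) + 1) * (2 ^ k * e)    ≡⟨ solve 3 (λ a x e → con 2 :* a :* (x :* e) := con 2 :* x :* (a :* e)) refl (2 * (k + r) + 1) (2 ^ k) e ⟩
    2 * 2 ^ k * ((2 * (k + r) + 1) * e)    ∎
    where
    open ≤-Reasoning
    d = [2 r -1]!!
    e = [2 (k + r) -1]!!

  binary-bracket : ∀ n → ∃[ ℓ ] (2 ^ ℓ ≤ suc n × suc n < 2 ^ suc ℓ)
  binary-bracket zero = 0 , ≤-refl , ≤-refl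
  binary-bracket (suc n) with binary-bracket n
  ... | ℓ , lo , hi with suc (suc n) <? 2 ^ suc ℓ
  ...   | yes hi′ = ℓ , m≤n⇒m≤1+n lo , hi′
  ...   | no ¬hi′ = suc ℓ , ≮⇒≥ ¬hi′ , ≤-<-trans hi (^-monoʳ-< 2 (s≤s (s≤s z≤n)) (n<1+n (suc ℓ)))

  square≤2^ : ∀ {ℓ} → 10 ≤′ ℓ → (2 * (4 + ℓ)) * (2 * (4 + ℓ)) ≤ 2 ^ ℓ
  -- Ten is the first exponent that works: 28² = 784 ≤ 1024, while 26² > 512. This is the origin of
  -- the threshold 1024.
  square≤2^ ≤′-refl = ≤ᵇ⇒≤ 784 1024 _
  square≤2^ (≤′-step {ℓ} 10≤ℓ) = begin
    (2 * (5 + ℓ)) * (2 * (5 + ℓ))          ≤⟨ m≤m+n _ (4 * ℓ * ℓ + 24 * ℓ + 28) ⟩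
    (2 * (5 + ℓ)) * (2 * (5 + ℓ)) + (4 * ℓ * ℓ + 24 * ℓ + 28)
      ≡⟨ solve 1 (λ ℓ → (con 2 :* (con 5 :+ ℓ)) :* (con 2 :* (con 5 :+ ℓ)) :+ (con 4 :* ℓ :* ℓ :+ con 24 :* ℓ :+ con 28)
           := con 2 :* ((con 2 :* (con 4 :+ ℓ)) :* (con 2 :* (con 4 :+ ℓ)))) refl ℓ ⟩
    2 * ((2 * (4 + ℓ)) * (2 * (4 + ℓ)))    ≤⟨ *-monoʳ-≤ 2 (square≤2^ 10≤ℓ) ⟩
    2 ^ suc ℓ                              ∎
    where open ≤-Reasoning

  -- The number of covering rounds: K ≈ 2 log₂ n makes (2/3)^K smaller than 1/(8n).
  rounds : ∀ n → 1024 ≤ suc n → ∃[ K ] (K * K ≤ suc n × 4 * K ≤ suc n × 2 ^ K * (8 * suc n) ≤ 3 ^ K)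
  rounds n 1024≤n with binary-bracket n
  ... | ℓ , lo , hi = K , K²≤ , ≤-trans (*-monoˡ-≤ K (≤-trans (m≤m+n 4 ℓ) (m≤m+n (4 + ℓ) _))) K²≤ , power
    where
    open ≤-Reasoning
    -- Chosen so that 2ˢ is 8 times `2 ^ suc ℓ`, and thus exceeds 8 times `suc n`.
    s = 4 + ℓ
    K = 2 * s
    10≤ℓ : 10 ≤ ℓ
    10≤ℓ = ≮⇒≥ λ ℓ<10 → <⇒≱ hi (≤-trans (^-monoʳ-≤ 2 ℓ<10) 1024≤n)
    K²≤ : K * K ≤ suc n
    K²≤ = ≤-trans (square≤2^ (≤⇒≤′ 10≤ℓ)) lo
    power : 2 ^ K * (8 * suc n) ≤ 3 ^ K
    power = begin
      2 ^ K * (8 * suc n)        ≤⟨ *-monoʳ-≤ (2 ^ K) (*-monoʳ-≤ 8 (<⇒≤ hi)) ⟩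
      2 ^ K * (8 * 2 ^ suc ℓ)    ≡⟨ cong (2 ^ K *_) (sym (^-distribˡ-+-* 2 3 (suc ℓ))) ⟩
      2 ^ K * 2 ^ (3 + suc ℓ)    ≡⟨ cong (λ x → 2 ^ K * 2 ^ x) (+-suc 3 ℓ) ⟩
      2 ^ K * 2 ^ s              ≡⟨ sym (^-distribˡ-+-* 2 K s) ⟩
      2 ^ (K + s)                ≡⟨ cong (2 ^_) (+-comm K s) ⟩
      2 ^ (3 * s)                ≡⟨ sym (^-*-assoc 2 3 s) ⟩
      -- Two rounds gain more than a factor 2, since (3/2)² = 9/4 > 8/4; hence `K` is twice `s`.
      8 ^ s                      ≤⟨ ^-monoˡ-≤ s (n≤1+n 8) ⟩
      9 ^ s                      ≡⟨ ^-*-assoc 3 2 s ⟩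
      3 ^ K                      ∎

  InStar : ∀ {N} → List (Mat N) → Set
  InStar {N} A = ∃[ a ] ∃[ b ] (a ≢ b × All (λ X → mate X a ≡ b) A)

  not-all⇒member : ∀ {N} {A : List (Mat N)} {a b} → ¬ All (λ X → mate X a ≡ b) A → ∃[ X ] (X ∈ A × mate X a ≢ b)
  not-all⇒member {A = A} {a} {b} ¬all with Any.any? (λ X → ¬? (mate X a Finₚ.≟ b)) A
  ... | yes found = find found
  ... | no none = contradiction (All.tabulate all) ¬all
    where
    all : ∀ {X} → X ∈ A → mate X a ≡ b
    all {X} X∈ with mate X a Finₚ.≟ b
    ... | yes e = e
    ... | no ¬e = contradiction (lose X∈ ¬e) none

  stability-rounds : ∀ {N n} K → K * K ≤ suc (suc n) → 4 * K ≤ suc (suc n) → 2 ^ K * (8 * suc (suc n)) ≤ 3 ^ K →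
    8 ≤ n → N ≡ 2 * suc (suc n) → {A : List (Mat N)} → Distinctₘ A → Intersecting A →
    3 * [2 suc n -1]!! ≤ 4 * length A → InStar A
  stability-rounds {N} {n} K K²≤ 4K≤ 2^K≤3^K 8≤n N≡2n {A} distinct intersecting 3d≤4a =
    conclude (dominant-star N≡2n distinct intersecting K r n≡K+r few many)
    where
    open ≤-Reasoning
    r = suc (suc n) ∸ K
    d = [2 n -1]!!
    q = suc (suc n) ^ K * [2 r -1]!!
    n≡K+r : suc (suc n) ≡ K + r
    n≡K+r = sym (m+[n∸m]≡n (≤-trans (m≤m+n K (3 * K)) 4K≤))
    instance
      d≢0 : NonZero d
      d≢0 = >-nonZero ([2-1]!!>0 n)
      2^K≢0 : NonZero (2 ^ K)
      2^K≢0 = m^n≢0 2 K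
    -- As `K` is at most a quarter of the number of edges of a matching, `r` is at least three
    -- quarters of it.
    K+r-decay : 3 * suc (suc n) ≤ 2 * (2 * r + 1)
    K+r-decay = +-cancelˡ-≤ (4 * K) _ _ (begin
      4 * K + 3 * suc (suc n)                ≤⟨ +-monoˡ-≤ _ 4K≤ ⟩
      suc (suc n) + 3 * suc (suc n)          ≡⟨ cong (4 *_) n≡K+r ⟩
      4 * (K + r)                            ≤⟨ m≤m+n _ 2 ⟩
      4 * (K + r) + 2                        ≡⟨ solve 2 (λ K r → con 4 :* (K :+ r) :+ con 2 := con 4 :* K :+ con 2 :* (con 2 :* r :+ con 1)) refl K r ⟩
      4 * K + 2 * (2 * r + 1)                ∎)
    4q< : 4 * q < (2 * suc n + 1) * d
    4q< = *-cancelʳ-< (3 ^ K) (4 * q) ((2 * suc n + 1) * d) (begin-strict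
      4 * q * 3 ^ K                                      ≡⟨ *-assoc 4 q (3 ^ K) ⟩
      4 * (q * 3 ^ K)                                    ≤⟨ *-monoʳ-≤ 4 (double-factorial-decay (suc (suc n)) r K+r-decay K) ⟩
      4 * (2 ^ K * [2 (K + r) -1]!!)                     ≡⟨ cong (λ m → 4 * (2 ^ K * [2 m -1]!!)) (sym n≡K+r) ⟩
      4 * (2 ^ K * ((2 * suc n + 1) * ((2 * n + 1) * d)))
        ≡⟨ solve 4 (λ x a b d → con 4 :* (x :* (a :* (b :* d))) := a :* d :* (x :* (con 4 :* b))) refl (2 ^ K) (2 * suc n + 1) (2 * n + 1) d ⟩
      (2 * suc n + 1) * d * (2 ^ K * (4 * (2 * n + 1)))  <⟨ *-monoʳ-< ((2 * suc n + 1) * d) {{m*n≢0 (2 * suc n + 1) d {{>-nonZero (subst (0 <_) (+-comm 1 (2 * suc n)) (s≤s z≤n))}}}} (*-monoʳ-< (2 ^ K) 4b<) ⟩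
      (2 * suc n + 1) * d * (2 ^ K * (8 * suc (suc n)))  ≤⟨ *-monoʳ-≤ ((2 * suc n + 1) * d) 2^K≤3^K ⟩
      (2 * suc n + 1) * d * 3 ^ K                        ∎)
      where
      4b< : 4 * (2 * n + 1) < 8 * suc (suc n)
      4b< = subst (4 * (2 * n + 1) <_) (solve 1 (λ n → con 4 :* (con 2 :* n :+ con 1) :+ con 12 := con 8 :* (con 2 :+ n)) refl n)
        (m<m+n _ (s≤s z≤n))
    few : q < length A
    few = *-cancelˡ-< 4 q (length A) (<-≤-trans 4q< (begin
      (2 * suc n + 1) * d                    ≤⟨ *-monoˡ-≤ d (subst (2 * suc n + 1 ≤_) (solve 1 (λ n → con 2 :* (con 1 :+ n) :+ con 1 :+ con 4 :* n := con 3 :* (con 2 :* n :+ con 1)) refl n) (m≤m+n _ (4 * n))) ⟩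
      3 * (2 * n + 1) * d                    ≡⟨ *-assoc 3 (2 * n + 1) d ⟩
      3 * [2 suc n -1]!!                     ≤⟨ 3d≤4a ⟩
      4 * length A                           ∎))
    many : K * (K * d) < length A
    many = *-cancelˡ-< 4 _ (length A) (begin-strict
      4 * (K * (K * d))                      ≡⟨ cong (4 *_) (sym (*-assoc K K d)) ⟩
      4 * (K * K * d)                        ≡⟨ sym (*-assoc 4 (K * K) d) ⟩
      4 * (K * K) * d                        ≤⟨ *-monoˡ-≤ d (*-monoʳ-≤ 4 K²≤) ⟩
      4 * suc (suc n) * d                    <⟨ *-monoˡ-< d 4n< ⟩
      3 * (2 * n + 1) * d                    ≡⟨ *-assoc 3 (2 * n + 1) d ⟩
      3 * [2 suc n -1]!!                     ≤⟨ 3d≤4a ⟩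
      4 * length A                           ∎)
      where
      4n< : 4 * suc (suc n) < 3 * (2 * n + 1)
      4n< = subst₂ _<_
        (solve 1 (λ n → con 4 :* n :+ con 8 := con 4 :* (con 2 :+ n)) refl n)
        (solve 1 (λ n → con 4 :* n :+ (con 2 :* n :+ con 3) := con 3 :* (con 2 :* n :+ con 1)) refl n)
        (+-monoʳ-< (4 * n) (≤-trans (s≤s 8≤n) (subst (suc n ≤_) (solve 1 (λ n → con 1 :+ n :+ (n :+ con 2) := con 2 :* n :+ con 3) refl n) (m≤m+n (suc n) (n + 2)))))
    conclude : ∃[ a ] ∃[ b ] (a ≢ b × length (filter (λ X → ¬? (mate X a Finₚ.≟ b)) A) ≤ q) → InStar A
    conclude (a , b , a≢b , rest) with All.all? (λ X → mate X a Finₚ.≟ b) A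
    ... | yes star = a , b , a≢b , star
    ... | no ¬star with not-all⇒member ¬star
    -- If some member avoids ab, the star has at most `n * d` members and the rest fewer than a
    -- quarter of `(2 * suc n + 1) * d`. Four times these bounds add up to exactly 3 (2n + 1) d.
    ...   | X , X∈ , Xa≢b = contradiction 3d≤4a (<⇒≱ (begin-strict
      4 * length A                           ≡⟨ cong (4 *_) (sym (length-filter-∁ (λ X → mate X a Finₚ.≟ b) A)) ⟩
      4 * (length (A ⟨ a ↦ b ⟩) + length (filter (∁? (λ X → mate X a Finₚ.≟ b)) A))
        ≤⟨ *-monoʳ-≤ 4 (+-mono-≤ (star-split-≤ N≡2n distinct intersecting a≢b X∈ Xa≢b) rest) ⟩
      4 * (n * d + q)                        ≡⟨ *-distribˡ-+ 4 (n * d) q ⟩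
      4 * (n * d) + 4 * q                    <⟨ +-monoʳ-< (4 * (n * d)) 4q< ⟩
      4 * (n * d) + (2 * suc n + 1) * d      ≡⟨ solve 2 (λ n d → con 4 :* (n :* d) :+ (con 2 :* (con 1 :+ n) :+ con 1) :* d := con 3 :* ((con 2 :* n :+ con 1) :* d)) refl n d ⟩
      3 * [2 suc n -1]!!                     ∎))

  stability-large : ∀ {N n} → 1024 ≤ suc (suc n) → N ≡ 2 * suc (suc n) → {A : List (Mat N)} → Distinctₘ A → Intersecting A →
    3 * [2 suc n -1]!! ≤ 4 * length A → InStar A
  stability-large {n = n} 1024≤n =
    let K , K²≤ , 4K≤ , 2^K≤3^K = rounds (suc n) 1024≤n
    in stability-rounds K K²≤ 4K≤ 2^K≤3^K (≤-pred (≤-pred (≤-trans (≤ᵇ⇒≤ 10 1024 _) 1024≤n)))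

  -- Relabelling and the clique–coclique bound

  module _ {N : ℕ} where

    transpose-left : ∀ (a b : Fin N) → PC.transpose a b a ≡ b
    transpose-left a b rewrite dec-true (a Finₚ.≟ a) refl = refl

    transpose-right : ∀ (a b : Fin N) → PC.transpose a b b ≡ a
    transpose-right a b with b Finₚ.≟ a
    ... | yes b≡a = b≡a
    ... | no _ rewrite dec-true (b Finₚ.≟ b) refl = refl

    transpose-other : ∀ {a b v : Fin N} → v ≢ a → v ≢ b → PC.transpose a b v ≡ v
    transpose-other {a} {b} {v} v≢a v≢b
      rewrite dec-false (v Finₚ.≟ a) v≢a | dec-false (v Finₚ.≟ b) v≢b = refl

    transpose-involutive : ∀ (a b v : Fin N) → PC.transpose a b (PC.transpose a b v) ≡ v
    transpose-involutive a b v = cases (v Finₚ.≟ a) (v Finₚ.≟ b)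
      where
      cases : Dec (v ≡ a) → Dec (v ≡ b) → PC.transpose a b (PC.transpose a b v) ≡ v
      cases (yes refl) _        = trans (cong (PC.transpose a b) (transpose-left a b)) (transpose-right a b)
      cases (no _) (yes refl)   = trans (cong (PC.transpose a b) (transpose-right a b)) (transpose-left a b)
      cases (no v≢a) (no v≢b)   = trans (cong (PC.transpose a b) (transpose-other v≢a v≢b)) (transpose-other v≢a v≢b)

    -- Unlike Perm.transpose, this is definitionally its own inverse.
    swap : Fin N → Fin N → Permutation′ N
    swap a b = permutation (PC.transpose a b) (PC.transpose a b) (transpose-involutive a b) (transpose-involutive a b)

    infixr 8 _•_
    _•_ : Permutation′ N → Mat N → Mat N
    mate        (π • X) v = π ⟨$⟩ʳ mate X (π ⟨$⟩ˡ v)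
    involutive  (π • X) v = trans (cong (λ u → π ⟨$⟩ʳ mate X u) (Perm.inverseˡ π))
                              (trans (cong (π ⟨$⟩ʳ_) (involutive X _)) (Perm.inverseʳ π))
    irreflexive (π • X) v e = irreflexive X (π ⟨$⟩ˡ v)
      (trans (sym (Perm.inverseˡ π)) (cong (π ⟨$⟩ˡ_) e))

    mate-• : ∀ π X v → mate (π • X) (π ⟨$⟩ʳ v) ≡ π ⟨$⟩ʳ mate X v
    mate-• π X v = cong (λ u → π ⟨$⟩ʳ mate X u) (Perm.inverseˡ π)

    to-injective : ∀ (π : Permutation′ N) {u v} → π ⟨$⟩ʳ u ≡ π ⟨$⟩ʳ v → u ≡ v
    to-injective π e = trans (sym (Perm.inverseˡ π)) (trans (cong (π ⟨$⟩ˡ_) e) (Perm.inverseˡ π))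

    •-disjoint : ∀ π {X Y} → ¬ Meets X Y → ¬ Meets (π • X) (π • Y)
    •-disjoint π X∩Y=∅ (v , e) = X∩Y=∅ (π ⟨$⟩ˡ v , to-injective π e)

    ≈-sym : ∀ {X Y : Mat N} → X ≈ Y → Y ≈ X
    ≈-sym X≈Y v = sym (X≈Y v)

    ≈-trans : ∀ {X Y Z : Mat N} → X ≈ Y → Y ≈ Z → X ≈ Z
    ≈-trans X≈Y Y≈Z v = trans (X≈Y v) (Y≈Z v)

    •-cong : ∀ π {X Y} → X ≈ Y → π • X ≈ π • Y
    •-cong π X≈Y v = cong (π ⟨$⟩ʳ_) (X≈Y _)

    -- The present and the desired partner of `v` trade places. Neither is an end of an edge common
    -- to `X` and `Y`, so agreement with `Y` is never lost.
    module Switch (X Y : Mat N) {v : Fin N} (Xv≢Yv : mate X v ≢ mate Y v) where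

      X′ = swap (mate X v) (mate Y v) • X

      unmoved : ∀ {u} → mate X u ≡ mate Y u → u ≢ mate X v × u ≢ mate Y v
      unmoved {u} e =
          (λ { refl → Xv≢Yv (sym (mate-flip Y (trans (sym e) (involutive X v)))) })
        , (λ { refl → Xv≢Yv (mate-flip X (trans e (involutive Y v))) })

      at : mate X′ v ≡ mate Y v
      at = trans (cong (λ u → PC.transpose (mate X v) (mate Y v) (mate X u))
                   (transpose-other (irreflexive X v ∘ sym) (irreflexive Y v ∘ sym)))
                 (transpose-left (mate X v) (mate Y v))

      keeps : ∀ {u} → mate X u ≡ mate Y u → mate X′ u ≡ mate Y u
      keeps {u} e = trans (cong (λ u → PC.transpose (mate X v) (mate Y v) (mate X u))
          (transpose-other (proj₁ (unmoved e)) (proj₂ (unmoved e))))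
        (trans (transpose-other (λ Xu≡Xv → Xv≢Yv (subst (λ u → mate X u ≡ mate Y u) (mate-injective X Xu≡Xv) e))
                 (λ Xu≡Yv → Xv≢Yv (subst (λ u → mate X u ≡ mate Y u) (mate-injective Y (trans (sym e) Xu≡Yv)) e))) e)

    -- An induction principle for matchings: `Φ` has to survive only switches towards `Y`. These
    -- keep all agreement with `Y`, so `Φ` may itself record agreement at chosen vertices.
    switch-connected : ∀ {ℓ} (Y : Mat N) (Φ : Mat N → Set ℓ) → (∀ {X X′} → X ≈ X′ → Φ X → Φ X′) →
      (∀ {X v} → mate X v ≢ mate Y v → Φ X → Φ (swap (mate X v) (mate Y v) • X)) →
      ∀ {X} → Φ X → Φ Y
    switch-connected Y Φ resp step φ = go (allFin N) φ (λ v → inj₁ (∈-allFin v))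
      where
      go : ∀ vs {X} → Φ X → (∀ v → v ∈ vs ⊎ mate X v ≡ mate Y v) → Φ Y
      go [] {X} φ agree = resp {X} {Y} (λ v → [ (λ ()) , id ]′ (agree v)) φ
      go (v ∷ vs) {X} φ agree with mate X v Finₚ.≟ mate Y v
      ... | yes e = go vs {X} φ agree′
        where
        agree′ : ∀ u → u ∈ vs ⊎ mate X u ≡ mate Y u
        agree′ u with agree u
        ... | inj₁ (here refl)  = inj₂ e
        ... | inj₁ (there u∈)   = inj₁ u∈
        ... | inj₂ e′           = inj₂ e′
      ... | no Xv≢Yv = go vs {X′} (step {X} {v} Xv≢Yv φ) agree′
        where
        open Switch X Y {v} Xv≢Yv
        agree′ : ∀ u → u ∈ vs ⊎ mate X′ u ≡ mate Y u
        agree′ u with agree u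
        ... | inj₁ (here refl)  = inj₂ at
        ... | inj₁ (there u∈)   = inj₁ u∈
        ... | inj₂ e′           = inj₂ (keeps e′)

    •-transitive : ∀ X Y → ∃[ π ] π • X ≈ Y
    •-transitive X Y = switch-connected Y (λ Z → ∃[ π ] π • X ≈ Z)
      (λ {Z} {Z′} Z≈Z′ (π , e) → π , ≈-trans {π • X} {Z} {Z′} e Z≈Z′)
      (λ {Z} {v} _ (π , e) → π ∘ₚ swap (mate Z v) (mate Y v) , •-cong (swap (mate Z v) (mate Y v)) {π • X} {Z} e)
      {X} (Perm.id , λ _ → refl)

  length-cartesianProduct : ∀ {X Y : Set} (xs : List X) (ys : List Y) →
    length (cartesianProduct xs ys) ≡ length xs * length ys
  length-cartesianProduct [] ys = refl
  length-cartesianProduct (x ∷ xs) ys = trans (length-++ (map (x ,_) ys))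
    (cong₂ _+_ (length-map (x ,_) ys) (length-cartesianProduct xs ys))

  module _ {N : ℕ} where

    vectors : ∀ k → List (Vec (Fin N) k)
    vectors zero    = []ᵥ ∷ []
    vectors (suc k) = cartesianProductWith _∷ᵥ_ (allFin N) (vectors k)

    vectors-unique : ∀ k → Unique (vectors k)
    vectors-unique zero    = [] ∷ []
    vectors-unique (suc k) = cartesianProductWith⁺ _∷ᵥ_ ∷-injective (allFin⁺ N) (vectors-unique k)

    ∈-vectors : ∀ {k} (xs : Vec (Fin N) k) → xs ∈ vectors k
    ∈-vectors []ᵥ       = here refl
    ∈-vectors (x ∷ᵥ xs) = ∈-cartesianProductWith⁺ _∷ᵥ_ (∈-allFin x) (∈-vectors xs)

    lookup-injective : ∀ {k} {xs ys : Vec (Fin N) k} → (∀ i → lookup xs i ≡ lookup ys i) → xs ≡ ys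
    lookup-injective {xs = xs} {ys} e = trans (sym (tabulate∘lookup xs)) (trans (tabulate-cong e) (tabulate∘lookup ys))

    -- A permutation tabulated together with its inverse: unlike Permutation′, this has finitely many elements up to _≡_.
    Code : Set
    Code = Vec (Fin N) N × Vec (Fin N) N

    MutuallyInverse : Code → Set
    MutuallyInverse (p , q) = (∀ v → lookup q (lookup p v) ≡ v) × (∀ v → lookup p (lookup q v) ≡ v)

    mutuallyInverse? : Decidable MutuallyInverse
    mutuallyInverse? (p , q) = Finₚ.all? (λ v → lookup q (lookup p v) Finₚ.≟ v) ×-dec Finₚ.all? (λ v → lookup p (lookup q v) Finₚ.≟ v)

    codes : List Code
    codes = filter mutuallyInverse? (cartesianProduct (vectors N) (vectors N))

    codes-unique : Unique codes
    codes-unique = Unique-filter⁺ mutuallyInverse? (cartesianProduct⁺ (vectors-unique N) (vectors-unique N))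

    ∈-codes⁺ : ∀ {c} → MutuallyInverse c → c ∈ codes
    ∈-codes⁺ {p , q} = ∈-filter⁺ mutuallyInverse? (∈-cartesianProduct⁺ (∈-vectors p) (∈-vectors q))

    ∈-codes⁻ : ∀ {c} → c ∈ codes → MutuallyInverse c
    ∈-codes⁻ c∈ = proj₂ (∈-filter⁻ mutuallyInverse? {xs = cartesianProduct (vectors N) (vectors N)} c∈)

    Sends : Mat N → Mat N → Code → Set
    Sends X Y (p , q) = ∀ v → lookup p (mate X v) ≡ mate Y (lookup p v)

    sends? : ∀ X Y → Decidable (Sends X Y)
    sends? X Y (p , q) = Finₚ.all? (λ v → lookup p (mate X v) Finₚ.≟ mate Y (lookup p v))

    #senders : Mat N → Mat N → ℕ
    #senders X Y = length (filter (sends? X Y) codes)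

    sandwich : Permutation′ N → Permutation′ N → Code → Code
    sandwich ρ σ (p , q) = tabulate (λ v → σ ⟨$⟩ʳ lookup p (ρ ⟨$⟩ʳ v)) , tabulate (λ v → ρ ⟨$⟩ˡ lookup q (σ ⟨$⟩ˡ v))

    module _ (ρ σ : Permutation′ N) where

      sandwich-to : ∀ c v → lookup (proj₁ (sandwich ρ σ c)) v ≡ σ ⟨$⟩ʳ lookup (proj₁ c) (ρ ⟨$⟩ʳ v)
      sandwich-to c = lookup∘tabulate (λ v → σ ⟨$⟩ʳ lookup (proj₁ c) (ρ ⟨$⟩ʳ v))

      sandwich-from : ∀ c v → lookup (proj₂ (sandwich ρ σ c)) v ≡ ρ ⟨$⟩ˡ lookup (proj₂ c) (σ ⟨$⟩ˡ v)
      sandwich-from c = lookup∘tabulate (λ v → ρ ⟨$⟩ˡ lookup (proj₂ c) (σ ⟨$⟩ˡ v))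

      sandwich-inverse : ∀ {c} → MutuallyInverse c → MutuallyInverse (sandwich ρ σ c)
      sandwich-inverse {c@(p , q)} (qp , pq) =
          (λ v → trans (sandwich-from c _) (trans (cong (λ u → ρ ⟨$⟩ˡ lookup q (σ ⟨$⟩ˡ u)) (sandwich-to c v))
            (trans (cong (λ u → ρ ⟨$⟩ˡ lookup q u) (Perm.inverseˡ σ)) (trans (cong (ρ ⟨$⟩ˡ_) (qp _)) (Perm.inverseˡ ρ)))))
        , (λ v → trans (sandwich-to c _) (trans (cong (λ u → σ ⟨$⟩ʳ lookup p (ρ ⟨$⟩ʳ u)) (sandwich-from c v))
            (trans (cong (λ u → σ ⟨$⟩ʳ lookup p u) (Perm.inverseʳ ρ)) (trans (cong (σ ⟨$⟩ʳ_) (pq _)) (Perm.inverseʳ σ)))))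

      sandwich-injective : ∀ {c d} → sandwich ρ σ c ≡ sandwich ρ σ d → c ≡ d
      sandwich-injective {c} {d} e = cong₂ _,_
        (lookup-injective (λ v → subst (λ u → lookup (proj₁ c) u ≡ lookup (proj₁ d) u) (Perm.inverseʳ ρ)
          (to-injective σ (trans (sym (sandwich-to c (ρ ⟨$⟩ˡ v))) (trans (cong (λ x → lookup (proj₁ x) (ρ ⟨$⟩ˡ v)) e) (sandwich-to d (ρ ⟨$⟩ˡ v)))))))
        (lookup-injective (λ v → subst (λ u → lookup (proj₂ c) u ≡ lookup (proj₂ d) u) (Perm.inverseˡ σ)
          (to-injective (Perm.flip ρ) (trans (sym (sandwich-from c (σ ⟨$⟩ʳ v))) (trans (cong (λ x → lookup (proj₂ x) (σ ⟨$⟩ʳ v)) e) (sandwich-from d (σ ⟨$⟩ʳ v)))))))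

      sandwich-sends : ∀ {X Y X′ Y′} → ρ • X′ ≈ X → σ • Y ≈ Y′ → ∀ {c} → Sends X Y c → Sends X′ Y′ (sandwich ρ σ c)
      sandwich-sends {X} {Y} {X′} {Y′} ρX′≈X σY≈Y′ {c@(p , q)} sends v = begin
        lookup p′ (mate X′ v)                           ≡⟨ sandwich-to c (mate X′ v) ⟩
        σ ⟨$⟩ʳ lookup p (ρ ⟨$⟩ʳ mate X′ v)              ≡⟨ cong (λ u → σ ⟨$⟩ʳ lookup p u) (trans (sym (mate-• ρ X′ v)) (ρX′≈X _)) ⟩
        σ ⟨$⟩ʳ lookup p (mate X (ρ ⟨$⟩ʳ v))             ≡⟨ cong (σ ⟨$⟩ʳ_) (sends _) ⟩
        σ ⟨$⟩ʳ mate Y (lookup p (ρ ⟨$⟩ʳ v))             ≡⟨ sym (mate-• σ Y _) ⟩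
        mate (σ • Y) (σ ⟨$⟩ʳ lookup p (ρ ⟨$⟩ʳ v))       ≡⟨ σY≈Y′ _ ⟩
        mate Y′ (σ ⟨$⟩ʳ lookup p (ρ ⟨$⟩ʳ v))            ≡⟨ cong (mate Y′) (sym (sandwich-to c v)) ⟩
        mate Y′ (lookup p′ v)                           ∎
        where
        open ≡-Reasoning
        p′ = proj₁ (sandwich ρ σ c)

    -- Composing with a permutation that carries `X′` to `X` before, and with one that carries `Y`
    -- to `Y′` after, is injective. By symmetry the number of relabellings from one matching to
    -- another does not depend on the two matchings.
    #senders-≤ : ∀ X Y X′ Y′ → #senders X Y ≤ #senders X′ Y′
    #senders-≤ X Y X′ Y′ with •-transitive X′ X | •-transitive Y Y′
    ... | ρ , ρX′≈X | σ , σY≈Y′ = subst (_≤ #senders X′ Y′) (length-map (sandwich ρ σ) (filter (sends? X Y) codes))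
      (unique-⊆⇒length≤ (Unique-map⁺ (sandwich-injective ρ σ) (Unique-filter⁺ (sends? X Y) codes-unique)) inside)
      where
      inside : ∀ {d} → d ∈ map (sandwich ρ σ) (filter (sends? X Y) codes) → d ∈ filter (sends? X′ Y′) codes
      inside d∈ with ∈-map⁻ (sandwich ρ σ) d∈
      ... | c , c∈ , refl with ∈-filter⁻ (sends? X Y) {xs = codes} c∈
      ...   | c∈codes , sends = ∈-filter⁺ (sends? X′ Y′) (∈-codes⁺ (sandwich-inverse ρ σ {c} (∈-codes⁻ c∈codes)))
        (sandwich-sends ρ σ {X} {Y} {X′} {Y′} ρX′≈X σY≈Y′ {c} sends)

    decode : ∀ c → MutuallyInverse c → Permutation′ N
    decode (p , q) (qp , pq) = permutation (lookup p) (lookup q) pq qp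

    -- One half of the orbit-stabiliser theorem. Neither (2n)! nor the order of the stabiliser is
    -- computed; both cancel in the clique-coclique argument.
    length-codes : ∀ {n} → N ≡ 2 * n → ∀ X → length codes ≤ [2 n -1]!! * #senders X X
    length-codes {n} N≡2n X = Images.length-free (#senders X X) n codes free (trans length-allFin N≡2n) small
      where
      image : Code → Fin N → Fin N
      image (p , q) v = lookup p (mate X (lookup q v))
      module Images = Assignments image
      free : Images.Free (allFin N) codes
      free = record
        { involutive  = λ {d} d∈ → involutive (decode d (∈-codes⁻ d∈) • X)
        ; irreflexive = λ {d} d∈ → irreflexive (decode d (∈-codes⁻ d∈) • X)
        ; unique      = allFin⁺ N
        ; closed      = λ _ _ → ∈-allFin _
        ; determined  = λ _ _ v∉ → contradiction (∈-allFin _) v∉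
        }
      small : ∀ {c} → c ∈ codes → length (filter (Images._≗? c) codes) ≤ #senders X X
      small {c} c∈ = ≤-trans (unique-⊆⇒length≤ (Unique-filter⁺ (Images._≗? c) codes-unique) inside) (#senders-≤ X Y X X)
        where
        Y = decode c (∈-codes⁻ c∈) • X
        inside : ∀ {d} → d ∈ filter (Images._≗? c) codes → d ∈ filter (sends? X Y) codes
        inside {d@(p , q)} d∈ with ∈-filter⁻ (Images._≗? c) {xs = codes} d∈
        ... | d∈codes , d≗c = ∈-filter⁺ (sends? X Y) d∈codes
          (λ v → trans (cong (λ u → lookup p (mate X u)) (sym (proj₁ (∈-codes⁻ d∈codes) v))) (d≗c (lookup p v)))

    Belongs : List (Mat N) → Mat N → Set
    Belongs A X = Any (X ≈_) A

    belongs? : ∀ A X → Dec (Belongs A X)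
    belongs? A X = Any.any? (X ≗?_) A

    matSetoid : Setoid _ _
    matSetoid = record { Carrier = Mat N ; _≈_ = _≈_ ; isEquivalence = record
      { refl = λ _ → refl ; sym = λ {X} {Y} → ≈-sym {N} {X} {Y} ; trans = λ {X} {Y} {Z} → ≈-trans {N} {X} {Y} {Z} } }

    PairwiseDisjoint : ∀ {K} → (Fin K → Mat N) → Set
    PairwiseDisjoint G = ∀ {i j} → i ≢ j → ¬ Meets (G i) (G j)

    -- Clique–coclique: averaging over all relabellings of G, each of which contains at most one member of A.
    factorisation-hit : ∀ {m} → N ≡ 2 * suc m → ∀ {A} → Distinctₘ A → Intersecting A → [2 m -1]!! ≤ length A →
      (G : Fin (2 * m + 1) → Mat N) → PairwiseDisjoint G → ∃[ i ] Belongs A (G i)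
    factorisation-hit {m} N≡ {A} distinct intersecting large G disjoint with Finₚ.any? (λ i → belongs? A (G i))
    ... | yes found = found
    ... | no missed = contradiction (begin
      length codes                          ≤⟨ length-codes {suc m} N≡ X₀ ⟩
      (2 * m + 1) * [2 m -1]!! * c          ≤⟨ *-monoˡ-≤ c (*-monoʳ-≤ (2 * m + 1) large) ⟩
      (2 * m + 1) * length A * c            ≡⟨ cong (_* c) (*-comm (2 * m + 1) (length A)) ⟩
      length A * (2 * m + 1) * c            ≡⟨ cong (λ k → length A * k * c) (sym (length-tabulate id)) ⟩
      length A * length (allFin (2 * m + 1)) * c   ≡⟨ cong (_* c) (sym (length-cartesianProduct A (allFin (2 * m + 1)))) ⟩
      length xs * c                         ∎)
      (<⇒≱ (packing<length {P = P} (λ { (X , i) → sends? (G i) X }) c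
        (UniqueSetoid.cartesianProduct⁺ matSetoid (setoid (Fin (2 * m + 1))) distinct (allFin⁺ (2 * m + 1)))
        clash (λ {x} _ → #senders-≤ X₀ X₀ (G (proj₂ x)) (proj₁ x)) identity∈ identity-misses))
      where
      open ≤-Reasoning
      X₀ = G (subst Fin (+-comm 1 (2 * m)) zero)
      c = #senders X₀ X₀
      xs = cartesianProduct A (allFin (2 * m + 1))
      P : Mat N × Fin (2 * m + 1) → Code → Set
      P (X , i) = Sends (G i) X
      -- A relabelling keeps disjoint factors disjoint, so it cannot send two factors into the
      -- intersecting family; nor can it send one factor to two different matchings.
      clash : ∀ {x x′ d} → x ∈ xs → x′ ∈ xs → ¬ (proj₁ x ≈ proj₁ x′ × proj₂ x ≡ proj₂ x′) → d ∈ codes → P x d → ¬ P x′ d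
      clash {X , i} {X′ , i′} {p , q} x∈ x′∈ differ d∈ s s′
        with ∈-codes⁻ d∈ | intersecting (proj₁ (∈-cartesianProduct⁻ A _ x∈)) (proj₁ (∈-cartesianProduct⁻ A _ x′∈))
      ... | qp , pq | u , Xu≡X′u with i Finₚ.≟ i′
      ...   | yes refl = differ ((λ v → trans (sym (value {i} {X} s v)) (value {i} {X′} s′ v)) , refl)
        where
        value : ∀ {j Y} → Sends (G j) Y (p , q) → ∀ v → lookup p (mate (G j) (lookup q v)) ≡ mate Y v
        value {j} {Y} s v = trans (s (lookup q v)) (cong (mate Y) (pq v))
      ...   | no i≢i′ = disjoint i≢i′ (lookup q u , trans (sym (qp (mate (G i) (lookup q u)))) (trans (cong (lookup q)
        (trans (s _) (trans (cong (mate X) (pq u)) (trans Xu≡X′u (trans (cong (mate X′) (sym (pq u))) (sym (s′ _)))))))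
        (qp (mate (G i′) (lookup q u)))))
      identity : Code
      identity = tabulate id , tabulate id
      identity∈ : identity ∈ codes
      identity∈ = ∈-codes⁺ ((λ v → trans (lookup∘tabulate id _) (lookup∘tabulate id v)) , (λ v → trans (lookup∘tabulate id _) (lookup∘tabulate id v)))
      -- If no factor belongs to `A`, the identity sends no factor to a member of `A`. It is the
      -- uncounted element that makes the packing inequality strict.
      identity-misses : ∀ {x} → x ∈ xs → ¬ P x identity
      identity-misses {X , i} x∈ s = missed (i , lose (proj₁ (∈-cartesianProduct⁻ A _ x∈))
        (λ v → trans (sym (lookup∘tabulate id _)) (trans (s v) (cong (mate X) (lookup∘tabulate id v)))))

  -- Extremal families are stars

  module _ {N : ℕ} where

    swap-fixes : ∀ (Z : Mat N) {y z} → mate Z y ≡ z → swap y z • Z ≈ Z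
    swap-fixes Z {y} {z} Zy≡z v = cases (v Finₚ.≟ y) (v Finₚ.≟ z)
      where
      τ = PC.transpose y z
      cases : Dec (v ≡ y) → Dec (v ≡ z) → τ (mate Z (τ v)) ≡ mate Z v
      cases (yes refl) _ = trans (cong (τ ∘ mate Z) (transpose-left y z))
        (trans (cong τ (mate-flip Z Zy≡z)) (trans (transpose-left y z) (sym Zy≡z)))
      cases (no _) (yes refl) = trans (cong (τ ∘ mate Z) (transpose-right y z))
        (trans (cong τ Zy≡z) (trans (transpose-right y z) (sym (mate-flip Z Zy≡z))))
      cases (no v≢y) (no v≢z) = trans (cong (τ ∘ mate Z) (transpose-other v≢y v≢z)) (transpose-other
        (λ e → v≢z (trans (sym (mate-flip Z e)) Zy≡z))
        (λ e → v≢y (mate-injective Z (trans e (sym Zy≡z)))))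

    swap-keeps : ∀ (Z : Mat N) {y z u} → u ≢ y → u ≢ z → mate Z u ≢ y → mate Z u ≢ z →
      mate (swap y z • Z) u ≡ mate Z u
    swap-keeps Z {y} {z} u≢y u≢z Zu≢y Zu≢z =
      trans (cong (PC.transpose y z ∘ mate Z) (transpose-other u≢y u≢z)) (transpose-other Zu≢y Zu≢z)

    -- `P` and `Q` contain opposite sides of the 4-cycle b, P b, c, P c. Exchanging b and c turns
    -- the sides in `P` into those in `Q`, so the new matching is disjoint from everything that is
    -- disjoint from both `P` and `Q`.
    square-switch : ∀ (P Q : Mat N) {b c} → b ≢ c → mate P b ≢ c → mate P b ≡ mate Q c → mate P c ≡ mate Q b →
      ∀ v → mate (swap b c • P) v ≡ mate P v ⊎ mate (swap b c • P) v ≡ mate Q v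
    square-switch P Q {b} {c} b≢c Pb≢c Pb≡Qc Pc≡Qb v =
      cases (v Finₚ.≟ b) (v Finₚ.≟ c) (mate P v Finₚ.≟ b) (mate P v Finₚ.≟ c)
      where
      σ = PC.transpose b c
      Pc≢b : mate P c ≢ b
      Pc≢b e = Pb≢c (mate-flip P e)
      fixed : ∀ {u} → mate P u ≡ b ⊎ mate P u ≡ c → σ u ≡ u
      fixed (inj₁ e) = transpose-other (λ { refl → irreflexive P b e }) (λ { refl → Pc≢b e })
      fixed (inj₂ e) = transpose-other (λ { refl → Pb≢c e }) (λ { refl → irreflexive P c e })
      cases : Dec (v ≡ b) → Dec (v ≡ c) → Dec (mate P v ≡ b) → Dec (mate P v ≡ c) →
        σ (mate P (σ v)) ≡ mate P v ⊎ σ (mate P (σ v)) ≡ mate Q v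
      cases (yes refl) _ _ _ = inj₂ (trans (cong (σ ∘ mate P) (transpose-left b c))
        (trans (fixed (inj₂ (involutive P c))) Pc≡Qb))
      cases (no _) (yes refl) _ _ = inj₂ (trans (cong (σ ∘ mate P) (transpose-right b c))
        (trans (fixed (inj₁ (involutive P b))) Pb≡Qc))
      cases (no _) (no _) (yes Pv≡b) _ = inj₂ (trans (cong (σ ∘ mate P) (fixed (inj₁ Pv≡b)))
        (trans (cong σ Pv≡b) (trans (transpose-left b c)
          (sym (mate-flip Q (trans (sym Pb≡Qc) (mate-flip P Pv≡b)))))))
      cases (no _) (no _) (no _) (yes Pv≡c) = inj₂ (trans (cong (σ ∘ mate P) (fixed (inj₂ Pv≡c)))
        (trans (cong σ Pv≡c) (trans (transpose-right b c)
          (sym (mate-flip Q (trans (sym Pc≡Qb) (mate-flip P Pv≡c)))))))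
      cases (no v≢b) (no v≢c) (no Pv≢b) (no Pv≢c) = inj₁ (swap-keeps P v≢b v≢c Pv≢b Pv≢c)

    InDistinctEdges : Mat N → List (Fin N) → Set
    InDistinctEdges X = AllPairs (λ u v → u ≢ v × mate X u ≢ v)

    -- With `K` one less than the number of vertices, pairwise disjointness alone makes a
    -- 1-factorisation. The square allows the switch at b and c to act on two factors only; `link`
    -- makes the swap of y and z fix the second factor, and with it the switched second factor when
    -- b, c, y, z are distinct.
    record SquareFactorisation (K : ℕ) (X : Mat N) (b c y z : Fin N) : Set where
      field
        factor   : Fin K → Mat N
        disjoint : PairwiseDisjoint factor
        i₁ i₂    : Fin K
        i₁≢i₂    : i₁ ≢ i₂
        first    : factor i₁ ≈ X
        square-b : mate (factor i₂) b ≡ mate X c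
        square-c : mate (factor i₂) c ≡ mate X b
        link     : mate (factor i₂) y ≡ z

    -- The overlaps of Z with Y are destroyed one by one, by switches that do not touch the edges at b and c.
    disjoint-through : 6 < N → ∀ (X Y : Mat N) {b c} → mate X b ≢ mate Y b → mate X c ≢ mate Y c →
      ∃[ Z ] (mate Z b ≡ mate X b × mate Z c ≡ mate X c × ¬ Meets Z Y)
    disjoint-through 6<N X Y {b} {c} Xb≢Yb Xc≢Yc = go (allFin N) X refl refl (λ v → inj₁ (∈-allFin v))
      where
      go : ∀ vs Z → mate Z b ≡ mate X b → mate Z c ≡ mate X c → (∀ v → v ∈ vs ⊎ mate Z v ≢ mate Y v) →
        ∃[ Z ] (mate Z b ≡ mate X b × mate Z c ≡ mate X c × ¬ Meets Z Y)
      go [] Z Zb Zc off = Z , Zb , Zc , λ { (v , e) → [ (λ ()) , (λ ¬e → ¬e e) ]′ (off v) }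
      go (v ∷ vs) Z Zb Zc off with mate Z v Finₚ.≟ mate Y v
      ... | no ¬e = go vs Z Zb Zc off′
        where
        off′ : ∀ u → u ∈ vs ⊎ mate Z u ≢ mate Y u
        off′ u with off u
        ... | inj₁ (here refl) = inj₂ ¬e
        ... | inj₁ (there u∈)  = inj₁ u∈
        ... | inj₂ ¬e′         = inj₂ ¬e′
      -- The overlap is the edge vy, with y the mate of v. Swapping y with a vertex z off the six
      -- listed ones leaves the edges at b and c alone, and both new edges, vz and the one from y to
      -- the old mate of z, are absent from `Y`, which pairs v with y.
      ... | yes Zv≡Yv with fresh (b ∷ mate X b ∷ c ∷ mate X c ∷ v ∷ mate Z v ∷ []) 6<N
      ...   | z , z∉ = go vs Z′ (trans (kept Zb Xb≢Yb (≢z 0F) (≢z 1F)) Zb) (trans (kept Zc Xc≢Yc (≢z 2F) (≢z 3F)) Zc) off′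
        where
        y = mate Z v
        τ = PC.transpose y z
        Z′ = swap y z • Z
        ≢z : ∀ i → List.lookup (b ∷ mate X b ∷ c ∷ mate X c ∷ v ∷ mate Z v ∷ []) i ≢ z
        ≢z i refl = z∉ (∈-lookup i)
        v≢z = ≢z 4F
        y≢z = ≢z 5F
        kept : ∀ {u} → mate Z u ≡ mate X u → mate X u ≢ mate Y u → u ≢ z → mate X u ≢ z → mate Z′ u ≡ mate Z u
        kept {u} Zu≡Xu Xu≢Yu u≢z Xu≢z = swap-keeps Z
          (λ u≡y → Xu≢Yu (trans (sym Zu≡Xu) (trans (mate-flip Z (sym u≡y)) (sym (mate-flip Y (trans (sym Zv≡Yv) (sym u≡y)))))))
          u≢z
          (λ Zu≡y → Xu≢Yu (trans (sym Zu≡Xu) (subst (λ u → mate Z u ≡ mate Y u) (sym (mate-injective Z Zu≡y)) Zv≡Yv)))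
          (λ Zu≡z → Xu≢z (trans (sym Zu≡Xu) Zu≡z))
        Yy≡v : mate Y y ≡ v
        Yy≡v = mate-flip Y (sym Zv≡Yv)
        Zz≢v : mate Z z ≢ v
        Zz≢v e = y≢z (mate-flip Z e)
        v≢y : v ≢ y
        v≢y e = irreflexive Z v (sym e)
        separated : ∀ u → Dec (u ≡ v) → Dec (u ≡ y) → Dec (u ≡ z) → Dec (mate Z u ≡ z) →
          mate Z u ≢ mate Y u ⊎ u ≡ v → mate Z′ u ≢ mate Y u
        separated u (yes refl) _ _ _ _ e = y≢z (trans Zv≡Yv (trans (sym e)
          (trans (cong (τ ∘ mate Z) (transpose-other v≢y v≢z)) (transpose-left y z))))
        separated u (no _) (yes refl) _ _ _ e = Zz≢v (trans (sym (transpose-other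
            (λ Zz≡y → v≢z (sym (mate-injective Z Zz≡y))) (irreflexive Z z)))
          (trans (cong (τ ∘ mate Z) (sym (transpose-left y z))) (trans e Yy≡v)))
        separated u (no _) (no _) (yes refl) _ _ e = y≢z (trans Zv≡Yv (mate-flip Y (trans (sym e)
          (trans (cong (τ ∘ mate Z) (transpose-right y z)) (trans (cong τ (involutive Z v)) (transpose-other v≢y v≢z))))))
        separated u (no _) (no u≢y) (no u≢z) (yes Zu≡z) _ e = Zz≢v (trans (mate-flip Z Zu≡z)
          (trans (sym (mate-flip Y (trans (sym e) (trans (cong (τ ∘ mate Z) (transpose-other u≢y u≢z))
            (trans (cong τ Zu≡z) (transpose-right y z)))))) Yy≡v))
        separated u (no u≢v) (no u≢y) (no u≢z) (no Zu≢z) ¬e e with ¬e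
        ... | inj₂ u≡v = u≢v u≡v
        ... | inj₁ Zu≢Yu = Zu≢Yu (trans (sym (swap-keeps Z u≢y u≢z (λ Zu≡y → u≢v (mate-injective Z Zu≡y)) Zu≢z)) e)
        off′ : ∀ u → u ∈ vs ⊎ mate Z′ u ≢ mate Y u
        off′ u with off u
        ... | inj₁ (there u∈)  = inj₁ u∈
        ... | inj₁ (here u≡v)  = inj₂ (separated u (u Finₚ.≟ v) (u Finₚ.≟ y) (u Finₚ.≟ z) (mate Z u Finₚ.≟ z) (inj₂ u≡v))
        ... | inj₂ ¬e          = inj₂ (separated u (u Finₚ.≟ v) (u Finₚ.≟ y) (u Finₚ.≟ z) (mate Z u Finₚ.≟ z) (inj₁ ¬e))

  module _ {N n : ℕ} (N≡2n : N ≡ 2 * suc (suc n)) (6<N : 6 < N)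
    (square-factorisation : ∀ X {b c y z} → InDistinctEdges {N} X (b ∷ c ∷ y ∷ z ∷ []) →
      SquareFactorisation (2 * suc n + 1) X b c y z)
    {A : List (Mat N)} (distinct : Distinctₘ A) (intersecting : Intersecting A)
    (large : [2 suc n -1]!! ≤ length A) where

    private
      B : Mat N → Set
      B = Belongs A

      B-resp : ∀ {X Y} → X ≈ Y → B X → B Y
      B-resp {X} {Y} X≈Y = Any.map (λ {Z} X≈Z → ≈-trans {N} {Y} {X} {Z} (≈-sym {N} {X} {Y} X≈Y) X≈Z)

      B-meets : ∀ {X Y} → B X → B Y → Meets X Y
      B-meets {X} {Y} BX BY =
        let X′ , X′∈ , X≈X′ = find BX ; Y′ , Y′∈ , Y≈Y′ = find BY ; v , e = intersecting X′∈ Y′∈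
        in v , trans (X≈X′ v) (trans e (sym (Y≈Y′ v)))

      hits : ∀ G → PairwiseDisjoint G → ∃[ i ] B (G i)
      hits = factorisation-hit N≡2n distinct intersecting large

    -- With G a factorisation through X containing the square at b, c, its variant G′ switched at b, c
    -- must be hit at its second factor; so must the image of G under the swap of y and z be hit at its first.
    switch-propagates : ∀ {X b c y z} → InDistinctEdges X (b ∷ c ∷ y ∷ z ∷ []) → B X → ¬ B (swap b c • X) →
      B (swap y z • X) × ¬ B (swap b c • swap y z • X)
    switch-propagates {X} {b} {c} {y} {z} edges BX ¬BsX with square-factorisation X edges
    ... | fac with edges
    ...   | ((b≢c , Xb≢c) ∷ (b≢y , _) ∷ (b≢z , _) ∷ []) ∷ ((c≢y , _) ∷ (c≢z , _) ∷ []) ∷ _ = BtX , ¬BstX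
      where
      open SquareFactorisation fac renaming (factor to G)
      s = swap b c
      t = swap y z
      square₁ : ∀ v → mate (s • G i₁) v ≡ mate (G i₁) v ⊎ mate (s • G i₁) v ≡ mate (G i₂) v
      square₁ = square-switch (G i₁) (G i₂) b≢c (Xb≢c ∘ trans (sym (first b)))
        (trans (first b) (sym square-c)) (trans (first c) (sym square-b))
      square₂ : ∀ v → mate (s • G i₂) v ≡ mate (G i₂) v ⊎ mate (s • G i₂) v ≡ mate (G i₁) v
      square₂ = square-switch (G i₂) (G i₁) b≢c (λ e → irreflexive X c (trans (sym square-b) e))
        (trans square-b (sym (first c))) (trans square-c (sym (first b)))
      G′-choice : ∀ i → Dec (i ≡ i₁) → Dec (i ≡ i₂) → Mat N
      G′-choice i (no _) (no _) = G i
      G′-choice i _      _      = s • G i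
      G′ : Fin (2 * suc n + 1) → Mat N
      G′ i = G′-choice i (i Finₚ.≟ i₁) (i Finₚ.≟ i₂)
      off₁ : ∀ {j} → j ≢ i₁ → j ≢ i₂ → ¬ Meets (s • G i₁) (G j)
      off₁ j≢i₁ j≢i₂ (v , e) with square₁ v
      ... | inj₁ e′ = disjoint (j≢i₁ ∘ sym) (v , trans (sym e′) e)
      ... | inj₂ e′ = disjoint (j≢i₂ ∘ sym) (v , trans (sym e′) e)
      off₂ : ∀ {j} → j ≢ i₁ → j ≢ i₂ → ¬ Meets (s • G i₂) (G j)
      off₂ j≢i₁ j≢i₂ (v , e) with square₂ v
      ... | inj₁ e′ = disjoint (j≢i₂ ∘ sym) (v , trans (sym e′) e)
      ... | inj₂ e′ = disjoint (j≢i₁ ∘ sym) (v , trans (sym e′) e)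
      swapped : ∀ {i} → i ≡ i₁ ⊎ i ≡ i₂ → ∀ {j} → j ≢ i₁ → j ≢ i₂ → ¬ Meets (s • G i) (G j)
      swapped (inj₁ refl) = off₁
      swapped (inj₂ refl) = off₂
      G′-disjoint : PairwiseDisjoint G′
      G′-disjoint {i} {j} i≢j = cases (i Finₚ.≟ i₁) (i Finₚ.≟ i₂) (j Finₚ.≟ i₁) (j Finₚ.≟ i₂)
        where
        cases : (p : Dec (i ≡ i₁)) (q : Dec (i ≡ i₂)) (p′ : Dec (j ≡ i₁)) (q′ : Dec (j ≡ i₂)) →
          ¬ Meets (G′-choice i p q) (G′-choice j p′ q′)
        cases (no _) (no _) (no _) (no _) = disjoint i≢j
        cases (yes p) _ (no p′) (no q′) = swapped (inj₁ p) p′ q′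
        cases (no _) (yes q) (no p′) (no q′) = swapped (inj₂ q) p′ q′
        cases (no p) (no q) (yes p′) _ (v , e) = swapped (inj₁ p′) p q (v , sym e)
        cases (no p) (no q) (no _) (yes q′) (v , e) = swapped (inj₂ q′) p q (v , sym e)
        cases (yes _) _ (yes _) _ = •-disjoint s {G i} {G j} (disjoint i≢j)
        cases (yes _) _ (no _) (yes _) = •-disjoint s {G i} {G j} (disjoint i≢j)
        cases (no _) (yes _) (yes _) _ = •-disjoint s {G i} {G j} (disjoint i≢j)
        cases (no _) (yes _) (no _) (yes _) = •-disjoint s {G i} {G j} (disjoint i≢j)
      meets-G₁ : ∀ {Y} → B Y → Meets Y (G i₁)
      meets-G₁ {Y} BY = let v , e = B-meets {Y} {X} BY BX in v , trans e (sym (first v))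
      BsG₂ : B (s • G i₂)
      BsG₂ = let j , B′ = hits G′ G′-disjoint in cases j (j Finₚ.≟ i₁) (j Finₚ.≟ i₂) B′
        where
        cases : ∀ j (p : Dec (j ≡ i₁)) (q : Dec (j ≡ i₂)) → B (G′-choice j p q) → B (s • G i₂)
        -- The switched first factor is `s • X`, which is not in `A` by hypothesis; the untouched
        -- factors are disjoint from `X`, which is.
        cases j (yes refl) q B′ = contradiction (B-resp {s • G i₁} {s • X} (•-cong s {G i₁} {X} first) B′) ¬BsX
        cases j (no _) (yes refl) B′ = B′
        cases j (no j≢i₁) (no _) B′ = contradiction (meets-G₁ {G j} B′) (disjoint j≢i₁)
      tG₂≈G₂ : t • G i₂ ≈ G i₂
      tG₂≈G₂ = swap-fixes (G i₂) link
      tsG₂≈sG₂ : t • s • G i₂ ≈ s • G i₂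
      tsG₂≈sG₂ = swap-fixes (s • G i₂) (trans (cong (PC.transpose b c ∘ mate (G i₂)) (transpose-other (b≢y ∘ sym) (c≢y ∘ sym)))
        (trans (cong (PC.transpose b c) link) (transpose-other (b≢z ∘ sym) (c≢z ∘ sym))))
      BtX : B (t • X)
      BtX = let j , B′ = hits (λ i → t • G i) (λ {i} {j} i≢j → •-disjoint t {G i} {G j} (disjoint i≢j)) in cases j (j Finₚ.≟ i₁) (j Finₚ.≟ i₂) B′
        where
        cases : ∀ j → Dec (j ≡ i₁) → Dec (j ≡ i₂) → B (t • G j) → B (t • X)
        cases j (yes refl) _ B′ = B-resp {t • G i₁} {t • X} (•-cong t {G i₁} {X} first) B′
        cases j (no _) (yes refl) B′ = contradiction
          (meets-G₁ {G i₂} (B-resp {t • G i₂} {G i₂} tG₂≈G₂ B′)) (disjoint (i₁≢i₂ ∘ sym))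
        -- The member `s • G i₂` misses the untouched factor `G j`, and is fixed by `t`; so it
        -- misses `t • G j` too, which therefore cannot be in `A`.
        cases j (no j≢i₁) (no j≢i₂) B′ = contradiction
          (B-meets {t • s • G i₂} {t • G j} (B-resp {s • G i₂} {t • s • G i₂} (≈-sym {N} {t • s • G i₂} {s • G i₂} tsG₂≈sG₂) BsG₂) B′)
          (•-disjoint t {s • G i₂} {G j} (off₂ j≢i₁ j≢i₂))
      ¬BstX : ¬ B (s • t • X)
      -- As `t` fixes `G i₂`, the matching `s • t • G i₂` is the member `s • G i₂`; it is disjoint
      -- from `s • t • X` because `G i₂` is disjoint from `X`.
      ¬BstX B′ = •-disjoint s {t • X} {t • G i₂}
        (•-disjoint t {X} {G i₂} (λ { (v , e) → disjoint i₁≢i₂ (v , trans (first v) e) }))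
        (B-meets {s • t • X} {s • t • G i₂} B′
          (B-resp {s • G i₂} {s • t • G i₂} (•-cong s {G i₂} {t • G i₂} (≈-sym {N} {t • G i₂} {G i₂} tG₂≈G₂)) BsG₂))

    -- Membership alone would not propagate: the failure of the switch at b and c is what allows the
    -- next switch elsewhere, so the induction carries both. Since all intermediate matchings agree
    -- with `Y` at b and c, the switches towards `Y` stay off the two edges there.
    contains-two-edges : ∀ {X b c} → B X → ¬ B (swap b c • X) → b ≢ c → mate X b ≢ c →
      ∀ Y → mate Y b ≡ mate X b → mate Y c ≡ mate X c → B Y
    contains-two-edges {X} {b} {c} BX ¬BsX b≢c Xb≢c Y Yb Yc =
      proj₁ (switch-connected Y Φ (λ {Z} {Z′} → Φ-resp {Z} {Z′}) (λ {Z} {v} → step {Z} {v}) {X} (BX , ¬BsX , sym Yb , sym Yc))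
      where
      Φ : Mat N → Set
      Φ Z = B Z × ¬ B (swap b c • Z) × mate Z b ≡ mate Y b × mate Z c ≡ mate Y c
      Φ-resp : ∀ {Z Z′} → Z ≈ Z′ → Φ Z → Φ Z′
      Φ-resp {Z} {Z′} e (BZ , ¬BsZ , Zb , Zc) = B-resp {Z} {Z′} e BZ ,
        (λ B′ → ¬BsZ (B-resp {swap b c • Z′} {swap b c • Z} (•-cong (swap b c) {Z′} {Z} (≈-sym {N} {Z} {Z′} e)) B′)) ,
        trans (sym (e b)) Zb , trans (sym (e c)) Zc
      step : ∀ {Z v} → mate Z v ≢ mate Y v → Φ Z → Φ (swap (mate Z v) (mate Y v) • Z)
      step {Z} {v} Zv≢Yv (BZ , ¬BsZ , Zb , Zc) =
        let B′ , ¬B′ = switch-propagates {Z} edges BZ ¬BsZ in B′ , ¬B′ , keeps Zb , keeps Zc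
        where
        open Switch Z Y {v} Zv≢Yv
        agree′ : ∀ {u} → mate Z u ≡ mate Y u → mate Z (mate Z u) ≡ mate Y (mate Z u)
        agree′ {u} e = trans (involutive Z u) (sym (trans (cong (mate Y) e) (involutive Y u)))
        apart : ∀ {u} → mate Z u ≡ mate Y u → All (λ w → u ≢ w × mate Z u ≢ w) (mate Z v ∷ mate Y v ∷ [])
        apart e = (proj₁ (unmoved e) , proj₁ (unmoved (agree′ e))) ∷ (proj₂ (unmoved e) , proj₂ (unmoved (agree′ e))) ∷ []
        edges : InDistinctEdges Z (b ∷ c ∷ mate Z v ∷ mate Y v ∷ [])
        edges = ((b≢c , Xb≢c ∘ trans (sym (trans Zb Yb))) ∷ apart Zb) ∷ apart Zc ∷
          ((Zv≢Yv , λ e → irreflexive Y v (trans (sym e) (involutive Z v))) ∷ []) ∷ [] ∷ []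

    -- Two stars, each avoided by some member, hold at most `2 * n * d` members together, and
    -- `large` asks for one `d` more.
    star-of-two : ∀ {b c} {X : Mat N} → b ≢ c → mate X b ≢ c →
      (∀ {Y} → Y ∈ A → mate Y b ≡ mate X b ⊎ mate Y c ≡ mate X c) → InStar A
    star-of-two {b} {c} {X} b≢c Xb≢c either
      with All.all? (λ Y → mate Y b Finₚ.≟ mate X b) A | All.all? (λ Y → mate Y c Finₚ.≟ mate X c) A
    ... | yes all | _ = b , mate X b , irreflexive X b ∘ sym , all
    ... | no _ | yes all = c , mate X c , irreflexive X c ∘ sym , all
    ... | no ¬allb | no ¬allc with not-all⇒member ¬allb | not-all⇒member ¬allc
    ...   | Y , Y∈ , Yb | Z , Z∈ , Zc = contradiction (begin
      length A                     ≤⟨ length≤cover {P = λ v W → mate W v ≡ mate X v} (λ v W → mate W v Finₚ.≟ mate X v)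
                                        (n * d) (b ∷ c ∷ []) A covers small ⟩
      2 * (n * d)                  ≡⟨ sym (*-assoc 2 n d) ⟩
      2 * n * d                    ∎)
      (<⇒≱ (begin-strict
      2 * n * d                    <⟨ m<m+n _ ([2-1]!!>0 n) ⟩
      2 * n * d + d                ≡⟨ solve 2 (λ n d → con 2 :* n :* d :+ d := (con 2 :* n :+ con 1) :* d) refl n d ⟩
      [2 suc n -1]!!               ≤⟨ large ⟩
      length A                     ∎))
      where
      open ≤-Reasoning
      d = [2 n -1]!!
      covers : ∀ {Y} → Y ∈ A → ∃[ v ] (v ∈ b ∷ c ∷ [] × mate Y v ≡ mate X v)
      covers Y∈ with either Y∈
      ... | inj₁ e = b , here refl , e
      ... | inj₂ e = c , there (here refl) , e
      small : ∀ {v} → v ∈ b ∷ c ∷ [] → length (A ⟨ v ↦ mate X v ⟩) ≤ n * d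
      small (here refl) = star-split-≤ N≡2n distinct intersecting (irreflexive X b ∘ sym) Y∈ Yb
      small (there (here refl)) = star-split-≤ N≡2n distinct intersecting (irreflexive X c ∘ sym) Z∈ Zc

    -- Switches connect all matchings, so a family closed under them would contain both of the
    -- disjoint `X₀` and `Y₀`.
    extremal-star : ∀ (X₀ Y₀ : Mat N) → ¬ Meets X₀ Y₀ → ∀ {X₁} → X₁ ∈ A → InStar A
    extremal-star X₀ Y₀ X₀∩Y₀=∅ {X₁} X₁∈ with Any.any? (λ X → Finₚ.any? (λ b → Finₚ.any? (λ c → ¬? (belongs? A (swap b c • X))))) A
    ... | no none = contradiction (B-meets {X₀} {Y₀} (everything X₀) (everything Y₀)) X₀∩Y₀=∅
      where
      closed : ∀ b c {X} → B X → B (swap b c • X)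
      closed b c {X} BX with find BX
      ... | X′ , X′∈ , X≈X′ with belongs? A (swap b c • X′)
      ...   | yes B′ = B-resp {swap b c • X′} {swap b c • X} (•-cong (swap b c) {X′} {X} (≈-sym {N} {X} {X′} X≈X′)) B′
      ...   | no ¬B′ = contradiction (lose X′∈ (b , c , ¬B′)) none
      everything : ∀ Y → B Y
      everything Y = switch-connected Y B (λ {X} {X′} → B-resp {X} {X′}) (λ {X} {v} _ → closed (mate X v) (mate Y v) {X})
        {X₁} (lose X₁∈ (λ _ → refl))
    ... | yes found with find found
    ...   | X , X∈ , b , c , ¬BsX = star-of-two {b} {c} {X} b≢c Xb≢c either
      where
      BX : B X
      BX = lose X∈ (λ _ → refl)
      b≢c : b ≢ c
      b≢c refl = ¬BsX (B-resp {X} {swap b b • X} (λ v → sym (trans (trivial _) (cong (mate X) (trivial v)))) BX)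
        where
        trivial : ∀ v → PC.transpose b b v ≡ v
        trivial v = cases (v Finₚ.≟ b)
          where
          cases : Dec (v ≡ b) → PC.transpose b b v ≡ v
          cases (yes refl) = transpose-left b b
          cases (no v≢b)   = transpose-other v≢b v≢b
      Xb≢c : mate X b ≢ c
      Xb≢c e = ¬BsX (B-resp {X} {swap b c • X} (≈-sym {N} {swap b c • X} {X} (swap-fixes X e)) BX)
      either : ∀ {Y} → Y ∈ A → mate Y b ≡ mate X b ⊎ mate Y c ≡ mate X c
      either {Y} Y∈ with mate Y b Finₚ.≟ mate X b | mate Y c Finₚ.≟ mate X c
      ... | yes e | _ = inj₁ e
      ... | no _ | yes e = inj₂ e
      -- A member avoiding both edges would be disjoint from some matching `Z` through both, yet `Z`
      -- lies in `A`.
      ... | no Yb | no Yc =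
        let Z , Zb , Zc , Z∩Y=∅ = disjoint-through 6<N X Y {b} {c} (Yb ∘ sym) (Yc ∘ sym)
        in contradiction (B-meets {Z} {Y} (contains-two-edges {X} BX ¬BsX b≢c Xb≢c Z Zb Zc) (lose Y∈ (λ _ → refl))) Z∩Y=∅

  -- A 1-factorisation of K₂ₙ with a 4-cycle in the union of two factors

  isOdd : ℕ → Bool
  isOdd zero    = false
  isOdd (suc n) = not (isOdd n)

  isOdd-+ : ∀ u v → isOdd (u + v) ≡ isOdd u xor isOdd v
  isOdd-+ zero v = refl
  isOdd-+ (suc u) v with isOdd u | isOdd-+ u v
  ... | true  | e = trans (cong not e) (not-not _)
    where
    not-not : ∀ b → not (not b) ≡ b
    not-not true = refl
    not-not false = refl
  ... | false | e = cong not e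

  isOdd-double : ∀ u → isOdd (2 * u) ≡ false
  isOdd-double u = trans (isOdd-+ u (u + 0)) (trans (cong (isOdd u xor_) (cong isOdd (+-identityʳ u))) (xor-self (isOdd u)))
    where
    xor-self : ∀ b → b xor b ≡ false
    xor-self true = refl
    xor-self false = refl

  -- Congruence of natural numbers

  infix 4 _∼_[_]
  -- Multiples may be added on both sides, so that no subtraction occurs and symmetry is immediate.
  record _∼_[_] (u v m : ℕ) : Set where
    constructor multiples
    field
      i j      : ℕ
      congruent : u + i * m ≡ v + j * m

  module _ {m : ℕ} where

    ∼-reflexive : ∀ {u v} → u ≡ v → u ∼ v [ m ]
    ∼-reflexive refl = multiples 0 0 refl

    ∼-sym : ∀ {u v} → u ∼ v [ m ] → v ∼ u [ m ]
    ∼-sym (multiples i j e) = multiples j i (sym e)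

    ∼-+ : ∀ {u v u′ v′} → u ∼ v [ m ] → u′ ∼ v′ [ m ] → u + u′ ∼ v + v′ [ m ]
    ∼-+ {u} {v} {u′} {v′} (multiples i j e) (multiples i′ j′ e′) = multiples (i + i′) (j + j′)
      (trans (regroup u u′ i i′) (trans (cong₂ _+_ e e′) (sym (regroup v v′ j j′))))
      where
      regroup : ∀ u u′ i i′ → (u + u′) + (i + i′) * m ≡ (u + i * m) + (u′ + i′ * m)
      regroup u u′ i i′ = solve 5 (λ u u′ i i′ m → (u :+ u′) :+ (i :+ i′) :* m := (u :+ i :* m) :+ (u′ :+ i′ :* m)) refl u u′ i i′ m

    ∼-cancelʳ : ∀ {u v} w → u + w ∼ v + w [ m ] → u ∼ v [ m ]
    ∼-cancelʳ {u} {v} w (multiples i j e) = multiples i j (+-cancelʳ-≡ w (u + i * m) (v + j * m)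
      (trans (regroup u i) (trans e (sym (regroup v j)))))
      where
      regroup : ∀ u i → u + i * m + w ≡ u + w + i * m
      regroup u i = solve 3 (λ u x w → u :+ x :+ w := u :+ w :+ x) refl u (i * m) w

    ∼-trans : ∀ {u v w} → u ∼ v [ m ] → v ∼ w [ m ] → u ∼ w [ m ]
    ∼-trans {u} {v} {w} p q = ∼-cancelʳ v (subst (u + v ∼_[ m ]) (+-comm v w) (∼-+ p q))

    ∼-modulus : ∀ {u} → u + m ∼ u [ m ]
    ∼-modulus {u} = multiples 0 1 (trans (+-identityʳ (u + m)) (cong (u +_) (sym (+-identityʳ m))))

    ∼⇒≡ : ∀ {u v} → u < m → v < m → u ∼ v [ m ] → u ≡ v
    ∼⇒≡ {u} {v} u<m v<m (multiples i j e) = go i j e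
      where
      shuffle : ∀ u i → u + i * m + m ≡ u + suc i * m
      shuffle u i = trans (+-assoc u (i * m) m) (cong (u +_) (+-comm (i * m) m))
      overflow : ∀ u v j → u < m → u + 0 ≢ v + suc j * m
      overflow u v j u<m e = contradiction u<m (≤⇒≯ (begin
        m                  ≤⟨ m≤m+n m (j * m) ⟩
        suc j * m          ≤⟨ m≤n+m (suc j * m) v ⟩
        v + suc j * m      ≡⟨ sym e ⟩
        u + 0              ≡⟨ +-identityʳ u ⟩
        u                  ∎))
        where open ≤-Reasoning
      go : ∀ i j → u + i * m ≡ v + j * m → u ≡ v
      go zero zero e       = trans (sym (+-identityʳ u)) (trans e (+-identityʳ v))
      go (suc i) (suc j) e = go i j (+-cancelʳ-≡ m _ _ (trans (shuffle u i) (trans e (sym (shuffle v j)))))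
      go zero (suc j) e    = contradiction e (overflow u v j u<m)
      go (suc i) zero e    = contradiction (sym e) (overflow v u i v<m)

    ∼-mod : .{{_ : NonZero m}} → ∀ u → toℕ (u mod m) ∼ u [ m ]
    ∼-mod u = multiples (u / m) 0 (trans (cong (_+ u / m * m) (Finₚ.toℕ-fromℕ< (m%n<n u m)))
      (trans (sym (m≡m%n+[m/n]*n u m)) (sym (+-identityʳ u))))

    mod-injective : .{{_ : NonZero m}} → ∀ {u v} → u mod m ≡ v mod m → u ∼ v [ m ]
    mod-injective {u} {v} e = ∼-trans (∼-sym (∼-mod u)) (∼-trans (∼-reflexive (cong toℕ e)) (∼-mod v))

  ∼-half : ∀ {h u v} → 2 * u ∼ 2 * v [ 2 * h ] → u ∼ v [ h ]
  ∼-half {h} {u} {v} (multiples i j e) = multiples i j (*-cancelˡ-≡ _ _ 2 (trans (regroup u i) (trans e (sym (regroup v j)))))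
    where
    regroup : ∀ u i → 2 * (u + i * h) ≡ 2 * u + i * (2 * h)
    regroup u i = solve 3 (λ u i h → con 2 :* (u :+ i :* h) := con 2 :* u :+ i :* (con 2 :* h)) refl u i h

  even≁odd : ∀ h {u v} → ¬ 2 * u ∼ suc (2 * v) [ 2 * h ]
  even≁odd h {u} {v} (multiples i j e) = even≢odd (u + i * h) (v + j * h) (trans (regroup u i) (trans e (cong suc (sym (regroup v j)))))
    where
    regroup : ∀ u i → 2 * (u + i * h) ≡ 2 * u + i * (2 * h)
    regroup u i = solve 3 (λ u i h → con 2 :* (u :+ i :* h) := con 2 :* u :+ i :* (con 2 :* h)) refl u i h

  -- A starter for 1-factorising K₂ₙ around a K₄: all residues mod 2h but four holes, which go to the vertices of the K₄,
  -- are paired so that, up to sign, each difference other than 1 and h occurs once. The pairs with sum 2a have the even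
  -- differences 2, …, 2a; those with sum 4a + 2b + 3 have the odd differences 3, …, 2b + 1.
  module Starter (a b : ℕ) (a≤1+b : a ≤ suc b) (b≤a : b ≤ a) where

    h m Σ : ℕ
    h = suc (suc (a + b))
    m = 2 * h
    Σ = suc (2 * (2 * a + suc b))

    -- The residues split into a low block 0, ..., 2a, a high block 2a + 1, ..., 2a + 2b + 2, and
    -- the last residue m - 1. Reflecting each block leaves the centre of the low one fixed, and the
    -- middle pair of the high one has the forbidden difference 1; these three and m - 1 are the
    -- holes.
    hole : Fin 4 → ℕ
    hole 0F = a
    hole 1F = 2 * a + suc b
    hole 2F = 2 * a + suc (suc b)
    hole 3F = 2 * a + suc (suc (suc (2 * b)))

    data Paired (p q : ℕ) : Set where
      low  : p + q ≡ 2 * a → p ≢ q → Paired p q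
      high : p + q ≡ Σ → 2 * a < p → 2 * a < q → p ≢ suc q → q ≢ suc p → Paired p q

    paired-sym : ∀ {p q} → Paired p q → Paired q p
    paired-sym {p} {q} (low e p≢q)             = low (trans (+-comm q p) e) (p≢q ∘ sym)
    paired-sym {p} {q} (high e lp lq p≢ q≢)    = high (trans (+-comm q p) e) lq lp q≢ p≢

    Σ≡ : Σ ≡ 2 * a + (2 * a + suc (suc (suc (2 * b))))
    Σ≡ = solve 2 (λ a b → con 1 :+ con 2 :* (con 2 :* a :+ (con 1 :+ b)) := con 2 :* a :+ (con 2 :* a :+ (con 3 :+ con 2 :* b))) refl a b

    m≡ : m ≡ suc (2 * a + suc (suc (suc (2 * b))))
    m≡ = solve 2 (λ a b → con 2 :* (con 2 :+ (a :+ b)) := con 1 :+ (con 2 :* a :+ (con 3 :+ con 2 :* b))) refl a b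

    low-≤ : ∀ {p q} → p + q ≡ 2 * a → p ≤ 2 * a
    low-≤ {p} {q} e = subst (p ≤_) e (m≤m+n p q)

    high-≤ : ∀ {p q} → p + q ≡ Σ → 2 * a < q → p < 2 * a + suc (suc (suc (2 * b)))
    high-≤ {p} {q} e lq = +-cancelʳ-< (2 * a) p _ (begin-strict
      p + 2 * a                                     <⟨ +-monoʳ-< p lq ⟩
      p + q                                         ≡⟨ trans e Σ≡ ⟩
      2 * a + (2 * a + suc (suc (suc (2 * b))))     ≡⟨ +-comm (2 * a) _ ⟩
      2 * a + suc (suc (suc (2 * b))) + 2 * a       ∎)
      where open ≤-Reasoning

    paired-< : ∀ {p q} → Paired p q → p < m
    paired-< {p} (low e _) = subst (p <_) (sym m≡) (s≤s (≤-trans (low-≤ e) (m≤m+n (2 * a) _)))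
    paired-< {p} (high e _ lq _ _) = subst (p <_) (sym m≡) (s≤s (<⇒≤ (high-≤ e lq)))

    hole-< : ∀ i → hole i < m
    hole-< 0F = subst (a <_) (sym m≡) (s≤s (≤-trans (m≤m+n a (a + 0)) (m≤m+n (2 * a) _)))
    hole-< 1F = subst (hole 1F <_) (sym m≡) (s≤s (+-monoʳ-≤ (2 * a) (s≤s (≤-trans (m≤m+n b (b + 0)) (m≤n+m (2 * b) 2)))))
    hole-< 2F = subst (hole 2F <_) (sym m≡) (s≤s (+-monoʳ-≤ (2 * a) (s≤s (s≤s (≤-trans (m≤m+n b (b + 0)) (m≤n+m (2 * b) 1))))))
    hole-< 3F = subst (hole 3F <_) (sym m≡) ≤-refl

    paired-unique : ∀ {p q q′} → Paired p q → Paired p q′ → q ≡ q′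
    paired-unique {p} (low e _) (low e′ _) = +-cancelˡ-≡ p _ _ (trans e (sym e′))
    paired-unique {p} (high e _ _ _ _) (high e′ _ _ _ _) = +-cancelˡ-≡ p _ _ (trans e (sym e′))
    paired-unique (low e _) (high _ lp _ _ _) = contradiction (low-≤ e) (<⇒≱ lp)
    paired-unique (high _ lp _ _ _) (low e _) = contradiction (low-≤ e) (<⇒≱ lp)

    Σ≡centre : 2 * a + suc b + suc (2 * a + suc b) ≡ Σ
    Σ≡centre = solve 1 (λ c → c :+ (con 1 :+ c) := con 1 :+ con 2 :* c) refl (2 * a + suc b)

    2a≱ : ∀ {x} → ¬ 2 * a + suc x ≤ 2 * a
    2a≱ = <⇒≱ (m<m+n (2 * a) (s≤s z≤n))

    paired-hole : ∀ {p q} i → Paired p q → p ≢ hole i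
    paired-hole 0F (low e p≢q) refl = p≢q (sym (trans (+-cancelˡ-≡ a _ _ e) (+-identityʳ a)))
    paired-hole 1F (low e _) refl = 2a≱ (low-≤ e)
    paired-hole 2F (low e _) refl = 2a≱ (low-≤ e)
    paired-hole 3F (low e _) refl = 2a≱ (low-≤ e)
    paired-hole 0F (high _ lp _ _ _) refl = <⇒≱ lp (m≤m+n a (a + 0))
    paired-hole 1F (high e _ _ _ q≢) refl = q≢ (+-cancelˡ-≡ (2 * a + suc b) _ _ (trans e (sym Σ≡centre)))
    paired-hole {p} {q} 2F (high e _ _ p≢ _) refl = p≢ (trans (+-suc (2 * a) (suc b)) (cong suc (sym
      (+-cancelˡ-≡ (suc (2 * a + suc b)) _ _ (trans (cong (_+ q) (sym (+-suc (2 * a) (suc b)))) (trans e (trans (sym Σ≡centre) (+-comm (2 * a + suc b) _))))))))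
    paired-hole 3F (high e _ lq _ _) refl = <-irrefl refl (high-≤ e lq)

    hole-injective : ∀ {i j} → hole i ≡ hole j → i ≡ j
    hole-injective {0F} {0F} _ = refl
    hole-injective {1F} {1F} _ = refl
    hole-injective {2F} {2F} _ = refl
    hole-injective {3F} {3F} _ = refl
    hole-injective {0F} {1F} e = contradiction (m≤m+n a (a + 0)) (<⇒≱ (subst (2 * a <_) (sym e) (m<m+n (2 * a) (s≤s z≤n))))
    hole-injective {0F} {2F} e = contradiction (m≤m+n a (a + 0)) (<⇒≱ (subst (2 * a <_) (sym e) (m<m+n (2 * a) (s≤s z≤n))))
    hole-injective {0F} {3F} e = contradiction (m≤m+n a (a + 0)) (<⇒≱ (subst (2 * a <_) (sym e) (m<m+n (2 * a) (s≤s z≤n))))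
    hole-injective {1F} {0F} e = contradiction (m≤m+n a (a + 0)) (<⇒≱ (subst (2 * a <_) e (m<m+n (2 * a) (s≤s z≤n))))
    hole-injective {2F} {0F} e = contradiction (m≤m+n a (a + 0)) (<⇒≱ (subst (2 * a <_) e (m<m+n (2 * a) (s≤s z≤n))))
    hole-injective {3F} {0F} e = contradiction (m≤m+n a (a + 0)) (<⇒≱ (subst (2 * a <_) e (m<m+n (2 * a) (s≤s z≤n))))
    hole-injective {1F} {2F} e = contradiction (+-cancelˡ-≡ (2 * a) _ _ e) (<⇒≢ ≤-refl)
    hole-injective {2F} {1F} e = contradiction (+-cancelˡ-≡ (2 * a) _ _ (sym e)) (<⇒≢ ≤-refl)
    hole-injective {1F} {3F} e = contradiction (suc-injective (+-cancelˡ-≡ (2 * a) _ _ e)) (<⇒≢ (s≤s (≤-trans (m≤m+n b (b + 0)) (n≤1+n (2 * b)))))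
    hole-injective {3F} {1F} e = contradiction (suc-injective (+-cancelˡ-≡ (2 * a) _ _ (sym e))) (<⇒≢ (s≤s (≤-trans (m≤m+n b (b + 0)) (n≤1+n (2 * b)))))
    hole-injective {2F} {3F} e = contradiction (suc-injective (suc-injective (+-cancelˡ-≡ (2 * a) _ _ e))) (<⇒≢ (s≤s (m≤m+n b (b + 0))))
    hole-injective {3F} {2F} e = contradiction (suc-injective (suc-injective (+-cancelˡ-≡ (2 * a) _ _ (sym e)))) (<⇒≢ (s≤s (m≤m+n b (b + 0))))

    classify : ∀ p → p < m → (∃[ q ] Paired p q) ⊎ (∃[ i ] p ≡ hole i)
    classify p p<m with p ≤? 2 * a | p Data.Nat.≟ a
    ... | yes _ | yes p≡a = inj₂ (0F , p≡a)
    ... | yes p≤2a | no p≢a = inj₁ (2 * a ∸ p , low e λ p≡q → p≢a (*-cancelˡ-≡ p a 2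
            (trans (cong (p +_) (trans (+-identityʳ p) p≡q)) e)))
      where e = m+[n∸m]≡n p≤2a
    ... | no p≰2a | _ with p Data.Nat.≟ hole 1F | p Data.Nat.≟ hole 2F | p Data.Nat.≟ hole 3F
    ...   | yes e | _ | _ = inj₂ (1F , e)
    ...   | no _ | yes e | _ = inj₂ (2F , e)
    ...   | no _ | no _ | yes e = inj₂ (3F , e)
    ...   | no p≢₁ | no p≢₂ | no p≢₃ = inj₁ (q , high e (≰⇒> p≰2a) 2a<q p≢1+q q≢1+p)
      where
      q = Σ ∸ p
      p<hole₃ : p < hole 3F
      p<hole₃ = ≤∧≢⇒< (≤-pred (subst (p <_) m≡ p<m)) p≢₃
      e : p + q ≡ Σ
      e = m+[n∸m]≡n (≤-trans (<⇒≤ p<hole₃) (subst (hole 3F ≤_) (sym Σ≡) (m≤n+m (hole 3F) (2 * a))))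
      2a<q : 2 * a < q
      2a<q = +-cancelˡ-< p (2 * a) q (subst (p + 2 * a <_) (trans (+-comm (hole 3F) (2 * a)) (trans (sym Σ≡) (sym e))) (+-monoˡ-< (2 * a) p<hole₃))
      half : ∀ {x} → x + suc x ≡ Σ → x ≡ hole 1F
      half {x} e = *-cancelˡ-≡ x (hole 1F) 2 (suc-injective (trans (solve 1 (λ x → con 1 :+ con 2 :* x := x :+ (con 1 :+ x)) refl x) e))
      p≢1+q : p ≢ suc q
      p≢1+q p≡ = p≢₂ (trans p≡ (trans (cong suc (half (trans (+-comm q (suc q)) (trans (cong (_+ q) (sym p≡)) e)))) (sym (+-suc (2 * a) (suc b)))))
      q≢1+p : q ≢ suc p
      q≢1+p q≡ = p≢₁ (half (trans (cong (p +_) (sym q≡)) e))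

    -- Here and in `2b+2≤h` the balance of `a` and `b` enters: each block must fit into a window of
    -- length `h`, on which congruence modulo `h` is equality.
    2a<h : 2 * a < h
    2a<h = s≤s (subst (_≤ suc (a + b)) (cong (a +_) (sym (+-identityʳ a))) (subst (a + a ≤_) (+-suc a b) (+-monoʳ-≤ a a≤1+b)))

    2b+2≤h : 2 * suc b ≤ h
    2b+2≤h = s≤s (subst (b + suc (b + 0) ≤_) (+-suc a b) (+-mono-≤ b≤a (s≤s (≤-reflexive (+-identityʳ b)))))

    low-<h : ∀ {p q} → p + q ≡ 2 * a → p < h
    low-<h e = ≤-<-trans (low-≤ e) 2a<h

    high-window : ∀ {p q} → p + q ≡ Σ → 2 * a < p → 2 * a < q → ∃[ x ] (p ≡ x + suc (2 * a) × x < h)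
    high-window {p} e lp lq = p ∸ suc (2 * a) , sym (m∸n+n≡m lp) ,
      <-≤-trans (+-cancelʳ-< (suc (2 * a)) _ _ (subst₂ _<_ (sym (m∸n+n≡m lp))
        (solve 2 (λ a b → con 2 :* a :+ (con 3 :+ con 2 :* b) := con 2 :* (con 1 :+ b) :+ (con 1 :+ con 2 :* a)) refl a b)
        (high-≤ e lq))) 2b+2≤h

    window-injective : ∀ {p q p′ q′} → p + q ≡ Σ → 2 * a < p → 2 * a < q → p′ + q′ ≡ Σ → 2 * a < p′ → 2 * a < q′ →
      p ∼ p′ [ h ] → p ≡ p′
    window-injective e lp lq e′ lp′ lq′ p∼p′ with high-window e lp lq | high-window e′ lp′ lq′
    ... | x , refl , x<h | x′ , refl , x′<h = cong (_+ suc (2 * a)) (∼⇒≡ x<h x′<h (∼-cancelʳ (suc (2 * a)) p∼p′))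

    -- Adding p + p′ to both sides turns an equation of differences into one of sums, and a sum is
    -- constant on each block.
    difference-sum : ∀ {p q p′ q′ s s′} → p + q ≡ s → p′ + q′ ≡ s′ → q + p′ ∼ q′ + p [ m ] → 2 * p′ + s ∼ 2 * p + s′ [ m ]
    difference-sum {p} {q} {p′} {q′} refl refl d = subst₂ _∼_[ m ]
      (solve 3 (λ p q p′ → q :+ p′ :+ (p :+ p′) := con 2 :* p′ :+ (p :+ q)) refl p q p′)
      (solve 3 (λ p q′ p′ → q′ :+ p :+ (p :+ p′) := con 2 :* p :+ (p′ :+ q′)) refl p q′ p′)
      (∼-+ d (∼-reflexive {m} {p + p′} refl))

    different-parity : ∀ {u v} → ¬ 2 * u + 2 * a ∼ 2 * v + Σ [ m ]
    different-parity {u} {v} d = even≁odd h {u + a} {v + (2 * a + suc b)} (subst₂ _∼_[ m ]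
      (sym (*-distribˡ-+ 2 u a)) (trans (+-suc (2 * v) _) (cong suc (sym (*-distribˡ-+ 2 v (2 * a + suc b))))) d)

    -- Within one block the sums cancel, and halving leaves a congruence modulo `h` inside a window.
    -- Across blocks the two sums differ in parity, which the even modulus respects. As `Paired` is
    -- symmetric, this gives uniqueness of differences up to sign.
    paired-difference : ∀ {p q p′ q′} → Paired p q → Paired p′ q′ → q + p′ ∼ q′ + p [ m ] → p ≡ p′
    paired-difference {p} {q} {p′} {q′} (low e _) (low e′ _) d =
      ∼⇒≡ (low-<h e) (low-<h e′) (∼-sym (∼-half (∼-cancelʳ (2 * a) (difference-sum {p} {q} {p′} {q′} e e′ d))))
    paired-difference {p} {q} {p′} {q′} (high e lp lq _ _) (high e′ lp′ lq′ _ _) d =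
      window-injective e lp lq e′ lp′ lq′ (∼-sym (∼-half (∼-cancelʳ Σ (difference-sum {p} {q} {p′} {q′} e e′ d))))
    paired-difference {p} {q} {p′} {q′} (low e _) (high e′ _ _ _ _) d = contradiction (difference-sum {p} {q} {p′} {q′} e e′ d) (different-parity {p′} {p})
    paired-difference {p} {q} {p′} {q′} (high e _ _ _ _) (low e′ _) d = contradiction (∼-sym (difference-sum {p} {q} {p′} {q′} e e′ d)) (different-parity {p} {p′})

    paired-irreflexive : ∀ {p} → ¬ Paired p p
    paired-irreflexive (low _ p≢p) = p≢p refl
    paired-irreflexive {p} (high e _ _ _ _) = even≢odd p (2 * a + suc b) (trans (cong (p +_) (+-identityʳ p)) e)

    -- A low pair has an even sum, unlike p + (p + 1); a high pair would be the middle one, which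
    -- was removed.
    paired-difference≢1 : ∀ {p q} → Paired p q → ¬ q ∼ suc p [ m ]
    paired-difference≢1 {p} {q} (low e _) d = even≁odd h {a} {p} (subst₂ _∼_[ m ] e
      (solve 1 (λ p → p :+ (con 1 :+ p) := con 1 :+ con 2 :* p) refl p) (∼-+ (∼-reflexive {m} {p} refl) d))
    paired-difference≢1 {p} {q} P@(high e lp lq _ _) d = paired-hole 1F P (window-injective e lp lq Σ≡centre
      (m<m+n (2 * a) (s≤s z≤n)) (s≤s (m≤m+n (2 * a) (suc b)))
      (∼-sym (∼-half (∼-cancelʳ 1 (subst₂ _∼_[ m ] (trans e (+-comm 1 _))
        (solve 1 (λ p → p :+ (con 1 :+ p) := con 2 :* p :+ con 1) refl p) (∼-+ (∼-reflexive {m} {p} refl) d))))))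

    -- Both members of a pair lie in one window of length `h`.
    paired-difference≢h : ∀ {p q} → Paired p q → ¬ q ∼ p + h [ m ]
    paired-difference≢h {p} {q} P d = contradiction d (apart P)
      where
      apart′ : ∀ {x y} → x < h → y < h → ¬ y ∼ x + h [ m ]
      apart′ {x} {y} x<h y<h d = <⇒≱ y<h (subst (h ≤_)
        (sym (∼⇒≡ (<-≤-trans y<h (m≤m+n h (h + 0))) (subst (x + h <_) (cong (h +_) (sym (+-identityʳ h))) (+-monoˡ-< h x<h)) d))
        (m≤n+m h x))
      apart : Paired p q → ¬ q ∼ p + h [ m ]
      apart (low e _) = apart′ (low-<h e) (low-<h (trans (+-comm q p) e))
      apart (high e lp lq _ _) d with high-window e lp lq | high-window (trans (+-comm q p) e) lq lp
      ... | x , refl , x<h | y , refl , y<h = apart′ x<h y<h (∼-cancelʳ (suc (2 * a)) (subst (y + suc (2 * a) ∼_[ m ])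
        (solve 3 (λ x c h → x :+ c :+ h := x :+ h :+ c) refl x (suc (2 * a)) h) d))

  module Factorisation (a b : ℕ) (a≤1+b : a ≤ suc b) (b≤a : b ≤ a) where

    open Starter a b a≤1+b b≤a

    partner : ℕ → Fin 4 ⊎ ℕ
    partner p with p <? m
    -- A default value; only residues below `m` are ever looked up.
    ... | no _    = inj₁ 0F
    ... | yes p<m = [ (λ { (q , _) → inj₂ q }) , (λ { (i , _) → inj₁ i }) ]′ (classify p p<m)

    data Partner (p : ℕ) : Set where
      is-paired : ∀ {q} → Paired p q → partner p ≡ inj₂ q → Partner p
      is-hole   : ∀ i → p ≡ hole i → partner p ≡ inj₁ i → Partner p

    partner-cases : ∀ {p} → p < m → Partner p
    partner-cases {p} p<m = from refl
      where
      from : ∀ {x} → partner p ≡ x → Partner p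
      from e with p <? m
      ... | no p≮m = contradiction p<m p≮m
      ... | yes p<m′ with classify p p<m′ in eq
      ...   | inj₁ (q , pq) = is-paired pq (value eq)
        where
        value : ∀ {c} → classify p p<m′ ≡ inj₁ (q , c) → partner p ≡ inj₂ q
        value eq with p <? m
        ... | no p≮m = contradiction p<m p≮m
        ... | yes p<m″ rewrite ≤-irrelevant p<m″ p<m′ | eq = refl
      ...   | inj₂ (i , pi) = is-hole i pi (value eq)
        where
        value : ∀ {c} → classify p p<m′ ≡ inj₂ (i , c) → partner p ≡ inj₁ i
        value eq with p <? m
        ... | no p≮m = contradiction p<m p≮m
        ... | yes p<m″ rewrite ≤-irrelevant p<m″ p<m′ | eq = refl

    partner-paired : ∀ {p q} → Paired p q → partner p ≡ inj₂ q
    partner-paired P with partner-cases (paired-< P)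
    ... | is-paired P′ e = trans e (cong inj₂ (paired-unique P′ P))
    ... | is-hole i p≡ _ = contradiction p≡ (paired-hole i P)

    partner-hole : ∀ i → partner (hole i) ≡ inj₁ i
    partner-hole i with partner-cases (hole-< i)
    ... | is-paired P _ = contradiction refl (paired-hole i P)
    ... | is-hole j hi≡hj e = trans e (cong inj₁ (hole-injective {j} {i} (sym hi≡hj)))

    Vtx Colour : Set
    Vtx    = Fin 4 ⊎ Fin m
    Colour = Fin 3 ⊎ Fin m

    shift : Fin m → Fin 4 ⊎ ℕ → Vtx
    shift k (inj₁ i) = inj₁ i
    shift k (inj₂ q) = inj₂ ((q + toℕ k) mod m)

    infixl 6 _⊖_
    _⊖_ : Fin m → Fin m → ℕ
    x ⊖ k = toℕ ((toℕ x + (m ∸ toℕ k)) mod m)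

    ⊖-< : ∀ x k → x ⊖ k < m
    ⊖-< x k = Finₚ.toℕ<n ((toℕ x + (m ∸ toℕ k)) mod m)

    ⊖-+ : ∀ x k → x ⊖ k + toℕ k ∼ toℕ x [ m ]
    ⊖-+ x k = ∼-trans (∼-+ (∼-mod (toℕ x + (m ∸ toℕ k))) (∼-reflexive {m} {toℕ k} refl))
      (∼-trans (∼-reflexive (trans (+-assoc (toℕ x) _ _) (cong (toℕ x +_) (m∸n+n≡m (<⇒≤ (Finₚ.toℕ<n k)))))) ∼-modulus)

    ⊖-of-shift : ∀ {q} k → q < m → ((q + toℕ k) mod m) ⊖ k ≡ q
    ⊖-of-shift {q} k q<m = ∼⇒≡ (⊖-< ((q + toℕ k) mod m) k) q<m (∼-cancelʳ (toℕ k) (∼-trans (⊖-+ ((q + toℕ k) mod m) k) (∼-mod (q + toℕ k))))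

    shift-of-⊖ : ∀ x k → (x ⊖ k + toℕ k) mod m ≡ x
    shift-of-⊖ x k = Finₚ.toℕ-injective (∼⇒≡ (Finₚ.toℕ<n _) (Finₚ.toℕ<n x)
      (∼-trans (∼-mod (x ⊖ k + toℕ k)) (⊖-+ x k)))

    -- The translation exchanged by special colour j: two alternating matchings of the m-cycle and its diameters.
    step : Fin 3 → Bool → ℕ
    step 0F odd = if odd then m ∸ 1 else 1
    step 1F odd = if odd then 1 else m ∸ 1
    step 2F odd = h

    mate₄ : Fin 3 → Fin 4 → Fin 4
    mate₄ 0F 0F = 1F
    mate₄ 0F 1F = 0F
    mate₄ 0F 2F = 3F
    mate₄ 0F 3F = 2F
    mate₄ 1F 0F = 2F
    mate₄ 1F 1F = 3F
    mate₄ 1F 2F = 0F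
    mate₄ 1F 3F = 1F
    mate₄ 2F 0F = 3F
    mate₄ 2F 1F = 2F
    mate₄ 2F 2F = 1F
    mate₄ 2F 3F = 0F

    mate₄-involutive : ∀ j i → mate₄ j (mate₄ j i) ≡ i
    mate₄-involutive = toWitness {a? = Finₚ.all? λ j → Finₚ.all? λ i → mate₄ j (mate₄ j i) Finₚ.≟ i} _

    mate₄-irreflexive : ∀ j i → mate₄ j i ≢ i
    mate₄-irreflexive = toWitness {a? = Finₚ.all? λ j → Finₚ.all? λ i → ¬? (mate₄ j i Finₚ.≟ i)} _

    mate₄-injective : ∀ i {j j′} → mate₄ j i ≡ mate₄ j′ i → j ≡ j′
    mate₄-injective i {j} {j′} e with j Finₚ.≟ j′
    ... | yes j≡j′ = j≡j′
    ... | no j≢j′  = [ (λ j≡j′ → contradiction j≡j′ j≢j′) , contradiction e ]′ (toWitness {a? = Finₚ.all? λ j → Finₚ.all? λ j′ →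
        Finₚ.all? λ i → (j Finₚ.≟ j′) ⊎-dec ¬? (mate₄ j i Finₚ.≟ mate₄ j′ i)} _ j j′ i)

    -- Colour `inj₂ k` is the starter translated by k, with its four holes joined to the vertices of
    -- the K₄. The special colours combine the three matchings of the K₄ with the differences 1 and
    -- `h` that the starter omits.
    opposite : Colour → Vtx → Vtx
    opposite (inj₁ j) (inj₁ i) = inj₁ (mate₄ j i)
    opposite (inj₁ j) (inj₂ x) = inj₂ ((toℕ x + step j (isOdd (toℕ x))) mod m)
    opposite (inj₂ k) (inj₁ i) = inj₂ ((hole i + toℕ k) mod m)
    opposite (inj₂ k) (inj₂ x) = shift k (partner (x ⊖ k))

    1<m : 1 < m
    1<m = s≤s (s≤s z≤n)

    h<m : h < m
    h<m = m<m+n h (s≤s z≤n)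

    m∸1<m : m ∸ 1 < m
    m∸1<m = ≤-refl

    h<m∸1 : h < m ∸ 1
    h<m∸1 = subst (h <_) (sym (trans (+-suc (suc (a + b)) (suc (a + b + 0))) (cong suc (+-suc (suc (a + b)) (a + b + 0)))))
      (s≤s (s≤s (s≤s (m≤m+n (a + b) (a + b + 0)))))

    step-< : ∀ j odd → step j odd < m
    step-< 0F true  = m∸1<m
    step-< 0F false = 1<m
    step-< 1F true  = 1<m
    step-< 1F false = m∸1<m
    step-< 2F _     = h<m

    step-cases : ∀ j odd → step j odd ≡ 1 ⊎ step j odd ≡ m ∸ 1 ⊎ step j odd ≡ h
    step-cases 0F true  = inj₂ (inj₁ refl)
    step-cases 0F false = inj₁ refl
    step-cases 1F true  = inj₁ refl
    step-cases 1F false = inj₂ (inj₁ refl)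
    step-cases 2F _     = inj₂ (inj₂ refl)

    1≢m∸1 : 1 ≢ m ∸ 1
    1≢m∸1 = <⇒≢ (≤-trans (s≤s (s≤s z≤n)) h<m∸1)

    h≢1 : h ≢ 1
    h≢1 ()

    h≢m∸1 : h ≢ m ∸ 1
    h≢m∸1 = <⇒≢ h<m∸1

    step-injective : ∀ odd {j j′} → step j odd ≡ step j′ odd → j ≡ j′
    step-injective _ {0F} {0F} _ = refl
    step-injective _ {1F} {1F} _ = refl
    step-injective _ {2F} {2F} _ = refl
    step-injective true  {0F} {1F} e = contradiction (sym e) 1≢m∸1
    step-injective false {0F} {1F} e = contradiction e 1≢m∸1
    step-injective true  {1F} {0F} e = contradiction e 1≢m∸1
    step-injective false {1F} {0F} e = contradiction (sym e) 1≢m∸1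
    step-injective true  {0F} {2F} e = contradiction (sym e) h≢m∸1
    step-injective false {0F} {2F} e = contradiction (sym e) h≢1
    step-injective true  {1F} {2F} e = contradiction (sym e) h≢1
    step-injective false {1F} {2F} e = contradiction (sym e) h≢m∸1
    step-injective true  {2F} {0F} e = contradiction e h≢m∸1
    step-injective false {2F} {0F} e = contradiction e h≢1
    step-injective true  {2F} {1F} e = contradiction e h≢1
    step-injective false {2F} {1F} e = contradiction e h≢m∸1

    isOdd-∼ : ∀ {u v} → u ∼ v [ m ] → isOdd u ≡ isOdd v
    isOdd-∼ {u} {v} (multiples i j e) = trans (sym (parity u i)) (trans (cong isOdd e) (parity v j))
      where
      xor-false : ∀ b → b xor false ≡ b
      xor-false true  = refl
      xor-false false = refl
      parity : ∀ u i → isOdd (u + i * m) ≡ isOdd u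
      parity u i = trans (cong (λ x → isOdd (u + x)) (solve 2 (λ i h → i :* (con 2 :* h) := con 2 :* (i :* h)) refl i h))
        (trans (isOdd-+ u _) (trans (cong (isOdd u xor_) (isOdd-double (i * h))) (xor-false (isOdd u))))

    isOdd-m∸1 : isOdd (m ∸ 1) ≡ true
    isOdd-m∸1 with isOdd (m ∸ 1) | isOdd-double h
    ... | true  | _ = refl

    -- A step by 1 or m - 1 changes parity, which is well defined modulo the even `m`; so the
    -- alternating rule prescribes the opposite step at the other end.
    step-back : ∀ j x y → y ∼ x + step j (isOdd x) [ m ] → step j (isOdd x) + step j (isOdd y) ≡ m
    step-back j x y y∼ = back j (isOdd x) (isOdd y) (trans (isOdd-∼ y∼) (isOdd-+ x _))
      where
      back : ∀ j odd odd′ → odd′ ≡ odd xor isOdd (step j odd) → step j odd + step j odd′ ≡ m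
      back 0F true  _ refl rewrite isOdd-m∸1 = +-comm (m ∸ 1) 1
      back 0F false _ refl = refl
      back 1F true  _ refl = refl
      back 1F false _ refl rewrite isOdd-m∸1 = +-comm (m ∸ 1) 1
      back 2F _     _ _    = cong (h +_) (sym (+-identityʳ h))

    opposite-involutive : ∀ c v → opposite c (opposite c v) ≡ v
    opposite-involutive (inj₁ j) (inj₁ i) = cong inj₁ (mate₄-involutive j i)
    opposite-involutive (inj₁ j) (inj₂ x) = cong inj₂ (Finₚ.toℕ-injective (∼⇒≡ (Finₚ.toℕ<n _) (Finₚ.toℕ<n x)
      (∼-trans (∼-mod (toℕ y + δ′)) (∼-trans (∼-+ y∼ (∼-reflexive {m} {δ′} refl))
        (∼-trans (∼-reflexive (trans (+-assoc (toℕ x) _ _) (cong (toℕ x +_) (step-back j (toℕ x) (toℕ y) y∼)))) ∼-modulus)))))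
      where
      y = (toℕ x + step j (isOdd (toℕ x))) mod m
      δ′ = step j (isOdd (toℕ y))
      y∼ : toℕ y ∼ toℕ x + step j (isOdd (toℕ x)) [ m ]
      y∼ = ∼-mod _
    opposite-involutive (inj₂ k) (inj₁ i) = cong (shift k) (trans (cong partner (⊖-of-shift k (hole-< i))) (partner-hole i))
    opposite-involutive (inj₂ k) (inj₂ x) with partner-cases (⊖-< x k)
    ... | is-paired {q} P e = trans (cong (opposite (inj₂ k) ∘ shift k) e)
            (trans (cong (shift k) (trans (cong partner (⊖-of-shift k (paired-< (paired-sym P)))) (partner-paired (paired-sym P))))
              (cong inj₂ (shift-of-⊖ x k)))
    ... | is-hole i p≡ e = trans (cong (opposite (inj₂ k) ∘ shift k) e)
            (cong inj₂ (trans (cong (λ p → (p + toℕ k) mod m) (sym p≡)) (shift-of-⊖ x k)))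

    ∼-cancelˡ : ∀ {u v} w → w + u ∼ w + v [ m ] → u ∼ v [ m ]
    ∼-cancelˡ {u} {v} w d = ∼-cancelʳ w (subst₂ _∼_[ m ] (+-comm w u) (+-comm w v) d)

    mod≡⇒∼ : ∀ {u} {x : Fin m} → u mod m ≡ x → u ∼ toℕ x [ m ]
    mod≡⇒∼ {u} refl = ∼-sym (∼-mod u)

    opposite-irreflexive : ∀ c v → opposite c v ≢ v
    opposite-irreflexive (inj₁ j) (inj₁ i) e = mate₄-irreflexive j i (inj₁-injective e)
    opposite-irreflexive (inj₁ j) (inj₂ x) e = step-≢0 j (isOdd (toℕ x)) (∼⇒≡ (step-< j (isOdd (toℕ x))) (s≤s z≤n)
      (∼-cancelˡ (toℕ x) (∼-trans (mod≡⇒∼ (inj₂-injective e)) (∼-reflexive (sym (+-identityʳ (toℕ x)))))))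
      where
      step-≢0 : ∀ j odd → step j odd ≢ 0
      step-≢0 0F true  ()
      step-≢0 0F false ()
      step-≢0 1F true  ()
      step-≢0 1F false ()
      step-≢0 2F _     ()
    opposite-irreflexive (inj₂ k) (inj₁ i) ()
    opposite-irreflexive (inj₂ k) (inj₂ x) e with partner-cases (⊖-< x k)
    ... | is-hole i _ e′ with trans (sym (cong (shift k) e′)) e
    ...   | ()
    opposite-irreflexive (inj₂ k) (inj₂ x) e | is-paired {q} P e′ =
      paired-irreflexive (subst (Paired (x ⊖ k)) q≡p P)
      where
      q≡p : q ≡ x ⊖ k
      q≡p = ∼⇒≡ (paired-< (paired-sym P)) (⊖-< x k) (∼-cancelʳ (toℕ k)
        (∼-trans (mod≡⇒∼ (inj₂-injective (trans (sym (cong (shift k) e′)) e))) (∼-sym (⊖-+ x k))))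

    -- Special colours use only the differences 1, m - 1 and `h` on the residues, and none of them
    -- occurs in the starter.
    special≢rotated : ∀ j k v → opposite (inj₁ j) v ≢ opposite (inj₂ k) v
    special≢rotated j k (inj₁ i) ()
    special≢rotated j k (inj₂ x) e with partner-cases (⊖-< x k)
    ... | is-hole i _ e′ with trans e (cong (shift k) e′)
    ...   | ()
    special≢rotated j k (inj₂ x) e | is-paired {q} P e′ =
      [ (λ δ≡1 → paired-difference≢1 P (subst (q ∼_[ m ]) (trans (cong (p +_) δ≡1) (+-comm p 1)) q∼))
      , [ (λ δ≡m∸1 → paired-difference≢1 (paired-sym P) (∼-sym (∼-trans (∼-+ (∼-reflexive {m} {1} refl) q∼)
            (∼-trans (∼-reflexive (trans (cong (λ d → suc (p + d)) δ≡m∸1) (sym (+-suc p (m ∸ 1))))) ∼-modulus))))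
        , (λ δ≡h → paired-difference≢h P (subst (q ∼_[ m ]) (cong (p +_) δ≡h) q∼)) ]′ ]′
      (step-cases j (isOdd (toℕ x)))
      where
      p = x ⊖ k
      δ = step j (isOdd (toℕ x))
      q∼ : q ∼ p + δ [ m ]
      q∼ = ∼-cancelʳ (toℕ k) (∼-trans (∼-sym (mod-injective (inj₂-injective (trans e (cong (shift k) e′)))))
        (∼-trans (∼-+ (∼-sym (⊖-+ x k)) (∼-reflexive {m} {δ} refl))
          (∼-reflexive (solve 3 (λ p k d → p :+ k :+ d := p :+ d :+ k) refl p (toℕ k) δ))))

    toℕ-∼ : ∀ {x y : Fin m} → toℕ x ∼ toℕ y [ m ] → x ≡ y
    toℕ-∼ {x} {y} d = Finₚ.toℕ-injective (∼⇒≡ (Finₚ.toℕ<n x) (Finₚ.toℕ<n y) d)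

    ⊖-injective : ∀ x {k l} → x ⊖ k ≡ x ⊖ l → k ≡ l
    ⊖-injective x {k} {l} e = toℕ-∼ (∼-cancelˡ (x ⊖ k) (∼-trans (⊖-+ x k)
      (∼-trans (∼-sym (⊖-+ x l)) (∼-reflexive (cong (_+ toℕ l) (sym e))))))

    -- No edge has two colours. With 3 + m perfect matchings on 4 + m vertices, this is all that a
    -- 1-factorisation requires.
    opposite-injective : ∀ v {c c′} → opposite c v ≡ opposite c′ v → c ≡ c′
    opposite-injective (inj₁ i) {inj₁ j} {inj₁ j′} e = cong inj₁ (mate₄-injective i (inj₁-injective e))
    opposite-injective (inj₂ x) {inj₁ j} {inj₁ j′} e = cong inj₁ (step-injective (isOdd (toℕ x))
      (∼⇒≡ (step-< j _) (step-< j′ _) (∼-cancelˡ (toℕ x) (mod-injective (inj₂-injective e)))))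
    opposite-injective v {inj₁ j} {inj₂ k} e = contradiction e (special≢rotated j k v)
    opposite-injective v {inj₂ k} {inj₁ j} e = contradiction (sym e) (special≢rotated j k v)
    opposite-injective (inj₁ i) {inj₂ k} {inj₂ l} e = cong inj₂ (toℕ-∼ (∼-cancelˡ (hole i) (mod-injective (inj₂-injective e))))
    opposite-injective (inj₂ x) {inj₂ k} {inj₂ l} e with partner-cases (⊖-< x k) | partner-cases (⊖-< x l)
    ... | is-hole i p≡ ei | is-hole i′ p′≡ ei′ = cong inj₂ (⊖-injective x (trans p≡ (trans (cong hole
            (inj₁-injective (trans (sym (cong (shift k) ei)) (trans e (cong (shift l) ei′))))) (sym p′≡))))
    ... | is-hole i _ ei | is-paired _ eq = contradiction (trans (sym (cong (shift k) ei)) (trans e (cong (shift l) eq))) λ ()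
    ... | is-paired _ eq | is-hole i _ ei = contradiction (trans (sym (cong (shift k) eq)) (trans e (cong (shift l) ei))) λ ()
    -- Two pairs of the starter have been translated onto the same edge, so their differences agree.
    ... | is-paired {q} P eq | is-paired {q′} P′ eq′ = cong inj₂ (⊖-injective x (paired-difference P P′
      (∼-cancelʳ (toℕ k + toℕ l) (subst₂ _∼_[ m ]
        (regroup q p′ (toℕ k) (toℕ l))
        (trans (regroup q′ p (toℕ l) (toℕ k)) (cong (q′ + p +_) (+-comm (toℕ l) (toℕ k))))
        (∼-+ q∼ (∼-trans (⊖-+ x l) (∼-sym (⊖-+ x k))))))))
      where
      p = x ⊖ k
      p′ = x ⊖ l
      q∼ : q + toℕ k ∼ q′ + toℕ l [ m ]
      q∼ = mod-injective (inj₂-injective (trans (sym (cong (shift k) eq)) (trans e (cong (shift l) eq′))))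
      regroup : ∀ q p k l → (q + k) + (p + l) ≡ q + p + (k + l)
      regroup = solve 4 (λ q p k l → (q :+ k) :+ (p :+ l) := q :+ p :+ (k :+ l)) refl

    vertex : Vtx → Fin (4 + m)
    vertex = join 4 m

    vertex-injective : ∀ {u v} → vertex u ≡ vertex v → u ≡ v
    vertex-injective {u} {v} e = trans (sym (Finₚ.splitAt-join 4 m u)) (trans (cong (splitAt 4) e) (Finₚ.splitAt-join 4 m v))

    matching : Colour → Mat (4 + m)
    mate        (matching c) v = vertex (opposite c (splitAt 4 v))
    involutive  (matching c) v = trans (cong (vertex ∘ opposite c) (Finₚ.splitAt-join 4 m _))
      (trans (cong vertex (opposite-involutive c (splitAt 4 v))) (Finₚ.join-splitAt 4 m v))
    irreflexive (matching c) v e = opposite-irreflexive c (splitAt 4 v)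
      (trans (sym (Finₚ.splitAt-join 4 m _)) (cong (splitAt 4) e))

    mate-vertex : ∀ c v → mate (matching c) (vertex v) ≡ vertex (opposite c v)
    mate-vertex c v = cong (vertex ∘ opposite c) (Finₚ.splitAt-join 4 m v)

    factors : Fin (3 + m) → Mat (4 + m)
    factors i = matching (splitAt 3 i)

    factors-disjoint : PairwiseDisjoint factors
    factors-disjoint {i} {j} i≢j (v , e) = i≢j (trans (sym (Finₚ.join-splitAt 3 m i))
      (trans (cong (join 3 m) (opposite-injective (splitAt 4 v) {splitAt 3 i} {splitAt 3 j}
        (vertex-injective {opposite (splitAt 3 i) (splitAt 4 v)} {opposite (splitAt 3 j) (splitAt 4 v)} e))) (Finₚ.join-splitAt 3 m j)))

    module _ {x₁ x₂ : Fin m} (x₁≡1 : toℕ x₁ ≡ 1) (x₂≡2 : toℕ x₂ ≡ 2) where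

      corners : List (Fin (4 + m))
      corners = vertex (inj₁ 1F) ∷ vertex (inj₁ 2F) ∷ vertex (inj₂ x₁) ∷ vertex (inj₂ x₂) ∷ []

      opposite-x₁ : ∀ {j y u} → step j true ≡ u → toℕ y ∼ 1 + u [ m ] → opposite (inj₁ j) (inj₂ x₁) ≡ inj₂ y
      opposite-x₁ {j} {y} {u} refl y∼ = cong inj₂ (toℕ-∼ (∼-trans (∼-mod (toℕ x₁ + step j (isOdd (toℕ x₁))))
        (∼-trans (∼-reflexive (cong (λ x → x + step j (isOdd x)) x₁≡1)) (∼-sym y∼))))

      -- The 4-cycle lies in the K₄, where colours 0F and 1F are two of its three matchings. The
      -- linked edge from 1 to 2 comes from the m-cycle; colour 0F pairs 1 with 0 instead.
      square : SquareFactorisation (3 + m) (factors 0F) (vertex (inj₁ 1F)) (vertex (inj₁ 2F)) (vertex (inj₂ x₁)) (vertex (inj₂ x₂))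
      square = record
        { factor = factors ; disjoint = λ {i} {j} → factors-disjoint {i} {j} ; i₁ = 0F ; i₂ = 1F ; i₁≢i₂ = λ ()
        ; first = λ _ → refl
        ; square-b = refl
        ; square-c = refl
        ; link = trans (mate-vertex (inj₁ 1F) (inj₂ x₁)) (cong vertex (opposite-x₁ {1F} {x₂} refl (∼-reflexive x₂≡2)))
        }

      private
        apart : ∀ i x → vertex (inj₁ i) ≢ vertex (inj₂ x)
        apart i x e with vertex-injective {inj₁ i} {inj₂ x} e
        ... | ()

        x₁≢x₂ : x₁ ≢ x₂
        x₁≢x₂ e = contradiction (trans (sym x₁≡1) (trans (cong toℕ e) x₂≡2)) λ ()

        x₁+-1∼0 : toℕ x₁ + step 0F (isOdd (toℕ x₁)) ∼ 0 [ m ]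
        x₁+-1∼0 = ∼-trans (∼-reflexive (cong (λ x → x + step 0F (isOdd x)) x₁≡1)) (∼-modulus {m} {0})

        mate-x₁≢x₂ : mate (factors 0F) (vertex (inj₂ x₁)) ≢ vertex (inj₂ x₂)
        mate-x₁≢x₂ e = contradiction (trans (sym (∼⇒≡ (Finₚ.toℕ<n x₂) (s≤s z≤n) (∼-trans (∼-sym x₂∼) x₁+-1∼0))) x₂≡2) λ ()
          where
          x₂∼ : toℕ x₁ + step 0F (isOdd (toℕ x₁)) ∼ toℕ x₂ [ m ]
          x₂∼ = mod≡⇒∼ (inj₂-injective
            (vertex-injective {opposite (inj₁ 0F) (inj₂ x₁)} {inj₂ x₂} (trans (sym (mate-vertex (inj₁ 0F) (inj₂ x₁))) e)))

      square-edges : InDistinctEdges (factors 0F) corners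
      square-edges =
          (((λ ()) , (λ ())) ∷ (apart 1F x₁ , apart 0F x₁) ∷ (apart 1F x₂ , apart 0F x₂) ∷ [])
        ∷ ((apart 2F x₁ , apart 3F x₁) ∷ (apart 2F x₂ , apart 3F x₂) ∷ [])
        ∷ ((x₁≢x₂ ∘ inj₂-injective ∘ vertex-injective {inj₂ x₁} {inj₂ x₂} , mate-x₁≢x₂) ∷ [])
        ∷ [] ∷ []

  -- Moving the model factorisation to an arbitrary matching and square

  module _ {N : ℕ} where

    commuting⇒stabilises : ∀ (τ : Permutation′ N) (X : Mat N) →
      (∀ v → τ ⟨$⟩ʳ mate X v ≡ mate X (τ ⟨$⟩ʳ v)) → τ • X ≈ X
    commuting⇒stabilises τ X comm v = trans (comm (τ ⟨$⟩ˡ v)) (cong (mate X) (Perm.inverseʳ τ))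

    -- The edges of `X` at `s` and `r` are exchanged as a whole, both pairs of ends at once, or one
    -- edge is reversed if `s` and `r` are its ends; vertices on other edges stay put.
    exchange : ∀ (X : Mat N) s r → ∃[ τ ] (τ • X ≈ X × τ ⟨$⟩ʳ s ≡ r ×
      (∀ {u} → u ≢ s → u ≢ r → mate X u ≢ s → mate X u ≢ r → τ ⟨$⟩ʳ u ≡ u))
    exchange X s r with s Finₚ.≟ r | mate X s Finₚ.≟ r
    ... | yes refl | _ = Perm.id , (λ _ → refl) , refl , λ _ _ _ _ → refl
    ... | no _ | yes Xs≡r = swap s r , swap-fixes X Xs≡r , transpose-left s r , λ u≢s u≢r _ _ → transpose-other u≢s u≢r
    ... | no s≢r | no Xs≢r = swap s r ∘ₚ swap s′ r′ , commuting⇒stabilises (swap s r ∘ₚ swap s′ r′) X comm , τs , τ-other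
      where
      s′ = mate X s
      r′ = mate X r
      Xr≢s : r′ ≢ s
      Xr≢s e = Xs≢r (mate-flip X e)
      τ : Fin N → Fin N
      τ u = PC.transpose s′ r′ (PC.transpose s r u)
      τs : τ s ≡ r
      τs = trans (cong (PC.transpose s′ r′) (transpose-left s r)) (transpose-other (Xs≢r ∘ sym) (irreflexive X r ∘ sym))
      τr : τ r ≡ s
      τr = trans (cong (PC.transpose s′ r′) (transpose-right s r)) (transpose-other (irreflexive X s ∘ sym) (Xr≢s ∘ sym))
      τs′ : τ s′ ≡ r′
      τs′ = trans (cong (PC.transpose s′ r′) (transpose-other (irreflexive X s) Xs≢r)) (transpose-left s′ r′)
      τr′ : τ r′ ≡ s′
      τr′ = trans (cong (PC.transpose s′ r′) (transpose-other Xr≢s (irreflexive X r))) (transpose-right s′ r′)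
      τ-other : ∀ {u} → u ≢ s → u ≢ r → mate X u ≢ s → mate X u ≢ r → τ u ≡ u
      τ-other u≢s u≢r Xu≢s Xu≢r = trans (cong (PC.transpose s′ r′) (transpose-other u≢s u≢r))
        (transpose-other (λ u≡s′ → Xu≢s (mate-flip X (sym u≡s′))) (λ u≡r′ → Xu≢r (mate-flip X (sym u≡r′))))
      comm : ∀ v → τ (mate X v) ≡ mate X (τ v)
      comm v = cases (v Finₚ.≟ s) (v Finₚ.≟ r) (mate X v Finₚ.≟ s) (mate X v Finₚ.≟ r)
        where
        cases : Dec (v ≡ s) → Dec (v ≡ r) → Dec (mate X v ≡ s) → Dec (mate X v ≡ r) → τ (mate X v) ≡ mate X (τ v)
        cases (yes refl) _ _ _ = trans τs′ (cong (mate X) (sym τs))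
        cases (no _) (yes refl) _ _ = trans τr′ (cong (mate X) (sym τr))
        cases (no _) (no _) (yes Xv≡s) _ = trans (cong τ Xv≡s) (trans τs (sym (trans
          (cong (mate X) (trans (cong τ (sym (mate-flip X Xv≡s))) τs′)) (involutive X r))))
        cases (no _) (no _) (no _) (yes Xv≡r) = trans (cong τ Xv≡r) (trans τr (sym (trans
          (cong (mate X) (trans (cong τ (sym (mate-flip X Xv≡r))) τr′)) (involutive X s))))
        cases (no v≢s) (no v≢r) (no Xv≢s) (no Xv≢r) = trans
          (τ-other Xv≢s Xv≢r (v≢s ∘ trans (sym (involutive X v))) (v≢r ∘ trans (sym (involutive X v))))
          (cong (mate X) (sym (τ-other v≢s v≢r Xv≢s Xv≢r)))

    -- The stabiliser of `X` moves its edges freely. Prescribed vertices are placed one at a time,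
    -- and correcting one of them does not disturb those already placed, since these lie on other
    -- edges.
    relabelling : ∀ (F X : Mat N) (l : List (Fin N × Fin N)) → InDistinctEdges F (map proj₁ l) → InDistinctEdges X (map proj₂ l) →
      ∃[ π ] (π • F ≈ X × All (λ e → π ⟨$⟩ʳ proj₁ e ≡ proj₂ e) l)
    relabelling F X [] _ _ = let π , e = •-transitive F X in π , e , []
    relabelling F X ((p , r) ∷ l) (dp ∷ dps) (dr ∷ drs) with relabelling F X l dps drs
    ... | π , πF≈X , πl with exchange X (π ⟨$⟩ʳ p) r
    ...   | τ , τX≈X , τs≡r , τ-other = π ∘ₚ τ ,
        ≈-trans {N} {τ • π • F} {τ • X} {X} (•-cong τ {π • F} {X} πF≈X) τX≈X , τs≡r ∷ kept l dp dr πl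
      where
      kept : ∀ l → All (λ u → p ≢ u × mate F p ≢ u) (map proj₁ l) → All (λ u → r ≢ u × mate X r ≢ u) (map proj₂ l) →
        All (λ e → π ⟨$⟩ʳ proj₁ e ≡ proj₂ e) l → All (λ e → τ ⟨$⟩ʳ (π ⟨$⟩ʳ proj₁ e) ≡ proj₂ e) l
      kept [] _ _ _ = []
      kept ((p′ , _) ∷ l) ((p≢p′ , Fp≢p′) ∷ dp) ((r≢r′ , Xr≢r′) ∷ dr) (refl ∷ πl) =
        τ-other (λ e → p≢p′ (sym (to-injective π e))) (r≢r′ ∘ sym)
          (λ e → Fp≢p′ (mate-flip F (to-injective π (trans (sym (mate-• π F p′)) (trans (πF≈X _) e)))))
          (λ e → Xr≢r′ (mate-flip X e))
        ∷ kept l dp dr πl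

    relabel-square : ∀ {K} {F X : Mat N} {b₀ c₀ y₀ z₀ b c y z} → SquareFactorisation K F b₀ c₀ y₀ z₀ →
      InDistinctEdges F (b₀ ∷ c₀ ∷ y₀ ∷ z₀ ∷ []) → InDistinctEdges X (b ∷ c ∷ y ∷ z ∷ []) →
      SquareFactorisation K X b c y z
    relabel-square {K} {F} {X} {b₀} {c₀} {y₀} {z₀} {b} {c} {y} {z} S dF dX
      with relabelling F X ((b₀ , b) ∷ (c₀ , c) ∷ (y₀ , y) ∷ (z₀ , z) ∷ []) dF dX
    ... | π , πF≈X , refl ∷ refl ∷ refl ∷ refl ∷ [] = record
      { factor   = λ i → π • factor i
      ; disjoint = λ {i} {j} i≢j → •-disjoint π {factor i} {factor j} (disjoint i≢j)
      ; i₁ = i₁ ; i₂ = i₂ ; i₁≢i₂ = i₁≢i₂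
      ; first    = ≈-trans {N} {π • factor i₁} {π • F} {X} (•-cong π {factor i₁} {F} first) πF≈X
      ; square-b = trans (mate-• π (factor i₂) b₀) (trans (cong (π ⟨$⟩ʳ_) square-b) (trans (sym (mate-• π F c₀)) (πF≈X _)))
      ; square-c = trans (mate-• π (factor i₂) c₀) (trans (cong (π ⟨$⟩ʳ_) square-c) (trans (sym (mate-• π F b₀)) (πF≈X _)))
      ; link     = trans (mate-• π (factor i₂) y₀) (cong (π ⟨$⟩ʳ_) link)
      }
      where open SquareFactorisation S

  -- The exact theorem for every n

  balanced-split : ∀ k → ∃[ a ] ∃[ b ] (a + b ≡ k × a ≤ suc b × b ≤ a)
  balanced-split zero = 0 , 0 , refl , z≤n , z≤n
  balanced-split (suc k) with balanced-split k
  ... | a , b , refl , a≤1+b , b≤a = suc b , a , cong suc (+-comm b a) , s≤s b≤a , a≤1+b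

  module _ {a b : ℕ} (a≤1+b : a ≤ suc b) (b≤a : b ≤ a) where
    open Starter a b a≤1+b b≤a using (m; h)
    open Factorisation a b a≤1+b b≤a

    private
      2<m : 2 < m
      2<m = ≤-trans (s≤s (s≤s (s≤s z≤n))) h<m
      x₁≡1 = Finₚ.toℕ-fromℕ< 1<m
      x₂≡2 = Finₚ.toℕ-fromℕ< 2<m

    square-factorisation : ∀ {N K} → 4 + m ≡ N → 3 + m ≡ K → ∀ (X : Mat N) {b c y z} →
      InDistinctEdges X (b ∷ c ∷ y ∷ z ∷ []) → SquareFactorisation K X b c y z
    square-factorisation refl refl X dX = relabel-square {X = X} (square x₁≡1 x₂≡2) (square-edges x₁≡1 x₂≡2) dX

    disjoint-pair : ∀ {N} → 4 + m ≡ N → ∃[ X ] ∃[ Y ] ¬ Meets {N} X Y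
    disjoint-pair refl = factors (Fin.zero) , factors (Fin.suc Fin.zero) , factors-disjoint {Fin.zero} {Fin.suc Fin.zero} (λ ())

  length-star≥1 : ∀ {N} {A : List (Mat N)} {X a b} → X ∈ A → mate X a ≡ b → 1 ≤ length (A ⟨ a ↦ b ⟩)
  length-star≥1 {A = A} {X} {a} {b} X∈ e with A ⟨ a ↦ b ⟩ | ∈-⟨⟩⁺ {B = A} X∈ e
  ... | _ ∷ _ | _ = s≤s z≤n

  -- The construction needs at least 8 vertices. On 2 vertices there is a single matching; on 4 and
  -- 6 vertices the bound of `star-split-≤` is 0 and 1, less than a star through one member, or
  -- through an edge shared by two, contains.
  stability-exact : ∀ n {N} → N ≡ 2 * suc n → {A : List (Mat N)} → Distinctₘ A → Intersecting A →
    [2 n -1]!! ≤ length A → InStar A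
  stability-exact 0 refl {A} _ _ _ = Fin.zero , Fin.suc Fin.zero , (λ ()) , All.tabulate (λ {X} _ → only X)
    where
    only : ∀ (X : Mat 2) → mate X Fin.zero ≡ Fin.suc Fin.zero
    only X with mate X Fin.zero in eq
    ... | Fin.zero         = contradiction eq (irreflexive X Fin.zero)
    ... | Fin.suc Fin.zero = refl
  stability-exact 1 refl {X ∷ A} distinct intersecting large with All.all? (λ Y → mate Y Fin.zero Finₚ.≟ mate X Fin.zero) (X ∷ A)
  ... | yes all = Fin.zero , mate X Fin.zero , irreflexive X Fin.zero ∘ sym , all
  ... | no ¬all = let Y , Y∈ , Yv≢ = not-all⇒member ¬all in
    contradiction (length-star≥1 {A = X ∷ A} {X} {Fin.zero} (here refl) refl)
      (<⇒≱ (s≤s (star-split-≤ {n = 0} refl {X ∷ A} distinct intersecting (irreflexive X Fin.zero ∘ sym) Y∈ Yv≢)))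
  stability-exact 2 refl {X ∷ []} distinct intersecting (s≤s ())
  stability-exact 2 refl {X ∷ Y ∷ A} distinct intersecting large with intersecting {X} {Y} (here refl) (there (here refl))
  ... | v , Xv≡Yv with All.all? (λ Z → mate Z v Finₚ.≟ mate X v) (X ∷ Y ∷ A)
  ...   | yes all = v , mate X v , irreflexive X v ∘ sym , all
  ...   | no ¬all = let Z , Z∈ , Zv≢ = not-all⇒member ¬all in
    contradiction two (<⇒≱ (s≤s (star-split-≤ {n = 1} refl {X ∷ Y ∷ A} distinct intersecting (irreflexive X v ∘ sym) Z∈ Zv≢)))
    where
    P? : ∀ (Z : Mat 6) → Dec (mate Z v ≡ mate X v)
    P? Z = mate Z v Finₚ.≟ mate X v
    two : 2 ≤ length ((X ∷ Y ∷ A) ⟨ v ↦ mate X v ⟩)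
    two = subst (λ L → 2 ≤ length L) (sym (trans (filter-accept P? refl) (cong (X ∷_) (filter-accept P? {Y} {A} (sym Xv≡Yv)))))
      (s≤s (s≤s z≤n))
  stability-exact (suc (suc (suc k))) N≡ {[]} distinct intersecting large = contradiction large (<⇒≱ ([2-1]!!>0 (3 + k)))
  stability-exact (suc (suc (suc k))) {N} N≡ {X ∷ A} distinct intersecting large with balanced-split k
  ... | a , b , refl , a≤1+b , b≤a =
    let X₀ , Y₀ , X₀∩Y₀=∅ = disjoint-pair {a} {b} a≤1+b b≤a 4+m≡N
    in extremal-star {n = suc (suc (a + b))} N≡ 6<N (square-factorisation a≤1+b b≤a 4+m≡N 3+m≡K) distinct intersecting large X₀ Y₀ X₀∩Y₀=∅ {X} (here refl)
    where
    4+m≡N : 4 + 2 * suc (suc (a + b)) ≡ N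
    4+m≡N = trans (solve 1 (λ k → con 4 :+ con 2 :* (con 2 :+ k) := con 2 :* (con 4 :+ k)) refl (a + b)) (sym N≡)
    3+m≡K : 3 + 2 * suc (suc (a + b)) ≡ 2 * suc (suc (suc (a + b))) + 1
    3+m≡K = solve 1 (λ k → con 3 :+ con 2 :* (con 2 :+ k) := con 2 :* (con 3 :+ k) :+ con 1) refl (a + b)
    6<N : 6 < N
    6<N = subst (6 <_) 4+m≡N (s≤s (s≤s (s≤s (s≤s (subst (3 ≤_) (*-comm (suc (suc (a + b))) 2) (s≤s (s≤s (s≤s z≤n))))))))

  -- Perfect matchings as involutions, and the choice of δ

  open import Data.Integer as ℤ using (+_)
  import Data.Integer.Properties as ℤₚ
  import Data.Rational as ℚ
  open import Data.Rational using (0ℚ; 1ℚ)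
  import Data.Rational.Properties as ℚₚ
  open import Data.Rational.Unnormalised as ℚᵘ using (mkℚᵘ)
  import Data.Rational.Unnormalised.Properties as ℚᵘₚ
  open import Defs

  module _ {N : ℕ} where

    lower≢upper : ∀ (e : Edge N) → lower e ≢ upper e
    lower≢upper (edge v w v<w) v≡w = Finₚ.<⇒≢ (recompute (v Finₚ.<? w) v<w) v≡w

    edge-≡ : ∀ {e e′ : Edge N} → lower e ≡ lower e′ → upper e ≡ upper e′ → e ≡ e′
    edge-≡ refl refl = refl

    otherEnd : ∀ {v} {e : Edge N} → v IsEndOf e → Fin N
    otherEnd {e = e} (inj₁ _) = upper e
    otherEnd {e = e} (inj₂ _) = lower e

    otherEnd-end : ∀ {v} {e : Edge N} (p : v IsEndOf e) → otherEnd {e = e} p IsEndOf e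
    otherEnd-end (inj₁ _) = inj₂ refl
    otherEnd-end (inj₂ _) = inj₁ refl

    otherEnd-≢ : ∀ {v} {e : Edge N} (p : v IsEndOf e) → otherEnd {e = e} p ≢ v
    otherEnd-≢ {e = e} (inj₁ refl) = lower≢upper e ∘ sym
    otherEnd-≢ {e = e} (inj₂ refl) = lower≢upper e

    otherEnd-unique : ∀ {v w} {e : Edge N} (p : v IsEndOf e) → w IsEndOf e → w ≢ v → otherEnd {e = e} p ≡ w
    otherEnd-unique (inj₁ refl) (inj₁ refl) w≢v = contradiction refl w≢v
    otherEnd-unique (inj₁ refl) (inj₂ refl) w≢v = refl
    otherEnd-unique (inj₂ refl) (inj₁ refl) w≢v = refl
    otherEnd-unique (inj₂ refl) (inj₂ refl) w≢v = contradiction refl w≢v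

    module _ (M : PerfectMatching N) where

      mateOf : Fin N → Fin N
      mateOf v = otherEnd {e = proj₁ (perfect M v)} (proj₂ (proj₁ (proj₂ (perfect M v))))

      mateOf-unique : ∀ {v w e} → edges M e → v IsEndOf e → w IsEndOf e → w ≢ v → mateOf v ≡ w
      mateOf-unique {v} {e = e} e∈ v∈e w∈e w≢v with perfect M v
      ... | e′ , (_ , p) , unique with unique (e∈ , v∈e)
      ...   | refl = otherEnd-unique {e = e} p w∈e w≢v

      toMat : Mat N
      mate        toMat = mateOf
      involutive  toMat v with perfect M v
      ... | e , (e∈ , p) , _ = mateOf-unique e∈ (otherEnd-end {e = e} p) p (otherEnd-≢ {e = e} p ∘ sym)
      irreflexive toMat v with perfect M v
      ... | e , (_ , p) , _ = otherEnd-≢ {e = e} p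

      edge⇒mate : ∀ {e} → edges M e → mateOf (lower e) ≡ upper e
      edge⇒mate {e} e∈ = mateOf-unique e∈ (inj₁ refl) (inj₂ refl) (lower≢upper e ∘ sym)

      mate⇒edge : ∀ {e} → mateOf (lower e) ≡ upper e → edges M e
      mate⇒edge {edge v w v<w} eq with perfect M v
      ... | edge _ _ _ , (e′∈ , inj₁ refl) , _ = subst (edges M) (edge-≡ refl eq) e′∈
      -- Here `v` is the upper end of its edge in `M`, so its partner `w` would lie below it.
      ... | edge _ _ v′<w′ , (_ , inj₂ refl) , _ = contradiction (recompute (v Finₚ.<? w) v<w)
        (subst (λ u → ¬ v Data.Fin.< u) eq (Finₚ.<-asym (recompute (_ Finₚ.<? v) v′<w′)))

  module _ {n : ℕ} where

    toMats-distinct : ∀ {A : List (Vertex n)} → Distinct n A → Distinctₘ (map toMat A)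
    toMats-distinct = AllPairsₚ.map⁺ ∘ AllPairs.map λ {M} {M′} M≠M′ M≈M′ → M≠M′
      ( (λ {e} e∈ → mate⇒edge M′ (trans (sym (M≈M′ _)) (edge⇒mate M e∈)))
      , (λ {e} e∈ → mate⇒edge M (trans (M≈M′ _) (edge⇒mate M′ e∈))))

    toMats-intersecting : ∀ {A : List (Vertex n)} → Independent n A → Intersecting (map toMat A)
    toMats-intersecting independent X∈ Y∈ with ∈-map⁻ toMat X∈ | ∈-map⁻ toMat Y∈
    ... | M , M∈ , refl | M′ , M′∈ , refl with Finₚ.any? (λ v → mateOf M v Finₚ.≟ mateOf M′ v)
    ...   | yes meet = meet
    ...   | no ¬meet = contradiction
      (λ e (e∈ , e∈′) → ¬meet (lower e , trans (edge⇒mate M e∈) (sym (edge⇒mate M′ e∈′))))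
      (independent M∈ M′∈)

    star⇒Star : ∀ {A : List (Vertex n)} → InStar (map toMat A) → ∃[ e ] All (Star n e) A
    star⇒Star {A} (a , b , a≢b , all) with Finₚ.<-cmp a b
    ... | tri< a<b _ _ = edge a b a<b , All.map (λ {M} → mate⇒edge M) (Allₚ.map⁻ all)
    ... | tri≈ _ a≡b _ = contradiction a≡b a≢b
    ... | tri> _ _ b<a = edge b a b<a , All.map (λ {M} e → mate⇒edge M (mate-flip (toMat M) e)) (Allₚ.map⁻ all)

  -- On unnormalised fractions the inequality is by definition one of cross products, so no common
  -- divisors have to be tracked.
  scaled-≤ : ∀ k d a → (1ℚ ℚ.- ℚ.fromℚᵘ (mkℚᵘ (+ 1) k)) ℚ.* (+ d ℚ./ 1) ℚ.≤ + a ℚ./ 1 → k * d ≤ suc k * a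
  scaled-≤ k d a ineq = clear (ℚᵘₚ.≤-respʳ-≃ (ℚₚ.toℚᵘ-fromℚᵘ (mkℚᵘ (+ a) 0)) (ℚᵘₚ.≤-respˡ-≃ unnormalise (ℚₚ.toℚᵘ-mono-≤ ineq)))
    where
    δ = ℚ.fromℚᵘ (mkℚᵘ (+ 1) k)
    unnormalise : ℚ.toℚᵘ ((1ℚ ℚ.- δ) ℚ.* (+ d ℚ./ 1)) ℚᵘ.≃ (ℚᵘ.1ℚᵘ ℚᵘ.- mkℚᵘ (+ 1) k) ℚᵘ.* mkℚᵘ (+ d) 0
    unnormalise = ℚᵘₚ.≃-trans (ℚₚ.toℚᵘ-homo-* (1ℚ ℚ.- δ) (+ d ℚ./ 1)) (ℚᵘₚ.*-cong
      (ℚᵘₚ.≃-trans (ℚₚ.toℚᵘ-homo-+ 1ℚ (ℚ.- δ)) (ℚᵘₚ.+-cong {ℚ.toℚᵘ 1ℚ} ℚᵘₚ.≃-refl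
        (ℚᵘₚ.≃-trans (ℚₚ.toℚᵘ-homo‿- δ) (ℚᵘₚ.-‿cong (ℚₚ.toℚᵘ-fromℚᵘ (mkℚᵘ (+ 1) k))))))
      (ℚₚ.toℚᵘ-fromℚᵘ (mkℚᵘ (+ d) 0)))
    clear : (ℚᵘ.1ℚᵘ ℚᵘ.- mkℚᵘ (+ 1) k) ℚᵘ.* mkℚᵘ (+ d) 0 ℚᵘ.≤ mkℚᵘ (+ a) 0 → k * d ≤ suc k * a
    clear (ℚᵘ.*≤* p) = ℤₚ.drop‿+≤+ (subst₂ ℤ._≤_ left right p)
      where
      left : (+ (k + 0) ℤ.* + d) ℤ.* + 1 ≡ + (k * d)
      left = trans (ℤₚ.*-identityʳ _) (trans (sym (ℤₚ.pos-* (k + 0) d)) (cong (λ x → + (x * d)) (+-identityʳ k)))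
      right : + a ℤ.* + ((suc k + 0) * 1) ≡ + (suc k * a)
      right = trans (sym (ℤₚ.pos-* a ((suc k + 0) * 1))) (cong +_ (trans (*-comm a ((suc k + 0) * 1))
        (cong (_* a) (trans (*-identityʳ (suc k + 0)) (+-identityʳ (suc k))))))

  [2-1]!!-mono : ∀ {m n} → m ≤′ n → [2 m -1]!! ≤ [2 n -1]!!
  [2-1]!!-mono ≤′-refl = ≤-refl
  [2-1]!!-mono {m} (≤′-step {n} m≤n) = ≤-trans ([2-1]!!-mono m≤n)
    (subst (λ x → [2 n -1]!! ≤ x * [2 n -1]!!) (+-comm 1 (2 * n)) (m≤m+n [2 n -1]!! (2 * n * [2 n -1]!!)))

  exact-from-scaled : ∀ {k d a} → d ≤ k → k * d ≤ suc k * a → d ≤ a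
  exact-from-scaled {k} {d} {a} d≤k ineq = ≮⇒≥ λ a<d → <⇒≱ (+-cancelʳ-< (suc k) (suc k * a) (k * d) (begin-strict
    suc k * a + suc k          ≡⟨ +-comm (suc k * a) (suc k) ⟩
    suc k + suc k * a          ≡⟨ sym (*-suc (suc k) a) ⟩
    suc k * suc a              ≤⟨ *-monoʳ-≤ (suc k) a<d ⟩
    d + k * d                  ≡⟨ +-comm d (k * d) ⟩
    k * d + d                  <⟨ +-monoʳ-< (k * d) (s≤s d≤k) ⟩
    k * d + suc k              ∎)) ineq
    where open ≤-Reasoning

  quarter-from-scaled : ∀ {k d a} → 3 ≤ k → k * d ≤ suc k * a → 3 * d ≤ 4 * a
  quarter-from-scaled {k} {d} {a} 3≤k ineq = *-cancelˡ-≤ (suc k) (begin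
    suc k * (3 * d)            ≡⟨ solve 2 (λ k d → (con 1 :+ k) :* (con 3 :* d) := con 3 :* d :+ con 3 :* (k :* d)) refl k d ⟩
    3 * d + 3 * (k * d)        ≤⟨ +-monoˡ-≤ (3 * (k * d)) (*-monoˡ-≤ d 3≤k) ⟩
    k * d + 3 * (k * d)        ≤⟨ *-monoʳ-≤ 4 ineq ⟩
    4 * (suc k * a)            ≡⟨ solve 2 (λ k a → con 4 :* (k :* a) := k :* (con 4 :* a)) refl (suc k) a ⟩
    suc k * (4 * a)            ∎)
    where open ≤-Reasoning

  -- With δ = 1/(k + 1), a size within δ of (2n − 3)!! is at least (2n − 3)!! as long as the latter does not exceed k.
  stability : ∀ n₀ k → 3 ≤ k → [2 n₀ -1]!! ≤ k →
    (∀ {N n} → n₀ ≤ suc (suc n) → N ≡ 2 * suc (suc n) → {A : List (Mat N)} → Distinctₘ A → Intersecting A →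
      3 * [2 suc n -1]!! ≤ 4 * length A → InStar A) →
    ∀ n {N} → N ≡ 2 * suc n → {A : List (Mat N)} → Distinctₘ A → Intersecting A →
      k * [2 n -1]!! ≤ suc k * length A → InStar A
  stability n₀ k 3≤k d₀≤k large zero N≡ distinct intersecting ineq =
    stability-exact zero N≡ distinct intersecting (exact-from-scaled (≤-trans (s≤s z≤n) 3≤k) ineq)
  stability n₀ k 3≤k d₀≤k large (suc n) N≡ distinct intersecting ineq with n₀ ≤? suc (suc n)
  ... | yes n₀≤ = large n₀≤ N≡ distinct intersecting (quarter-from-scaled 3≤k ineq)
  ... | no n₀≰  = stability-exact (suc n) N≡ distinct intersecting
    (exact-from-scaled (≤-trans ([2-1]!!-mono (≤⇒≤′ (≤-trans (n≤1+n (suc n)) (<⇒≤ (≰⇒> n₀≰))))) d₀≤k) ineq)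

  scaled-stability : ∀ n₀ →
    (∀ {N n} → n₀ ≤ suc (suc n) → N ≡ 2 * suc (suc n) → {A : List (Mat N)} → Distinctₘ A → Intersecting A →
      3 * [2 suc n -1]!! ≤ 4 * length A → InStar A) →
    ∃[ δ ] (0ℚ ℚ.< δ × ((n : ℕ) .{{_ : NonZero n}} (A : List (Vertex n)) → Distinct n A → Independent n A →
      (1ℚ ℚ.- δ) ℚ.* (+ [2 (n ∸ 1) -1]!! ℚ./ 1) ℚ.≤ + length A ℚ./ 1 → ∃[ e ] All (Star n e) A))
  scaled-stability n₀ large = ℚ.fromℚᵘ (mkℚᵘ (+ 1) k) , δ>0 , star
    where
    -- The summand 3 makes 1 - δ at least 3/4, as large n requires; the double factorial forces the
    -- exact bound for all n below `n₀`.
    k = 3 + [2 n₀ -1]!!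
    δ>0 : 0ℚ ℚ.< ℚ.fromℚᵘ (mkℚᵘ (+ 1) k)
    δ>0 = ℚₚ.toℚᵘ-cancel-< (ℚᵘₚ.<-respʳ-≃ (ℚᵘₚ.≃-sym (ℚₚ.toℚᵘ-fromℚᵘ (mkℚᵘ (+ 1) k))) (ℚᵘ.*<* (ℤ.+<+ (s≤s z≤n))))
    star : (n : ℕ) .{{_ : NonZero n}} (A : List (Vertex n)) → Distinct n A → Independent n A →
      (1ℚ ℚ.- ℚ.fromℚᵘ (mkℚᵘ (+ 1) k)) ℚ.* (+ [2 (n ∸ 1) -1]!! ℚ./ 1) ℚ.≤ + length A ℚ./ 1 → ∃[ e ] All (Star n e) A
    star (suc n) A distinct independent ineq = star⇒Star {suc n} {A} (stability n₀ k (m≤m+n 3 _) (m≤n+m _ 3) large n refl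
      (toMats-distinct {suc n} distinct) (toMats-intersecting {suc n} independent)
      (subst (λ l → k * [2 n -1]!! ≤ suc k * l) (sym (length-map toMat A)) (scaled-≤ k [2 n -1]!! (length A) ineq)))

open import Defs
open import Data.Nat using (ℕ; NonZero; _∸_)
open import Data.Integer using (+_)
open import Data.Rational using (ℚ; 0ℚ; 1ℚ; _<_; _≤_; _-_; _*_; _/_)
open import Data.List using (List; length)
open import Data.List.Relation.Unary.All using (All)
open import Data.Product using (∃-syntax; _×_)

theorem1p9 : ∃[ δ ] (0ℚ < δ × ((n : ℕ) .{{_ : NonZero n}} (A : List (Vertex n)) → Distinct n A → Independent n A →
    (1ℚ - δ) * (+ [2 (n ∸ 1) -1]!! / 1) ≤ + length A / 1 →
    ∃[ e ] All (Star n e) A))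
theorem1p9 = Matchings.scaled-stability 1024 Matchings.stability-large
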